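{- The decision problem Strong Geodetic (given a graph $G$ and a positive integer $k$, decide whether $G$ has a strong geodetic set $S$ with $|S|\le k$), restricted to chordal graphs $G$ of diameter $2$, is NP-complete.
   Context: All graphs are finite, simple, undirected and connected. A graph is chordal if it has no induced cycle of length at least $4$. The diameter of $G$ is the greatest distance between two of its vertices. A shortest path assignment $I(S)$ of a vertex set $S\subseteq V(G)$ consists of exactly one chosen shortest path of $G$ between $u$ and $v$ for each unordered pair of distinct vertices $u,v\in S$. The set $S$ is a strong geodetic set of $G$ if there is a shortest path assignment $I(S)$ such that every vertex of $V(G)\setminus S$ lies on some path of $I(S)$ (for $|S|\ge 2$ this is the same as $\bigcup_{P\in I(S)}V(P)=V(G)$). -}

module Defs where

open import Data.Bool.Base using (Bool; true; false)
open import Data.Fin.Base using (Fin; zero; toℕ; _↑ʳ_) renaming (_<_ to _<ᶠ_)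
open import Data.Fin.Subset using (Subset; _∈_; _∉_; ∣_∣)
open import Data.List.Base using (List; []; _∷_; _++_; foldr; length; replicate; concatMap; map; allFin)
open import Data.List.Membership.Propositional using () renaming (_∈_ to _∈ˡ_)
open import Data.List.Relation.Unary.Unique.Propositional using (Unique)
open import Data.Maybe.Base using (Maybe; just; nothing)
open import Data.Nat.Base using (ℕ; suc; _+_; _*_; _≤_)
open import Data.Nat.Binary.Base using (ℕᵇ; 2[1+_]; 1+[2_]; fromℕ)
open import Data.Product.Base using (Σ; ∃-syntax; _×_; _,_)
open import Data.Sum.Base using (_⊎_)
open import Data.Vec.Base as Vec using (Vec; []; _∷_; lookup; zipWith)
open import Function.Bundles using (_⇔_)
open import Function.Definitions using (Injective)
open import Relation.Binary.PropositionalEquality using (_≡_)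
open import Relation.Nullary.Negation using (¬_)

Word : Set
Word = List Bool

-- A finite tape alphabet: the blank, the two bits and any fixed number of
-- further symbols.
data Symbol (a : ℕ) : Set where
  blank : Symbol a
  bit   : Bool → Symbol a
  extra : Fin a → Symbol a

data Move : Set where
  left stay right : Move

-- A two-way infinite tape.  Both lists are ordered outwards from the head,
-- and every cell beyond their ends is blank.
record Tape (a : ℕ) : Set where
  constructor tape
  field
    leftOf  : List (Symbol a)
    head    : Symbol a
    rightOf : List (Symbol a)

moveHead : ∀ {a} → Move → Tape a → Tape a
moveHead left  (tape []       s rs)       = tape [] blank (s ∷ rs)
moveHead left  (tape (l ∷ ls) s rs)       = tape ls l (s ∷ rs)
moveHead stay  t                          = t
moveHead right (tape ls       s [])       = tape (s ∷ ls) blank []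
moveHead right (tape ls       s (r ∷ rs)) = tape (s ∷ ls) r rs

writeMove : ∀ {a} → Tape a → Symbol a × Move → Tape a
writeMove (tape ls _ rs) (s , m) = moveHead m (tape ls s rs)

emptyTape : ∀ {a} → Tape a
emptyTape = tape [] blank []

wordTape : ∀ {a} → Word → Tape a
wordTape []       = emptyTape
wordTape (b ∷ bs) = tape [] (bit b) (map bit bs)

bitPrefix : ∀ {a} → List (Symbol a) → Word
bitPrefix (bit b ∷ ss) = b ∷ bitPrefix ss
bitPrefix _            = []

-- The word starting under the head and extending to the right up to the
-- first cell that does not hold a bit.
readTape : ∀ {a} → Tape a → Word
readTape (tape _ s rs) = bitPrefix (s ∷ rs)

-- Deterministic machines with m input tapes, followed by an output tape and
-- any number of work tapes.  The machine halts when δ returns nothing.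
record Machine (m : ℕ) : Set where
  field
    aux    : ℕ
    work   : ℕ
    states : ℕ

  tapes : ℕ
  tapes = m + suc work

  field
    start : Fin states
    δ     : Fin states → Vec (Symbol aux) tapes →
            Maybe (Fin states × Vec (Symbol aux × Move) tapes)

  Config : Set
  Config = Fin states × Vec (Tape aux) tapes

  initial : Vec Word m → Config
  initial ws = start , Vec.map wordTape ws Vec.++ Vec.replicate (suc work) emptyTape

  output : Config → Word
  output (_ , ts) = readTape (lookup ts (m ↑ʳ zero))

  step : Config → Maybe Config
  step (q , ts) with δ q (Vec.map Tape.head ts)
  ... | nothing         = nothing
  ... | just (q′ , acts) = just (q′ , zipWith writeMove ts acts)

  -- c ⇓[ t ] d : started in c, the machine halts in d after exactly t steps.
  data _⇓[_]_ : Config → ℕ → Config → Set where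
    halt : ∀ {c} → step c ≡ nothing → c ⇓[ 0 ] c
    next : ∀ {c c′ d t} → step c ≡ just c′ → c′ ⇓[ t ] d → c ⇓[ suc t ] d

-- Coefficients, constant term first.
Polynomial : Set
Polynomial = List ℕ

eval : Polynomial → ℕ → ℕ
eval p x = foldr (λ c r → c + x * r) 0 p

size : ∀ {m} → Vec Word m → ℕ
size ws = Vec.sum (Vec.map length ws)

PolyTime : ∀ {m} → (Vec Word m → Word) → Set
PolyTime {m} f =
  Σ (Machine m) λ M → let open Machine M in
  ∃[ p ] ∀ ws → ∃[ t ] ∃[ d ]
    initial ws ⇓[ t ] d × t ≤ eval p (size ws) × output d ≡ f ws

Language : Set₁
Language = Word → Set

NP : Language → Set
NP L =
  ∃[ V ] PolyTime {2} V × ∃[ p ]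
  (∀ w → L w ⇔ (∃[ y ] length y ≤ eval p (length w) × V (w ∷ y ∷ []) ≡ true ∷ []))

record DecisionProblem : Set₁ where
  field
    Instance : Set
    encode   : Instance → Word
    Yes      : Instance → Set

  language : Language
  language w = ∃[ i ] encode i ≡ w × Yes i

-- Every value of the reduction has to encode an instance, so for a restricted
-- problem the hardness cannot come from recognising which words encode
-- instances.
NPHard : DecisionProblem → Set₁
NPHard P =
  ∀ (L : Language) → NP L →
  Σ (Word → Word) λ f →
    PolyTime {1} (λ ws → f (Vec.head ws)) ×
    (∀ w → (∃[ i ] encode i ≡ f w) × (L w ⇔ language (f w)))
  where open DecisionProblem P

NPComplete : DecisionProblem → Set₁
NPComplete P = NP (DecisionProblem.language P) × NPHard P

record Graph : Set where
  field
    order   : ℕ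
    adj     : Fin order → Fin order → Bool
    adj-sym : ∀ u v → adj u v ≡ adj v u
    irrefl  : ∀ v → adj v v ≡ false

  Vertex : Set
  Vertex = Fin order

  Adj : Vertex → Vertex → Set
  Adj u v = adj u v ≡ true

module _ (G : Graph) where
  open Graph G

  data Walk : Vertex → Vertex → ℕ → Set where
    []     : ∀ {u} → Walk u u 0
    _∷_    : ∀ {u v w l} → Adj u v → Walk v w l → Walk u w (suc l)

  vertices : ∀ {u v l} → Walk u v l → List Vertex
  vertices {u} []      = u ∷ []
  vertices {u} (_ ∷ p) = u ∷ vertices p

  Path : Vertex → Vertex → ℕ → Set
  Path u v l = Σ (Walk u v l) λ p → Unique (vertices p)

  Connected : Set
  Connected = ∀ u v → ∃[ l ] Path u v l

  Distance : Vertex → Vertex → ℕ → Set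
  Distance u v d = Path u v d × (∀ l → Path u v l → d ≤ l)

  ShortestPath : Vertex → Vertex → Set
  ShortestPath u v = ∃[ l ] Path u v l × (∀ l′ → Path u v l′ → l ≤ l′)

  pathVertices : ∀ {u v} → ShortestPath u v → List Vertex
  pathVertices (_ , (p , _) , _) = vertices p

  HasDiameter : ℕ → Set
  HasDiameter d =
    (∀ u v → ∃[ e ] Distance u v e × e ≤ d) × (∃[ u ] ∃[ v ] Distance u v d)

  CyclicSuc : ∀ {m} → Fin m → Fin m → Set
  CyclicSuc {m} i j = toℕ j ≡ suc (toℕ i) ⊎ (suc (toℕ i) ≡ m × toℕ j ≡ 0)

  InducedCycle : ℕ → Set
  InducedCycle m =
    Σ (Fin m → Vertex) λ c → Injective _≡_ _≡_ c ×
      (∀ i j → Adj (c i) (c j) ⇔ (CyclicSuc i j ⊎ CyclicSuc j i))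

  Chordal : Set
  Chordal = ∀ m → 4 ≤ m → ¬ InducedCycle m

  -- The unordered pair {u , v} is represented by u < v; the proofs of
  -- membership and of u < v are unique, so each pair gets exactly one path.
  ShortestPathAssignment : Subset order → Set
  ShortestPathAssignment S =
    ∀ u v → u ∈ S → v ∈ S → u <ᶠ v → ShortestPath u v

  StrongGeodeticSet : Subset order → Set
  StrongGeodeticSet S =
    Σ (ShortestPathAssignment S) λ I →
    ∀ x → x ∉ S →
    ∃[ u ] ∃[ v ] Σ (u ∈ S) λ u∈S → Σ (v ∈ S) λ v∈S → Σ (u <ᶠ v) λ u<v →
      x ∈ˡ pathVertices (I u v u∈S v∈S u<v)

-- Bijective base-2 notation, least significant digit first.
binary : ℕᵇ → Word
binary ℕᵇ.zero  = []
binary 2[1+ b ] = true ∷ binary b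
binary 1+[2 b ] = false ∷ binary b

-- The order in unary with a terminator, the adjacency matrix row by row, and
-- k in binary.
encodeGraphNumber : Graph → ℕ → Word
encodeGraphNumber G k =
  replicate order true ++ false ∷
  concatMap (λ u → map (adj u) (allFin order)) (allFin order) ++
  binary (fromℕ k)
  where open Graph G

record StrongGeodeticInstance (C : Graph → Set) : Set where
  field
    graph     : Graph
    connected : Connected graph
    inClass   : C graph
    k         : ℕ
    positive  : 1 ≤ k

StrongGeodetic : (Graph → Set) → DecisionProblem
StrongGeodetic C = record
  { Instance = StrongGeodeticInstance C
  ; encode   = λ i → encodeGraphNumber (graph i) (k i)
  ; Yes      = λ i → ∃[ S ] StrongGeodeticSet (graph i) S × ∣ S ∣ ≤ k i
  }
  where open StrongGeodeticInstance

{-# OPTIONS --safe #-}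
-- Hardness.  The computation of a verifier on (w , y) is described by a CNF
-- formula about the cells of its tapes, with positions counted from the heads:
-- a move shifts the whole tape, so no variable records where a head is.  As the
-- machine is deterministic, the clauses only have to propagate facts from the
-- start to the end; the one real choice is the certificate y.  Satisfiability
-- with B variables and B clauses is the question whether B literals can hit all
-- pairs {x , ¬x} and all clauses.  The graph has a clique of literals, a vertex
-- for every pair and every clause that is adjacent to its literals, a pendant
-- leaf at each of these 4 B vertices, and a universal vertex.  It is chordal
-- (leaves, sets, literals, universal vertex is an elimination order).  Leaves
-- lie in every strong geodetic set, and a set vertex outside of it can only be
-- covered by a path from its leaf to a literal; so 5 B vertices suffice if and
-- only if the formula is satisfiable.
--
-- Membership.  A certificate consists of the set S, of the middle vertices of
-- the chosen paths and, for any two nonadjacent neighbours b and c of a vertex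
-- a, of a set of vertices showing that no path from b to c avoids the rest of
-- the closed neighbourhood of a, which is equivalent to chordality.
--
-- Machines.  Both algorithms are terms of a small language of bounded sums and
-- iterations, whose polynomial bounds can be read off.  A number is stored as
-- the distance of a head from a mark, so that counting takes one step.

module Submission where

open import Data.Bool.Base using (Bool; true; false; if_then_else_; T)
import Data.Bool.Properties as 𝔹
open import Data.Empty using (⊥)
open import Data.Fin.Base using (Fin; zero; suc; toℕ; fromℕ<; _↑ˡ_; _↑ʳ_; splitAt; combine; remQuot; inject₁) renaming (_<_ to _<ᶠ_)
open import Data.Fin.Properties using (splitAt-↑ˡ; splitAt-↑ʳ; remQuot-combine; combine-remQuot; toℕ-combine; toℕ-↑ʳ; toℕ<n; toℕ-injective; toℕ-fromℕ<; fromℕ<-toℕ; combine-injective)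
import Data.Fin.Properties as 𝔽
open import Data.Fin.Subset using (Subset; ∣_∣) renaming (_∈_ to _∈ˢ_; _∉_ to _∉ˢ_)
open import Data.Fin.Subset.Properties using (∣p∣≤n; _∈?_)
open import Data.List.Base as List using (List; []; _∷_; _++_; length; concatMap; replicate; allFin)
open import Data.List.Membership.Propositional using () renaming (_∈_ to _∈ˡ_)
open import Data.List.Membership.Propositional.Properties using (∈-allFin; ∈-map⁺; ∈-map⁻; ∈-++⁺ˡ; ∈-++⁺ʳ; ∈-++⁻; ∈-cartesianProduct⁺; ∈-lookup)
open import Data.List.Properties using (++-assoc; ++-identityʳ; map-tabulate; length-++; length-replicate; length-tabulate; tabulate-cong; length-drop; ∷-injectiveˡ)
open import Data.List.Relation.Unary.All using ([]; _∷_)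
open import Data.List.Relation.Unary.AllPairs.Core using ([]; _∷_)
open import Data.List.Relation.Unary.Any using (here; there)
import Data.List.Relation.Unary.Any as Any
import Data.List.Relation.Unary.Any.Properties as Any
open import Data.Maybe.Base as Maybe using (Maybe; just; nothing; maybe′)
open import Data.Nat.Base hiding (less; equal; greater)
open import Data.Nat.Binary.Base using (ℕᵇ; 2[1+_]; 1+[2_])
import Data.Nat.Binary.Base as ℕᵇ
import Data.Nat.Binary.Properties as ℕᵇ
open import Data.Nat.Induction using (<-rec)
open import Data.Nat.Properties
open import Data.Nat.Tactic.RingSolver using (solve-∀)
open import Data.Product.Base using (Σ; ∃; ∃-syntax; _×_; _,_; proj₁; proj₂; map₂)
open import Data.Sum.Base using (_⊎_; inj₁; inj₂; [_,_]′)
open import Data.Unit.Base using (⊤; tt)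
open import Data.Vec.Base as Vec using (Vec; []; _∷_; here; there)
open import Data.Vec.Properties using (lookup-map; lookup-zipWith; lookup∘tabulate; []≔-updates; []≔-minimal; lookup∘updateAt′; tabulate∘lookup; []=⇒lookup; lookup⇒[]=; lookup-replicate) renaming (tabulate-cong to Vec-tabulate-cong)
open import Data.Vec.Properties.WithK using ([]=-irrelevant)
open import Defs
open import Function.Base using (_∘_; id; case_of_; _$_)
open import Function.Bundles using (_⇔_; mk⇔; Equivalence)
open import Function.Definitions using (Injective)
open import Relation.Binary.Definitions using (tri<; tri≈; tri>)
open import Relation.Binary.PropositionalEquality using (_≡_; _≢_; refl; sym; trans; cong; cong₂; subst; subst₂; module ≡-Reasoning)
open import Relation.Nullary.Decidable using (_×-dec_; _⊎-dec_; dec-true; dec-false; map′; ¬?)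
open import Relation.Nullary.Decidable.Core using (Dec; yes; no; does)
open import Relation.Nullary.Negation using (¬_; contradiction)

-- Structured programs for Turing machines

-- Membership cannot rest on a promise: a word that encodes no graph of the class has to be
-- rejected. So chordality needs a certificate, although by its definition it is the failure of
-- chordality, an induced cycle, that has a short witness. Diameter 2 simplifies the notion: a
-- chosen path matters only through one common neighbour of a nonadjacent pair; in the reduction the
-- universal vertex provides this.
--
-- The budget 5 B consists of 4 B leaves and of B disjoint groups, each made of x, ¬x and the pair
-- vertex of x. Every strong geodetic set contains the leaves and meets each group, so nothing is
-- left for a clause vertex or for a second literal of a variable. Variables and clauses share the
-- bound B because both are numbered by triples of a time, a position and a rule.
--
-- The hardness map has to come from an actual machine, so the adjacency of the graph is itself the
-- value of a formula of the term language, and the verifier is another such formula. Values are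
-- kept in unary and must stay polynomial; the number k of an input, being binary, may be larger and
-- is therefore never evaluated, only compared digit by digit.

Symbols : ℕ → Set
Symbols n = Vec (Symbol 0) n

Actions : ℕ → Set
Actions n = Vec (Symbol 0 × Move) n

Tapes : ℕ → Set
Tapes n = Vec (Tape 0) n

data Prog (n : ℕ) : Set where
  act   : (Symbols n → Actions n) → Prog n
  _⨾_   : Prog n → Prog n → Prog n
  while : (Symbols n → Bool) → Prog n → Prog n

infixr 5 _⨾_

module _ {n : ℕ} where

  card : Prog n → ℕ
  card (act _)     = 1
  card (p ⨾ q)     = card p + card q
  card (while _ p) = suc (card p)

  entry : (p : Prog n) → Fin (card p)
  entry (act _)     = zero
  entry (p ⨾ q)     = entry p ↑ˡ card q
  entry (while _ _) = zero

  idle : Symbols n → Actions n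
  idle = Vec.map (_, stay)

  -- The next state is nothing when the program is left.
  control : (p : Prog n) → Fin (card p) → Symbols n → Actions n × Maybe (Fin (card p))
  control (act f) _ h = f h , nothing
  control (p ⨾ q) i h = [ fromP , fromQ ]′ (splitAt (card p) i)
    where
    fromP : Fin (card p) → Actions n × Maybe (Fin (card p + card q))
    fromP j = map₂ (just ∘ maybe′ (_↑ˡ card q) (card p ↑ʳ entry q)) (control p j h)
    fromQ : Fin (card q) → Actions n × Maybe (Fin (card p + card q))
    fromQ j = map₂ (Maybe.map (card p ↑ʳ_)) (control q j h)
  -- State `zero` tests the guard and leaves the tapes alone; leaving the body leads back to it, as
  -- the default value of `maybe′ suc zero`.
  control (while b p) zero    h = idle h , (if b h then just (suc (entry p)) else nothing)
  control (while b p) (suc i) h = map₂ (just ∘ maybe′ suc zero) (control p i h)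

  heads : Tapes n → Symbols n
  heads = Vec.map Tape.head

  apply : Tapes n → Actions n → Tapes n
  apply = Vec.zipWith writeMove

  infix 4 _⊢_,_↝[_]_

  data _⊢_,_↝[_]_ (p : Prog n) : Fin (card p) → Tapes n → ℕ → Tapes n → Set where
    leave : ∀ {i ts as} → control p i (heads ts) ≡ (as , nothing) →
            p ⊢ i , ts ↝[ 1 ] apply ts as
    hop    : ∀ {i j ts ts′ as t} → control p i (heads ts) ≡ (as , just j) →
            p ⊢ j , apply ts as ↝[ t ] ts′ → p ⊢ i , ts ↝[ suc t ] ts′

  ⨾-right : ∀ p {q j ts t ts′} → q ⊢ j , ts ↝[ t ] ts′ → p ⨾ q ⊢ card p ↑ʳ j , ts ↝[ t ] ts′
  ⨾-right p {q} {j} {ts} (leave e) = leave (eq e)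
    where
    eq : ∀ {as} → control q j (heads ts) ≡ (as , nothing) →
         control (p ⨾ q) (card p ↑ʳ j) (heads ts) ≡ (as , nothing)
    eq e rewrite splitAt-↑ʳ (card p) (card q) j | e = refl
  ⨾-right p {q} {j} {ts} (hop e r) = hop (eq e) (⨾-right p r)
    where
    eq : ∀ {as k} → control q j (heads ts) ≡ (as , just k) →
         control (p ⨾ q) (card p ↑ʳ j) (heads ts) ≡ (as , just (card p ↑ʳ k))
    eq e rewrite splitAt-↑ʳ (card p) (card q) j | e = refl

  ⨾-left : ∀ {p q i ts t ts′ t′ ts″} → p ⊢ i , ts ↝[ t ] ts′ → q ⊢ entry q , ts′ ↝[ t′ ] ts″ →
           p ⨾ q ⊢ i ↑ˡ card q , ts ↝[ t + t′ ] ts″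
  ⨾-left {p} {q} {i} {ts} (leave e) s = hop (eq e) (⨾-right p s)
    where
    eq : ∀ {as} → control p i (heads ts) ≡ (as , nothing) →
         control (p ⨾ q) (i ↑ˡ card q) (heads ts) ≡ (as , just (card p ↑ʳ entry q))
    eq e rewrite splitAt-↑ˡ (card p) i (card q) | e = refl
  ⨾-left {p} {q} {i} {ts} (hop e r) s = hop (eq e) (⨾-left r s)
    where
    eq : ∀ {as k} → control p i (heads ts) ≡ (as , just k) →
         control (p ⨾ q) (i ↑ˡ card q) (heads ts) ≡ (as , just (k ↑ˡ card q))
    eq e rewrite splitAt-↑ˡ (card p) i (card q) | e = refl

  while-body : ∀ {b p i ts t ts′ t′ ts″} → p ⊢ i , ts ↝[ t ] ts′ →
               while b p ⊢ zero , ts′ ↝[ t′ ] ts″ → while b p ⊢ suc i , ts ↝[ t + t′ ] ts″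
  while-body (leave e) s = hop (cong (map₂ (just ∘ maybe′ suc zero)) e) s
  while-body (hop e r)  s = hop (cong (map₂ (just ∘ maybe′ suc zero)) e) (while-body r s)

  apply-idle : ∀ ts → apply ts (idle (heads ts)) ≡ ts
  apply-idle ts = lemma ts
    where
    lemma : ∀ {k} (us : Vec (Tape 0) k) → Vec.zipWith writeMove us (Vec.map (_, stay) (Vec.map Tape.head us)) ≡ us
    lemma []       = refl
    lemma (u ∷ us) = cong (u ∷_) (lemma us)

  while-done : ∀ {b} p {ts} → b (heads ts) ≡ false → while b p ⊢ zero , ts ↝[ 1 ] ts
  while-done {b} p {ts} e = subst (while b p ⊢ zero , ts ↝[ 1 ]_) (apply-idle ts)
    (leave (cong (λ c → idle (heads ts) , (if c then just (suc (entry p)) else nothing)) e))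

  while-more : ∀ {b p ts t ts′ t′ ts″} → b (heads ts) ≡ true → p ⊢ entry p , ts ↝[ t ] ts′ →
               while b p ⊢ zero , ts′ ↝[ t′ ] ts″ → while b p ⊢ zero , ts ↝[ suc (t + t′) ] ts″
  while-more {b} {p} {ts} {t} e r s =
    hop (cong (λ c → idle (heads ts) , (if c then just (suc (entry p)) else nothing)) e)
       (subst (λ us → while b p ⊢ suc (entry p) , us ↝[ _ ] _) (sym (apply-idle ts)) (while-body r s))

module _ (m work : ℕ) (p : Prog (m + suc work)) where

  -- The additional state `zero` is the halting state: leaving the program becomes a move to it, so
  -- the number of steps does not change.
  compiled : Machine m
  compiled = record
    { aux = 0 ; work = work ; states = suc (card p) ; start = suc (entry p) ; δ = δ }
    where
    δ : Fin (suc (card p)) → Symbols (m + suc work) →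
        Maybe (Fin (suc (card p)) × Actions (m + suc work))
    δ zero    _ = nothing
    δ (suc i) h = just (maybe′ suc zero (proj₂ (control p i h)) , proj₁ (control p i h))

  open Machine compiled using (_⇓[_]_; halt; next)

  compiled-run : ∀ {i ts t ts′} → p ⊢ i , ts ↝[ t ] ts′ → (suc i , ts) ⇓[ t ] (zero , ts′)
  compiled-run {i} {ts} (leave e) = next (cong (λ r → just (maybe′ suc zero (proj₂ r) , apply ts (proj₁ r))) e) (halt refl)
  compiled-run {i} {ts} (hop e r)  = next (cong (λ r → just (maybe′ suc zero (proj₂ r) , apply ts (proj₁ r))) e) (compiled-run r)

-- Registers

nth : ∀ {A : Set} {n} → A → Vec A n → ℕ → A
nth z []       _       = z
nth z (x ∷ xs) zero    = x
nth z (x ∷ xs) (suc i) = nth z xs i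

nth-lookup : ∀ {A : Set} {n} {z : A} (xs : Vec A n) i → nth z xs (toℕ i) ≡ Vec.lookup xs i
nth-lookup (x ∷ xs) zero    = refl
nth-lookup (x ∷ xs) (suc i) = nth-lookup xs i

nth-map : ∀ {A B : Set} {n} {z : A} (f : A → B) (xs : Vec A n) i → nth (f z) (Vec.map f xs) i ≡ f (nth z xs i)
nth-map f []       i       = refl
nth-map f (x ∷ xs) zero    = refl
nth-map f (x ∷ xs) (suc i) = nth-map f xs i

nth-apply : ∀ {n} (ts : Tapes n) (f : ℕ → Symbol 0 × Move) {r} → r < n →
            nth emptyTape (apply ts (Vec.tabulate (f ∘ toℕ))) r ≡ writeMove (nth emptyTape ts r) (f r)
nth-apply (t ∷ ts) f {zero}  _         = refl
nth-apply (t ∷ ts) f {suc r} (s≤s r<n) = nth-apply ts (f ∘ suc) r<n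

cellAt : ∀ {a} → List (Symbol a) → ℕ → Symbol a
cellAt []       _       = blank
cellAt (s ∷ ss) zero    = s
cellAt (s ∷ ss) (suc i) = cellAt ss i

-- B holds the cells of a tape from its origin to the right; At B p says that
-- the tape carries B and that the head is p cells to the right of the origin.
Behind : (ℕ → Symbol 0) → ℕ → List (Symbol 0) → Set
Behind B zero    _        = ⊤
Behind B (suc p) []       = ⊥
Behind B (suc p) (l ∷ ls) = l ≡ B p × Behind B p ls

record At (B : ℕ → Symbol 0) (p : ℕ) (t : Tape 0) : Set where
  constructor atPos
  field
    headAt  : Tape.head t ≡ B p
    aheadAt : ∀ i → cellAt (Tape.rightOf t) i ≡ B (suc (p + i))
    behind  : Behind B p (Tape.leftOf t)

at-right : ∀ {B p t} → At B p t → At B (suc p) (moveHead right t)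
at-right {B} {p} {tape ls s []} (atPos h a b) =
  atPos (trans (a 0) (cong (B ∘ suc) (+-identityʳ p)))
        (λ i → trans (a (suc i)) (cong (B ∘ suc) (+-suc p i))) (h , b)
at-right {B} {p} {tape ls s (r ∷ rs)} (atPos h a b) =
  atPos (trans (a 0) (cong (B ∘ suc) (+-identityʳ p)))
        (λ i → trans (a (suc i)) (cong (B ∘ suc) (+-suc p i))) (h , b)

at-left : ∀ {B p t} → At B (suc p) t → At B p (moveHead left t)
at-left {B} {p} {tape (l ∷ ls) s rs} (atPos h a (l≡ , b)) = atPos l≡ ahead b
  where
  ahead : ∀ i → cellAt (s ∷ rs) i ≡ B (suc (p + i))
  ahead zero    = trans h (cong (B ∘ suc) (sym (+-identityʳ p)))
  ahead (suc i) = trans (a i) (cong (B ∘ suc) (sym (+-suc p i)))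

wordCells : ∀ {a} → Word → ℕ → Symbol a
wordCells w = cellAt (List.map bit w)

-- The mark at the origin is the zero of a counter, so `isBlank` of the scanned symbol tests whether
-- the value is positive.
counterCells : ℕ → Symbol 0
counterCells zero    = bit true
counterCells (suc _) = blank

wordTape-at : ∀ w → At (wordCells w) 0 (wordTape w)
wordTape-at []      = atPos refl (λ _ → refl) tt
wordTape-at (b ∷ w) = atPos refl (λ _ → refl) tt

upd : (ℕ → ℕ) → ℕ → ℕ → ℕ → ℕ
upd σ r v r′ with r′ ≟ r
... | yes _ = v
... | no  _ = σ r′

upd-same : ∀ σ r v → upd σ r v r ≡ v
upd-same σ r v with r ≟ r
... | yes _ = refl
... | no  n = contradiction refl n

upd-other : ∀ σ {r} v {r′} → r′ ≢ r → upd σ r v r′ ≡ σ r′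
upd-other σ {r} v {r′} n with r′ ≟ r
... | yes e = contradiction e n
... | no  _ = refl

infix 4 _≗_
_≗_ : (ℕ → ℕ) → (ℕ → ℕ) → Set
σ ≗ τ = ∀ r → σ r ≡ τ r

upd-self : ∀ σ {r v} → σ r ≡ v → upd σ r v ≗ σ
upd-self σ {r} e r′ with r′ ≟ r
... | yes refl = sym e
... | no  _    = refl

upd-cong : ∀ {σ τ} r {v w} → σ ≗ τ → v ≡ w → upd σ r v ≗ upd τ r w
upd-cong r e v≡w r′ with r′ ≟ r
... | yes _ = v≡w
... | no  _ = e r′

upd-upd : ∀ σ r v w → upd (upd σ r v) r w ≗ upd σ r w
upd-upd σ r v w r′ with r′ ≟ r
... | yes _ = refl
... | no  n = upd-other σ v n

upd-comm : ∀ σ {r s} v w → r ≢ s → upd (upd σ r v) s w ≗ upd (upd σ s w) r v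
upd-comm σ {r} {s} v w r≢s r′ with r′ ≟ s
... | yes refl = sym (trans (upd-other _ v (r≢s ∘ sym)) (upd-same σ s w))
... | no  n    with r′ ≟ r
...   | yes _ = refl
...   | no  _ = sym (upd-other σ w n)

≗-trans : ∀ {σ τ υ} → σ ≗ τ → τ ≗ υ → σ ≗ υ
≗-trans e f r = trans (e r) (f r)

isBlank isBit isOne : Symbol 0 → Bool
isBlank blank   = true
isBlank _       = false
isBit (bit _)   = true
isBit _         = false
isOne (bit b)   = b
isOne _         = false

module Registers (m work : ℕ) where

  n : ℕ
  n = m + suc work

  m<n : m < n
  m<n = m<m+n m (s≤s z≤n)

  action : ((ℕ → Symbol 0) → ℕ → Symbol 0 × Move) → Prog n
  action g = act λ h → Vec.tabulate (g (nth blank h) ∘ toℕ)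

  shiftBy : Move → ℕ → (Symbol 0 → Bool) → ℕ → (ℕ → Symbol 0) → ℕ → Symbol 0 × Move
  shiftBy d q c r h r′ with r′ ≟ r
  ... | yes _ = h r′ , (if c (h q) then d else stay)
  ... | no  _ = h r′ , stay

  shift : Move → ℕ → (Symbol 0 → Bool) → ℕ → Prog n
  shift d q c r = action (shiftBy d q c r)

  skip : Prog n
  skip = action λ h r → h r , stay

  inc dec : ℕ → Prog n
  inc r = shift right r (λ _ → true) r
  dec r = shift left r (λ _ → true) r

  whileReg : ℕ → (Symbol 0 → Bool) → Prog n → Prog n
  whileReg q c p = while (λ h → c (nth blank h q)) p

  loop : ℕ → Prog n → Prog n
  loop q p = whileReg q isBlank (dec q ⨾ p)

  -- Words are output from the end to the beginning: loops count down, and the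
  -- output head needs no rewinding.
  prepend : ℕ → (Symbol 0 → Bool) → Prog n
  prepend q c = action λ h r → if r ≡ᵇ m then (bit (c (h q)) , left) else (h r , stay)

  module _ (ws : Vec Word m) where

    cells : ℕ → ℕ → Symbol 0
    cells r = if m <ᵇ r then counterCells else wordCells (nth [] ws r)

    cells-counter : ∀ {r} → m < r → cells r ≡ counterCells
    cells-counter {r} lt with m <ᵇ r | <⇒<ᵇ lt
    ... | true | _ = refl

    cells-input : ∀ j → cells (toℕ {m} j) ≡ wordCells (Vec.lookup ws j)
    cells-input j with m <ᵇ toℕ j in e
    ... | true  = contradiction (<ᵇ⇒< m (toℕ j) (subst T (sym e) tt)) (<-asym (toℕ<n j))
    ... | false = cong wordCells (nth-lookup ws j)

    -- The output register `m` is no counter: its head rests on the blank to the left of the word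
    -- written so far.
    record Rep (σ : ℕ → ℕ) (o : Word) (ts : Tapes n) : Set where
      constructor rep
      field
        regs : ∀ r → r < n → r ≢ m → At (cells r) (σ r) (nth emptyTape ts r)
        outp : nth emptyTape ts m ≡ tape [] blank (List.map bit o)

    record Reg (r : ℕ) : Set where
      constructor reg
      field
        r<n : r < n
        r≢m : r ≢ m

    Runs : Prog n → (ℕ → ℕ) → Word → (ℕ → ℕ) → Word → ℕ → Set
    Runs p σ o σ′ o′ b = ∀ ts → Rep σ o ts →
      ∃[ t ] ∃[ ts′ ] (p ⊢ entry p , ts ↝[ t ] ts′) × Rep σ′ o′ ts′ × t ≤ b

    rep-cong : ∀ {σ τ o ts} → σ ≗ τ → Rep σ o ts → Rep τ o ts
    rep-cong {ts = ts} e (rep r o) =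
      rep (λ i i<n i≢m → subst (λ v → At (cells i) v (nth emptyTape ts i)) (e i) (r i i<n i≢m)) o

    weaken : ∀ {p σ o τ o′ b c} → b ≤ c → Runs p σ o τ o′ b → Runs p σ o τ o′ c
    weaken b≤c f ts R = let (t , ts′ , r , R′ , t≤b) = f ts R in t , ts′ , r , R′ , ≤-trans t≤b b≤c

    before : ∀ {p σ σ′ o τ o′ b} → σ ≗ σ′ → Runs p σ′ o τ o′ b → Runs p σ o τ o′ b
    before e f ts R = f ts (rep-cong e R)

    after : ∀ {p σ o τ τ′ o′ b} → τ ≗ τ′ → Runs p σ o τ o′ b → Runs p σ o τ′ o′ b
    after e f ts R = let (t , ts′ , r , R′ , t≤b) = f ts R in t , ts′ , r , rep-cong e R′ , t≤b

    after-out : ∀ {p σ o τ o′ o″ b} → o′ ≡ o″ → Runs p σ o τ o′ b → Runs p σ o τ o″ b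
    after-out refl f = f

    infixr 5 _⨾ʳ_
    _⨾ʳ_ : ∀ {p q σ o τ o′ υ o″ b c} → Runs p σ o τ o′ b → Runs q τ o′ υ o″ c → Runs (p ⨾ q) σ o υ o″ (b + c)
    (f ⨾ʳ g) ts R =
      let (t  , ts′ , r , R′ , t≤b) = f ts R
          (t′ , ts″ , s , R″ , t′≤c) = g ts′ R′
      in t + t′ , ts″ , ⨾-left r s , R″ , +-mono-≤ t≤b t′≤c

    symbol : ∀ {σ o ts q} → Reg q → Rep σ o ts → nth blank (heads ts) q ≡ cells q (σ q)
    symbol {ts = ts} {q} (reg q<n q≢m) R =
      trans (nth-map Tape.head ts q) (At.headAt (Rep.regs R q q<n q≢m))

    while-exit : ∀ {q c p σ o} → Reg q → c (cells q (σ q)) ≡ false → Runs (whileReg q c p) σ o σ o 1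
    while-exit {c = c} {p} Q e ts R = 1 , ts , while-done p (trans (cong c (symbol Q R)) e) , R , ≤-refl

    while-step : ∀ {q c p σ o τ o′ υ o″ b d} → Reg q → c (cells q (σ q)) ≡ true → Runs p σ o τ o′ b →
                 Runs (whileReg q c p) τ o′ υ o″ d → Runs (whileReg q c p) σ o υ o″ (suc (b + d))
    while-step {c = c} Q e f g ts R =
      let (t  , ts′ , r , R′ , t≤b) = f ts R
          (t′ , ts″ , s , R″ , t′≤d) = g ts′ R′
      in suc (t + t′) , ts″ , while-more (trans (cong c (symbol Q R)) e) r s , R″ , s≤s (+-mono-≤ t≤b t′≤d)

    action-runs : ∀ g {σ o τ o′} →
      (∀ ts → Rep σ o ts → (∀ r → r < n → r ≢ m → At (cells r) (τ r) (writeMove (nth emptyTape ts r) (g (nth blank (heads ts)) r)))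
                         × writeMove (nth emptyTape ts m) (g (nth blank (heads ts)) m) ≡ tape [] blank (List.map bit o′)) →
      Runs (action g) σ o τ o′ 1
    action-runs g {τ = τ} step ts R = 1 , apply ts as , leave refl ,
      rep (λ r r<n r≢m → subst (At (cells r) (τ r)) (sym (nth-apply ts f r<n)) (proj₁ (step ts R) r r<n r≢m))
          (trans (nth-apply ts f m<n) (proj₂ (step ts R))) , ≤-refl
      where
      f  = g (nth blank (heads ts))
      as = Vec.tabulate (f ∘ toℕ)

    rewrite-idle : ∀ (ts : Tapes n) r → writeMove (nth emptyTape ts r) (nth blank (heads ts) r , stay) ≡ nth emptyTape ts r
    rewrite-idle ts r = cong (λ s → writeMove (nth emptyTape ts r) (s , stay)) (nth-map Tape.head ts r)

    skip-runs : ∀ {σ o} → Runs skip σ o σ o 1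
    skip-runs {σ} = action-runs (λ h r → h r , stay) λ ts R →
      (λ r r<n r≢m → subst (At (cells r) (σ r)) (sym (rewrite-idle ts r)) (Rep.regs R r r<n r≢m)) ,
      trans (rewrite-idle ts m) (Rep.outp R)

    shift-runs : ∀ d {q c r v σ o} → Reg q → Reg r →
      (∀ t → At (cells r) (σ r) t → At (cells r) v (moveHead (if c (cells q (σ q)) then d else stay) t)) →
      Runs (shift d q c r) σ o (upd σ r v) o 1
    shift-runs d {q} {c} {r} {v} {σ} {o} Q (reg _ r≢m) moved = action-runs (shiftBy d q c r) λ ts R → regs ts R , out ts R
      where
      regs : ∀ ts → Rep σ o ts → ∀ r′ → r′ < n → r′ ≢ m →
             At (cells r′) (upd σ r v r′) (writeMove (nth emptyTape ts r′) (shiftBy d q c r (nth blank (heads ts)) r′))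
      regs ts R r′ r′<n r′≢m with r′ ≟ r
      ... | yes refl rewrite nth-map {z = emptyTape} Tape.head ts r | symbol Q R = moved _ (Rep.regs R r r′<n r′≢m)
      ... | no _ = subst (At (cells r′) (σ r′)) (sym (rewrite-idle ts r′)) (Rep.regs R r′ r′<n r′≢m)
      out : ∀ ts → Rep σ o ts →
            writeMove (nth emptyTape ts m) (shiftBy d q c r (nth blank (heads ts)) m) ≡ tape [] blank (List.map bit o)
      out ts R with m ≟ r
      ... | yes e = contradiction (sym e) r≢m
      ... | no  _ = trans (rewrite-idle ts m) (Rep.outp R)

    inc-runs : ∀ {r v σ o} → Reg r → σ r ≡ v → Runs (inc r) σ o (upd σ r (suc v)) o 1
    inc-runs R refl = shift-runs right R R λ _ → at-right

    dec-runs : ∀ {r v σ o} → Reg r → σ r ≡ suc v → Runs (dec r) σ o (upd σ r v) o 1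
    dec-runs {r} R e = shift-runs left R R λ t a → at-left (subst (λ k → At (cells r) k t) e a)

    incIf-runs : ∀ {q c r v σ o} → Reg q → Reg r → σ r ≡ v →
      Runs (shift right q c r) σ o (upd σ r (if c (cells q (σ q)) then suc v else v)) o 1
    incIf-runs {q} {c} {r} {v} {σ} Q R refl = shift-runs right Q R λ t a → lemma t a
      where
      lemma : ∀ t → At (cells r) v t → At (cells r) (if c (cells q (σ q)) then suc v else v) (moveHead (if c (cells q (σ q)) then right else stay) t)
      lemma t a with c (cells q (σ q))
      ... | true  = at-right a
      ... | false = a

    Counter : ℕ → Set
    Counter r = m < r × r < n

    ctr : ∀ {r} → Counter r → Reg r
    ctr (m<r , r<n) = reg r<n λ { refl → <-irrefl refl m<r }

    -- The head moves left only from a blank, that is from a positive value; on the mark it stays,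
    -- which makes the subtraction truncated.
    monus-runs : ∀ {r v σ o} → Counter r → σ r ≡ v → Runs (shift left r isBlank r) σ o (upd σ r (v ∸ 1)) o 1
    monus-runs {r} {v} {σ} R refl = shift-runs left (ctr R) (ctr R) λ t a → lemma t v a
      where
      lemma : ∀ t v → At (cells r) v t → At (cells r) (v ∸ 1) (moveHead (if isBlank (cells r v) then left else stay) t)
      lemma t v a rewrite cells-counter (proj₁ R) with v
      ... | zero  = a
      ... | suc _ = at-left a

    prepend-runs : ∀ {q c σ o} → Reg q → Runs (prepend q c) σ o σ (c (cells q (σ q)) ∷ o) 1
    prepend-runs {q} {c} {σ} {o} Q = action-runs g λ ts R → regs ts R , out ts R
      where
      g : (ℕ → Symbol 0) → ℕ → Symbol 0 × Move
      g h r = if r ≡ᵇ m then (bit (c (h q)) , left) else (h r , stay)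
      regs : ∀ ts → Rep σ o ts → ∀ r → r < n → r ≢ m → At (cells r) (σ r) (writeMove (nth emptyTape ts r) (g (nth blank (heads ts)) r))
      regs ts R r r<n r≢m with r ≡ᵇ m in e
      ... | true  = contradiction (≡ᵇ⇒≡ r m (subst T (sym e) tt)) r≢m
      ... | false = subst (At (cells r) (σ r)) (sym (rewrite-idle ts r)) (Rep.regs R r r<n r≢m)
      out : ∀ ts → Rep σ o ts → writeMove (nth emptyTape ts m) (g (nth blank (heads ts)) m) ≡ tape [] blank (List.map bit (c (cells q (σ q)) ∷ o))
      out ts R with m ≡ᵇ m | ≡⇒≡ᵇ m m refl
      ... | true | _ rewrite Rep.outp R | symbol Q R = refl

    loop-exit : ∀ {q p σ o} → Counter q → σ q ≡ 0 → Runs (loop q p) σ o σ o 1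
    loop-exit {q} {σ = σ} Q e = while-exit {c = isBlank} (ctr Q) (cong isBlank (trans (cong (cells q) e) (cong (_$ 0) (cells-counter (proj₁ Q)))))

    loop-step : ∀ {q p k σ o τ o′ υ o″ b d} → Counter q → σ q ≡ suc k → Runs p (upd σ q k) o τ o′ b →
                Runs (loop q p) τ o′ υ o″ d → Runs (loop q p) σ o υ o″ (suc (suc b + d))
    loop-step {q} {k = k} Q e f g =
      while-step {c = isBlank} (ctr Q) (cong isBlank (trans (cong (cells q) e) (cong (_$ suc k) (cells-counter (proj₁ Q)))))
        (dec-runs (ctr Q) e ⨾ʳ f) g

-- Arithmetic terms

data Tm (m : ℕ) : ℕ → Set where
  var   : ∀ {Γ} → Fin Γ → Tm m Γ
  wk    : ∀ {Γ} → Tm m Γ → Tm m (suc Γ)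
  ren   : ∀ {Γ Δ} → Vec (Fin Δ) Γ → Tm m Γ → Tm m Δ
  lit   : ∀ {Γ} → ℕ → Tm m Γ
  len   : ∀ {Γ} → Fin m → Tm m Γ
  digit : ∀ {Γ} → Fin m → Tm m Γ → Tm m Γ
  _⊕_   : ∀ {Γ} → Tm m Γ → Tm m Γ → Tm m Γ
  _⊖_   : ∀ {Γ} → Tm m Γ → Tm m Γ → Tm m Γ
  _⊗_   : ∀ {Γ} → Tm m Γ → Tm m Γ → Tm m Γ
  sum   : ∀ {Γ} → Tm m Γ → Tm m (suc Γ) → Tm m Γ
  iter  : ∀ {Γ} → Tm m Γ → Tm m Γ → Tm m (suc (suc Γ)) → Tm m Γ

infixl 6 _⊕_ _⊖_
infixl 7 _⊗_

sumBelow : ℕ → (ℕ → ℕ) → ℕ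
sumBelow zero    f = 0
sumBelow (suc k) f = f k + sumBelow k f

-- The body yields an amount to be subtracted, so the value never exceeds the initial one. This
-- keeps `bound` polynomial; iterating an arbitrary body, such as doubling, could reach exponential
-- values.
countdown : ℕ → (ℕ → ℕ → ℕ) → ℕ → ℕ
countdown zero    g x = x
countdown (suc k) g x = countdown k g (x ∸ g k x)

-- 0 beyond the end of the word, 1 for false, 2 for true.
digitOf : Word → ℕ → ℕ
digitOf []          _       = 0
digitOf (false ∷ _) zero    = 1
digitOf (true  ∷ _) zero    = 2
digitOf (_ ∷ w)     (suc i) = digitOf w i

⟦_⟧ : ∀ {m Γ} → Tm m Γ → Vec Word m → Vec ℕ Γ → ℕ
⟦ var i ⟧      ws ρ = Vec.lookup ρ i
⟦ wk t ⟧       ws ρ = ⟦ t ⟧ ws (Vec.tail ρ)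
⟦ ren is t ⟧   ws ρ = ⟦ t ⟧ ws (Vec.map (Vec.lookup ρ) is)
⟦ lit c ⟧      ws ρ = c
⟦ len j ⟧      ws ρ = length (Vec.lookup ws j)
⟦ digit j t ⟧  ws ρ = digitOf (Vec.lookup ws j) (⟦ t ⟧ ws ρ)
⟦ t ⊕ u ⟧      ws ρ = ⟦ t ⟧ ws ρ + ⟦ u ⟧ ws ρ
⟦ t ⊖ u ⟧      ws ρ = ⟦ t ⟧ ws ρ ∸ ⟦ u ⟧ ws ρ
⟦ t ⊗ u ⟧      ws ρ = ⟦ t ⟧ ws ρ * ⟦ u ⟧ ws ρ
⟦ sum t b ⟧    ws ρ = sumBelow (⟦ t ⟧ ws ρ) λ i → ⟦ b ⟧ ws (i ∷ ρ)
⟦ iter c t b ⟧ ws ρ = countdown (⟦ c ⟧ ws ρ) (λ i x → ⟦ b ⟧ ws (i ∷ x ∷ ρ)) (⟦ t ⟧ ws ρ)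

-- A bound both for the value of the term and for the running time of its program, when all
-- variables and input lengths are at most `N`. The factors 3 and 4 are the steps of a loop round
-- that updates one or two registers: a test, a decrement and the updates.
bound : ∀ {m Γ} → Tm m Γ → ℕ → ℕ
bound (var _)      N = (N * 4 + 1) + (N * 3 + 1)
bound (wk t)       N = bound t N
bound (ren _ t)    N = bound t N
bound (lit c)      N = c + 1
bound (len _)      N = (N * 4 + 1) + (N * 3 + 1)
bound (digit _ t)  N = bound t N + ((bound t N * 4 + 1) + (1 + (1 + (bound t N * 3 + 1))))
bound (t ⊕ u)      N = bound t N + bound u N
bound (t ⊖ u)      N = bound t N + (bound u N + ((bound u N * 3 + 1) + (bound t N * 3 + 1)))
bound (t ⊗ u)      N = bound t N + (bound t N * (2 + bound u (N + bound t N)) + 1)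
bound (sum t b)    N = bound t N + (bound t N * (2 + bound b (N + bound t N)) + 1)
bound (iter c t b) N = bound t N + (bound c N + ((bound c N * (2 + (B + (B * 3 + 1))) + 1) + (bound t N * 3 + 1)))
  where B = bound b (N + bound t N + bound c N)

-- The number of scratch registers, counted from `d`, that suffice for `compile`.
need : ∀ {m Γ} → Tm m Γ → ℕ
need (var _)      = 1
need (wk t)       = need t
need (ren _ t)    = need t
need (lit _)      = 0
need (len _)      = 1
need (digit _ t)  = 2 + need t
need (t ⊕ u)      = need t + need u
need (t ⊖ u)      = 2 + (need t + need u)
need (t ⊗ u)      = 1 + (need t + need u)
need (sum t b)    = 1 + (need t + need b)
need (iter c t b) = 3 + (need t + (need c + need b))

countdown-≤ : ∀ k g x → countdown k g x ≤ x
countdown-≤ zero    g x = ≤-refl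
countdown-≤ (suc k) g x = ≤-trans (countdown-≤ k g (x ∸ g k x)) (m∸n≤m x (g k x))

sumBelow-≤ : ∀ k {f b} → (∀ i → i < k → f i ≤ b) → sumBelow k f ≤ k * b
sumBelow-≤ zero    h = z≤n
sumBelow-≤ (suc k) h = +-mono-≤ (h k ≤-refl) (sumBelow-≤ k λ i i<k → h i (m≤n⇒m≤1+n i<k))

digitOf-≤ : ∀ w i → digitOf w i ≤ 2
digitOf-≤ []          _       = z≤n
digitOf-≤ (false ∷ _) zero    = s≤s z≤n
digitOf-≤ (true  ∷ _) zero    = ≤-refl
digitOf-≤ (false ∷ w) (suc i) = digitOf-≤ w i
digitOf-≤ (true ∷ w)  (suc i) = digitOf-≤ w i

record Bounded {m Γ} (ws : Vec Word m) (ρ : Vec ℕ Γ) (N : ℕ) : Set where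
  constructor bounded
  field
    vars : ∀ i → Vec.lookup ρ i ≤ N
    lens : ∀ j → length (Vec.lookup ws j) ≤ N

bounded-∷ : ∀ {m Γ} {ws : Vec Word m} {ρ : Vec ℕ Γ} {N v M} → Bounded ws ρ N → v ≤ M → Bounded ws (v ∷ ρ) (N + M)
bounded-∷ {N = N} {M = M} (bounded vs ls) v≤M = bounded
  (λ { zero → ≤-trans v≤M (m≤n+m M N) ; (suc i) → ≤-trans (vs i) (m≤m+n N M) })
  (λ j → ≤-trans (ls j) (m≤m+n N M))

bounded-tail : ∀ {m Γ} {ws : Vec Word m} {ρ : Vec ℕ (suc Γ)} {N} → Bounded ws ρ N → Bounded ws (Vec.tail ρ) N
bounded-tail {ρ = _ ∷ _} (bounded vs ls) = bounded (vs ∘ suc) ls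

bounded-ren : ∀ {m Γ Δ} {ws : Vec Word m} {ρ : Vec ℕ Δ} {N} (is : Vec (Fin Δ) Γ) → Bounded ws ρ N →
              Bounded ws (Vec.map (Vec.lookup ρ) is) N
bounded-ren {ρ = ρ} is (bounded vs ls) = bounded (λ i → subst (_≤ _) (sym (lookup-map i (Vec.lookup ρ) is)) (vs (Vec.lookup is i))) ls

⟦⟧-bounded : ∀ {m Γ} (t : Tm m Γ) {ws ρ N} → Bounded ws ρ N → ⟦ t ⟧ ws ρ ≤ bound t N
⟦⟧-bounded (var i) {N = N} b = ≤-trans (Bounded.vars b i) (≤-trans (m≤m*n N 4) (≤-trans (m≤m+n (N * 4) 1) (m≤m+n _ _)))
⟦⟧-bounded (wk t) b = ⟦⟧-bounded t (bounded-tail b)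
⟦⟧-bounded (ren is t) b = ⟦⟧-bounded t (bounded-ren is b)
⟦⟧-bounded (lit c) b = m≤m+n c 1
⟦⟧-bounded (len j) {N = N} b = ≤-trans (Bounded.lens b j) (≤-trans (m≤m*n N 4) (≤-trans (m≤m+n (N * 4) 1) (m≤m+n _ _)))
⟦⟧-bounded (digit j t) {ws} {ρ} {N} b = ≤-trans (digitOf-≤ (Vec.lookup ws j) _)
  (≤-trans (+-mono-≤ (m≤n+m 1 (bound t N * 4)) (m≤m+n 1 _)) (m≤n+m _ (bound t N)))
⟦⟧-bounded (t ⊕ u) b = +-mono-≤ (⟦⟧-bounded t b) (⟦⟧-bounded u b)
⟦⟧-bounded (t ⊖ u) {ws} {ρ} b = ≤-trans (m∸n≤m _ (⟦ u ⟧ ws ρ)) (≤-trans (⟦⟧-bounded t b) (m≤m+n _ _))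
⟦⟧-bounded (t ⊗ u) {ws} {ρ} {N} b = ≤-trans
  (*-mono-≤ (⟦⟧-bounded t b) (≤-trans (⟦⟧-bounded u (bounded-tail (bounded-∷ {v = 0} b z≤n))) (m≤n+m _ 2)))
  (≤-trans (m≤m+n _ 1) (m≤n+m _ (bound t N)))
⟦⟧-bounded (sum t u) {ws} {ρ} {N} b = ≤-trans
  (sumBelow-≤ (⟦ t ⟧ ws ρ) λ i i<k → ⟦⟧-bounded u (bounded-∷ b (≤-trans (<⇒≤ i<k) (⟦⟧-bounded t b))))
  (≤-trans (*-mono-≤ (⟦⟧-bounded t b) (m≤n+m _ 2)) (≤-trans (m≤m+n _ 1) (m≤n+m _ (bound t N))))
⟦⟧-bounded (iter c t u) {ws} {ρ} b = ≤-trans (countdown-≤ (⟦ c ⟧ ws ρ) _ _) (≤-trans (⟦⟧-bounded t b) (m≤m+n _ _))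

-- Compiling terms to programs on counters

module Evaluation (m work : ℕ) where
  open Registers m work

  -- `xs` lists the registers of the variables, `d` is the first free register and `a` the
  -- accumulator, to which the value is added. Everything else ends as it began: a variable is
  -- emptied while it is copied and then refilled from a scratch register.
  compile : ∀ {Γ} → Tm m Γ → Vec ℕ Γ → ℕ → ℕ → Prog n
  compile (var i)       xs d a = loop (Vec.lookup xs i) (inc a ⨾ inc d) ⨾ loop d (inc (Vec.lookup xs i))
  compile (wk t)        xs d a = compile t (Vec.tail xs) d a
  compile (ren is t)    xs d a = compile t (Vec.map (Vec.lookup xs) is) d a
  compile (lit zero)    xs d a = skip
  compile (lit (suc c)) xs d a = inc a ⨾ compile {0} (lit c) [] d a
  compile (len j)       xs d a = whileReg (toℕ j) isBit (inc (toℕ j) ⨾ inc a ⨾ inc d) ⨾ loop d (dec (toℕ j))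
  compile (digit j t)   xs d a =
    compile t xs (1 + d) d ⨾ loop d (inc (toℕ j) ⨾ inc (1 + d)) ⨾
    shift right (toℕ j) isBit a ⨾ shift right (toℕ j) isOne a ⨾ loop (1 + d) (dec (toℕ j))
  compile (t ⊕ u)       xs d a = compile t xs d a ⨾ compile u xs d a
  compile (t ⊖ u)       xs d a =
    compile t xs (1 + d) d ⨾ compile u xs (2 + d) (1 + d) ⨾ loop (1 + d) (shift left d isBlank d) ⨾ loop d (inc a)
  compile (t ⊗ u)       xs d a = compile t xs (1 + d) d ⨾ loop d (compile u xs (1 + d) a)
  compile (sum t b)     xs d a = compile t xs (1 + d) d ⨾ loop d (compile b (d ∷ xs) (1 + d) a)
  compile (iter c t b)  xs d a =
    compile t xs (1 + d) d ⨾ compile c xs (2 + d) (1 + d) ⨾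
    loop (1 + d) (compile b ((1 + d) ∷ d ∷ xs) (3 + d) (2 + d) ⨾ loop (2 + d) (shift left d isBlank d)) ⨾
    loop d (inc a)

  module _ (ws : Vec Word m) where

    private
      Run : Prog n → (ℕ → ℕ) → Word → (ℕ → ℕ) → Word → ℕ → Set
      Run = Runs ws

    -- `F k v` is what `k` rounds make of `v`. The equation `F k (f v) ≡ F (suc k) v` has the shape
    -- of the loop, which applies `f` before the remaining rounds.
    loop-one : ∀ {p q r o} {f : ℕ → ℕ} {F : ℕ → ℕ → ℕ} → Counter ws q → q ≢ r →
      (∀ {σ v} → σ r ≡ v → Run p σ o (upd σ r (f v)) o 1) →
      (∀ v → F 0 v ≡ v) → (∀ k v → F k (f v) ≡ F (suc k) v) →
      ∀ k v {σ} → σ q ≡ k → σ r ≡ v → Run (loop q p) σ o (upd (upd σ q 0) r (F k v)) o (k * 3 + 1)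
    loop-one {F = F} Q q≢r P F₀ F₁ zero v {σ} eq er = after ws
      (λ s → sym (trans (upd-self (upd σ _ 0) (trans (upd-other σ 0 (q≢r ∘ sym)) (trans er (sym (F₀ v)))) s) (upd-self σ eq s)))
      (loop-exit ws Q eq)
    loop-one {q = q} {r} {f = f} {F} Q q≢r P F₀ F₁ (suc k) v {σ} eq er = after ws pw
      (loop-step ws Q eq (P (trans (upd-other σ k (q≢r ∘ sym)) er))
        (loop-one {F = F} Q q≢r P F₀ F₁ k (f v) (trans (upd-other _ (f v) q≢r) (upd-same σ q k)) (upd-same _ r (f v))))
      where
      pw : upd (upd (upd (upd σ q k) r (f v)) q 0) r (F k (f v)) ≗ upd (upd σ q 0) r (F (suc k) v)
      pw s with s ≟ r
      ... | yes _ = F₁ k v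
      ... | no  n with s ≟ q
      ...   | yes _ = refl
      ...   | no  n′ = trans (upd-other _ (f v) n) (upd-other σ k n′)

    add-loop : ∀ {q r k v σ o} → Counter ws q → Reg ws r → q ≢ r → σ q ≡ k → σ r ≡ v →
      Run (loop q (inc r)) σ o (upd (upd σ q 0) r (k + v)) o (k * 3 + 1)
    add-loop {k = k} {v} Q R ne = loop-one {f = suc} {F = _+_} Q ne (inc-runs ws R) (λ _ → refl) +-suc k v

    monus-loop : ∀ {q r k v σ o} → Counter ws q → Counter ws r → q ≢ r → σ q ≡ k → σ r ≡ v →
      Run (loop q (shift left r isBlank r)) σ o (upd (upd σ q 0) r (v ∸ k)) o (k * 3 + 1)
    monus-loop {k = k} {v} Q R ne = loop-one {f = _∸ 1} {F = λ k v → v ∸ k} Q ne (monus-runs ws R) (λ _ → refl)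
      (λ k v → ∸-+-assoc v 1 k) k v

    -- No instance of `loop-one`: a move to the left is specified only for a positive register, so
    -- both registers have to count down together.
    return-loop : ∀ {q r} → Counter ws q → Reg ws r → q ≢ r → ∀ k {σ o} → σ q ≡ k → σ r ≡ k →
      Run (loop q (dec r)) σ o (upd (upd σ q 0) r 0) o (k * 3 + 1)
    return-loop {q} {r} Q R q≢r zero {σ} eq er = after ws
      (λ s → sym (trans (upd-self (upd σ q 0) (trans (upd-other σ 0 (q≢r ∘ sym)) er) s) (upd-self σ eq s)))
      (loop-exit ws Q eq)
    return-loop {q} {r} Q R q≢r (suc k) {σ} eq er = after ws pw
      (loop-step ws Q eq (dec-runs ws R (trans (upd-other σ k (q≢r ∘ sym)) er))
        (return-loop Q R q≢r k (trans (upd-other _ k q≢r) (upd-same σ q k)) (upd-same _ r k)))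
      where
      pw : upd (upd (upd (upd σ q k) r k) q 0) r 0 ≗ upd (upd σ q 0) r 0
      pw s with s ≟ r
      ... | yes _ = refl
      ... | no  n with s ≟ q
      ...   | yes _ = refl
      ...   | no  n′ = trans (upd-other _ k n) (upd-other σ k n′)

    add-loop₂ : ∀ {q r s} → Counter ws q → Reg ws r → Reg ws s → q ≢ r → q ≢ s → r ≢ s →
      ∀ k {u v σ o} → σ q ≡ k → σ r ≡ u → σ s ≡ v →
      Run (loop q (inc r ⨾ inc s)) σ o (upd (upd (upd σ q 0) r (k + u)) s (k + v)) o (k * 4 + 1)
    add-loop₂ {q} {r} {s} Q R S q≢r q≢s r≢s zero {u} {v} {σ} eq er es = after ws
      (λ x → sym (trans (upd-self (upd (upd σ q 0) r u) (trans (upd-other _ u (r≢s ∘ sym)) (trans (upd-other σ 0 (q≢s ∘ sym)) es)) x)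
                 (trans (upd-self (upd σ q 0) (trans (upd-other σ 0 (q≢r ∘ sym)) er) x) (upd-self σ eq x))))
      (loop-exit ws Q eq)
    add-loop₂ {q} {r} {s} Q R S q≢r q≢s r≢s (suc k) {u} {v} {σ} eq er es = after ws pw
      (loop-step ws Q eq
        (_⨾ʳ_ ws (inc-runs ws R (trans (upd-other σ k (q≢r ∘ sym)) er))
                 (inc-runs ws S (trans (upd-other _ (suc u) (r≢s ∘ sym)) (trans (upd-other σ k (q≢s ∘ sym)) es))))
        (add-loop₂ Q R S q≢r q≢s r≢s k
          (trans (upd-other _ (suc v) q≢s) (trans (upd-other _ (suc u) q≢r) (upd-same σ q k)))
          (trans (upd-other _ (suc v) r≢s) (upd-same _ r (suc u))) (upd-same _ s (suc v))))
      where
      pw : upd (upd (upd (upd (upd (upd σ q k) r (suc u)) s (suc v)) q 0) r (k + suc u)) s (k + suc v)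
           ≗ upd (upd (upd σ q 0) r (suc k + u)) s (suc k + v)
      pw x with x ≟ s
      ... | yes _ = +-suc k v
      ... | no  n with x ≟ r
      ...   | yes _ = +-suc k u
      ...   | no  n′ with x ≟ q
      ...     | yes _ = refl
      ...     | no  n″ = trans (upd-other _ (suc v) n) (trans (upd-other _ (suc u) n′) (upd-other σ k n″))
    -- The invariant between any two terms. Since everything from `d` on is zero and the input heads
    -- are at their origins, no scratch register has to be cleared and no input rewound before use.
    record Frame {Γ} (xs ρ : Vec ℕ Γ) (d a : ℕ) (σ : ℕ → ℕ) : Set where
      constructor frame
      field
        low   : ∀ i → m < Vec.lookup xs i × Vec.lookup xs i < d × Vec.lookup xs i ≢ a
        value : ∀ i → σ (Vec.lookup xs i) ≡ Vec.lookup ρ i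
        m<a   : m < a
        a<d   : a < d
        clean : ∀ r → d ≤ r → σ r ≡ 0
        home  : ∀ r → r < m → σ r ≡ 0

    open Frame

    frame-tail : ∀ {Γ} {xs ρ : Vec ℕ (suc Γ)} {d a σ} → Frame xs ρ d a σ → Frame (Vec.tail xs) (Vec.tail ρ) d a σ
    frame-tail {xs = _ ∷ _} {_ ∷ _} (frame l v ma ad c h) = frame (l ∘ suc) (v ∘ suc) ma ad c h

    frame-ren : ∀ {Γ Δ} {xs ρ : Vec ℕ Δ} {d a σ} (is : Vec (Fin Δ) Γ) → Frame xs ρ d a σ →
                Frame (Vec.map (Vec.lookup xs) is) (Vec.map (Vec.lookup ρ) is) d a σ
    frame-ren {xs = xs} {ρ} {d} {a} {σ} is (frame l v ma ad c h) = frame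
      (λ i → subst (λ x → m < x × x < d × x ≢ a) (sym (lookup-map i (Vec.lookup xs) is)) (l (Vec.lookup is i)))
      (λ i → trans (cong σ (lookup-map i (Vec.lookup xs) is)) (trans (v (Vec.lookup is i)) (sym (lookup-map i (Vec.lookup ρ) is))))
      ma ad c h

    frame-[] : ∀ {Γ} {xs ρ : Vec ℕ Γ} {d a σ} → Frame xs ρ d a σ → Frame [] [] d a σ
    frame-[] (frame l v ma ad c h) = frame (λ ()) (λ ()) ma ad c h

    frame-push : ∀ {Γ} {xs ρ : Vec ℕ Γ} {d a σ} → Frame xs ρ d a σ → Frame xs ρ (suc d) d σ
    frame-push (frame l v ma ad c h) = frame
      (λ i → let (p , q , _) = l i in p , m≤n⇒m≤1+n q , <⇒≢ q) v (<-trans ma ad) ≤-refl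
      (λ r p → c r (<⇒≤ p)) h

    frame-bind : ∀ {Γ} {xs ρ : Vec ℕ Γ} {d a σ} v → Frame xs ρ d a σ → Frame (d ∷ xs) (v ∷ ρ) (suc d) a (upd σ d v)
    frame-bind {d = d} {σ = σ} v F = frame
      (λ { zero → <-trans (m<a F) (a<d F) , ≤-refl , (<⇒≢ (a<d F) ∘ sym)
         ; (suc i) → let (p , q , r) = low F i in p , m≤n⇒m≤1+n q , r })
      (λ { zero → upd-same σ d v ; (suc i) → trans (upd-other σ v (<⇒≢ (proj₁ (proj₂ (low F i))))) (value F i) })
      (m<a F) (m≤n⇒m≤1+n (a<d F))
      (λ r p → trans (upd-other σ v (<⇒≢ p ∘ sym)) (clean F r (<⇒≤ p)))
      (λ r p → trans (upd-other σ v (<⇒≢ (<-trans p (<-trans (m<a F) (a<d F))))) (home F r p))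

    frame-raise : ∀ {Γ} {xs ρ : Vec ℕ Γ} {d a σ} v → Frame xs ρ d a σ → Frame xs ρ (suc d) a (upd σ d v)
    frame-raise v F = frame-tail (frame-bind v F)

    frame-target : ∀ {Γ} {xs ρ : Vec ℕ Γ} {d a σ} v → Frame xs ρ d a σ → Frame xs ρ d a (upd σ a v)
    frame-target {a = a} {σ} v F = frame (low F)
      (λ i → trans (upd-other σ v (proj₂ (proj₂ (low F i)))) (value F i)) (m<a F) (a<d F)
      (λ r p → trans (upd-other σ v (<⇒≢ (<-≤-trans (a<d F) p) ∘ sym)) (clean F r p))
      (λ r p → trans (upd-other σ v (<⇒≢ (<-trans p (m<a F)))) (home F r p))

    room : ∀ k {d x z} → x ≤ z → d + (k + z) ≤ n → k + d + x ≤ n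
    room k {d} {x} {z} x≤z h = ≤-trans (≤-reflexive (trans (cong (_+ x) (+-comm k d)) (+-assoc d k x)))
      (≤-trans (+-monoʳ-≤ d (+-monoʳ-≤ k x≤z)) h)

    room-ctr : ∀ k {d z} → m < d → d + (suc k + z) ≤ n → Counter ws (k + d)
    room-ctr k {d} {z} m<d h = <-≤-trans m<d (m≤n+m d k) ,
      ≤-trans (≤-reflexive (trans (cong suc (+-comm k d)) (sym (+-suc d k)))) (≤-trans (+-monoʳ-≤ d (m≤m+n (suc k) z)) h)

    frame-reg : ∀ {Γ} {xs ρ : Vec ℕ Γ} {d a σ} → Frame xs ρ d a σ → d ≤ n → Counter ws a
    frame-reg F d≤n = m<a F , <-≤-trans (a<d F) d≤n

    input-reg : ∀ (j : Fin m) → Reg ws (toℕ j)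
    input-reg j = reg (<-trans (toℕ<n j) m<n) (<⇒≢ (toℕ<n j))

    input-cell : ∀ (j : Fin m) p → cells ws (toℕ j) p ≡ wordCells (Vec.lookup ws j) p
    input-cell j p = cong (_$ p) (cells-input ws j)

    cell-digit : ∀ w p → (if isOne (wordCells w p) then suc else id) (if isBit (wordCells w p) then 1 else 0) ≡ digitOf w p
    cell-digit []          p       = refl
    cell-digit (false ∷ w) zero    = refl
    cell-digit (true  ∷ w) zero    = refl
    cell-digit (false ∷ w) (suc p) = cell-digit w p
    cell-digit (true  ∷ w) (suc p) = cell-digit w p

    bit-within : ∀ w k p → k + p ≡ length w → isBit (wordCells w p) ≡ (0 <ᵇ k)
    bit-within []      zero    zero    e = refl
    bit-within (b ∷ w) zero    (suc p) e = bit-within w 0 p (suc-injective e)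
    bit-within (b ∷ w) (suc k) zero    e = refl
    bit-within (b ∷ w) (suc k) (suc p) e = bit-within w (suc k) p (suc-injective (trans (sym (cong suc (+-suc k p))) e))
    bit-within []      (suc k) p       ()

    scan-loop : ∀ {j a d} → Counter ws a → Counter ws d → a ≢ d → toℕ j ≢ a → toℕ j ≢ d →
      ∀ k p {u v σ o} → k + p ≡ length (Vec.lookup ws j) → σ (toℕ j) ≡ p → σ a ≡ u → σ d ≡ v →
      Run (whileReg (toℕ j) isBit (inc (toℕ j) ⨾ inc a ⨾ inc d)) σ o
          (upd (upd (upd σ (toℕ j) (k + p)) a (k + u)) d (k + v)) o (k * 4 + 1)
    scan-loop {j} {a} {d} A D a≢d j≢a j≢d zero p {u} {v} {σ} e ej ea ed = after ws
      (λ x → sym (trans (upd-self (upd (upd σ (toℕ j) p) a u) (trans (upd-other _ u (a≢d ∘ sym)) (trans (upd-other σ p (j≢d ∘ sym)) ed)) x)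
                 (trans (upd-self (upd σ (toℕ j) p) (trans (upd-other σ p (j≢a ∘ sym)) ea) x) (upd-self σ ej x))))
      (while-exit ws {c = isBit} (input-reg j) (trans (cong isBit (trans (cong (cells ws (toℕ j)) ej) (input-cell j p)))
        (bit-within (Vec.lookup ws j) 0 p e)))
    scan-loop {j} {a} {d} A D a≢d j≢a j≢d (suc k) p {u} {v} {σ} e ej ea ed = after ws pw
      (while-step ws {c = isBit} (input-reg j)
        (trans (cong isBit (trans (cong (cells ws (toℕ j)) ej) (input-cell j p))) (bit-within (Vec.lookup ws j) (suc k) p e))
        (_⨾ʳ_ ws (inc-runs ws (input-reg j) ej)
          (_⨾ʳ_ ws (inc-runs ws (ctr ws A) (trans (upd-other σ (suc p) (j≢a ∘ sym)) ea))
            (inc-runs ws (ctr ws D) (trans (upd-other _ (suc u) (a≢d ∘ sym)) (trans (upd-other σ (suc p) (j≢d ∘ sym)) ed)))))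
        (scan-loop A D a≢d j≢a j≢d k (suc p) (trans (+-suc k p) e)
          (trans (upd-other _ (suc v) j≢d) (trans (upd-other _ (suc u) j≢a) (upd-same σ (toℕ j) (suc p))))
          (trans (upd-other _ (suc v) a≢d) (upd-same _ a (suc u))) (upd-same _ d (suc v))))
      where
      pw : upd (upd (upd (upd (upd (upd σ (toℕ j) (suc p)) a (suc u)) d (suc v)) (toℕ j) (k + suc p)) a (k + suc u)) d (k + suc v)
           ≗ upd (upd (upd σ (toℕ j) (suc k + p)) a (suc k + u)) d (suc k + v)
      pw x with x ≟ d
      ... | yes _ = +-suc k v
      ... | no  n with x ≟ a
      ...   | yes _ = +-suc k u
      ...   | no  n′ with x ≟ toℕ j
      ...     | yes _ = +-suc k p
      ...     | no  n″ = trans (upd-other _ (suc v) n) (trans (upd-other _ (suc u) n′) (upd-other σ (suc p) n″))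

    Adds : ∀ {Γ} → Tm m Γ → Set
    Adds {Γ} t = ∀ {xs ρ : Vec ℕ Γ} {d a σ o N} → Frame xs ρ d a σ → d + need t ≤ n → Bounded ws ρ N →
      ∀ {v} → σ a ≡ v → Run (compile t xs d a) σ o (upd σ a (v + ⟦ t ⟧ ws ρ)) o (bound t N)

    adds-fresh : ∀ {Γ} {t : Tm m Γ} → Adds t → ∀ {xs ρ d a σ o N} → Frame xs ρ d a σ → suc d + need t ≤ n →
      Bounded ws ρ N → Run (compile t xs (suc d) d) σ o (upd σ d (⟦ t ⟧ ws ρ)) o (bound t N)
    adds-fresh A {d = d} F h B = A (frame-push F) h B (clean F d ≤-refl)

    var-adds : ∀ {Γ} (i : Fin Γ) → Adds (var i)
    var-adds i {xs} {ρ} {d} {a} {σ} {o} {N} F h B {v} ea = weaken ws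
      (+-mono-≤ (+-monoˡ-≤ 1 (*-monoˡ-≤ 4 (Bounded.vars B i))) (+-monoˡ-≤ 1 (*-monoˡ-≤ 3 (Bounded.vars B i))))
      (after ws pw (_⨾ʳ_ ws
        (add-loop₂ X (ctr ws A) (ctr ws D) x≢a x≢d a≢d k (value F i) ea (clean F d ≤-refl))
        (after ws (λ _ → refl) (add-loop D (ctr ws X) (x≢d ∘ sym)
          (trans (upd-same _ d (k + 0)) (+-identityʳ k))
          (trans (upd-other _ (k + 0) x≢d) (trans (upd-other _ (k + v) x≢a) (upd-same σ x 0)))))))
      where
      x = Vec.lookup xs i
      k = Vec.lookup ρ i
      D = room-ctr 0 (<-trans (m<a F) (a<d F)) h
      A = frame-reg F (≤-trans (m≤m+n d 1) h)
      X = proj₁ (low F i) , <-trans (proj₁ (proj₂ (low F i))) (proj₂ D)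
      x≢d = <⇒≢ (proj₁ (proj₂ (low F i)))
      x≢a = proj₂ (proj₂ (low F i))
      a≢d = <⇒≢ (a<d F)
      pw : upd (upd (upd (upd (upd σ x 0) a (k + v)) d (k + 0)) d 0) x (k + 0) ≗ upd σ a (v + k)
      pw r with r ≟ x
      ... | yes refl = trans (+-identityʳ k) (sym (trans (upd-other σ (v + k) x≢a) (value F i)))
      ... | no  n with r ≟ d
      ...   | yes refl = sym (trans (upd-other σ (v + k) (a≢d ∘ sym)) (clean F d ≤-refl))
      ...   | no  n′ with r ≟ a
      ...     | yes refl = trans (upd-other _ (k + 0) n′) (trans (upd-same _ r (k + v)) (+-comm k v))
      ...     | no  n″ = trans (upd-other _ (k + 0) n′) (trans (upd-other _ (k + v) n″) (upd-other σ 0 n))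

    len-adds : ∀ {Γ} (j : Fin m) → Adds {Γ} (len j)
    len-adds j {xs} {ρ} {d} {a} {σ} {o} {N} F h B {v} ea = weaken ws
      (+-mono-≤ (+-monoˡ-≤ 1 (*-monoˡ-≤ 4 (Bounded.lens B j))) (+-monoˡ-≤ 1 (*-monoˡ-≤ 3 (Bounded.lens B j))))
      (after ws pw (_⨾ʳ_ ws
        (scan-loop A D a≢d j≢a j≢d k 0 (+-identityʳ k) (home F (toℕ j) (toℕ<n j)) ea (clean F d ≤-refl))
        (return-loop D (input-reg j) (j≢d ∘ sym) k (trans (upd-same _ d (k + 0)) (+-identityʳ k))
          (trans (upd-other _ (k + 0) j≢d) (trans (upd-other _ (k + v) j≢a) (trans (upd-same σ (toℕ j) (k + 0)) (+-identityʳ k)))))))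
      where
      k = length (Vec.lookup ws j)
      D = room-ctr 0 (<-trans (m<a F) (a<d F)) h
      A = frame-reg F (≤-trans (m≤m+n d 1) h)
      a≢d = <⇒≢ (a<d F)
      j≢a = <⇒≢ (<-trans (toℕ<n j) (m<a F))
      j≢d = <⇒≢ (<-trans (toℕ<n j) (proj₁ D))
      pw : upd (upd (upd (upd (upd σ (toℕ j) (k + 0)) a (k + v)) d (k + 0)) d 0) (toℕ j) 0 ≗ upd σ a (v + k)
      pw r with r ≟ toℕ j
      ... | yes refl = sym (trans (upd-other σ (v + k) j≢a) (home F (toℕ j) (toℕ<n j)))
      ... | no  n with r ≟ d
      ...   | yes refl = sym (trans (upd-other σ (v + k) (a≢d ∘ sym)) (clean F d ≤-refl))
      ...   | no  n′ with r ≟ a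
      ...     | yes refl = trans (upd-other _ (k + 0) n′) (trans (upd-same _ r (k + v)) (+-comm k v))
      ...     | no  n″ = trans (upd-other _ (k + 0) n′) (trans (upd-other _ (k + v) n″) (upd-other σ (k + 0) n))

    lit-adds : ∀ {Γ} c → Adds {Γ} (lit c)
    lit-adds zero    {a = a} {σ} F h B {v} ea = after ws
      (λ r → sym (upd-self σ (trans ea (sym (+-identityʳ v))) r)) (skip-runs ws)
    lit-adds (suc c) {d = d} {a} {σ} {N = N} F h B {v} ea = after ws
      (≗-trans (upd-upd σ a (suc v) (suc v + c)) (upd-cong a (λ _ → refl) (sym (+-suc v c))))
      (_⨾ʳ_ ws (inc-runs ws (ctr ws (frame-reg F (≤-trans (m≤m+n d 0) h))) ea)
        (lit-adds c {N = N} (frame-target (suc v) (frame-[] F)) h (bounded (λ ()) (Bounded.lens B)) (upd-same σ a (suc v))))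

    -- The head moves `k` cells to the right while `1 + d` remembers the distance. One increment for
    -- a bit and another one for `true` produce the digits 0, 1 and 2 of `digitOf`; then the head
    -- returns.
    digit-adds : ∀ {Γ} (j : Fin m) (t : Tm m Γ) → Adds t → Adds (digit j t)
    digit-adds j t IH {xs} {ρ} {d} {a} {σ} {o} {N} F h B {v} ea = weaken ws
      (+-monoʳ-≤ (bound t N) (+-mono-≤ (+-monoˡ-≤ 1 (*-monoˡ-≤ 4 k≤)) (s≤s (s≤s (+-monoˡ-≤ 1 (*-monoˡ-≤ 3 k≤))))))
      (after ws pw
        (_⨾ʳ_ ws (adds-fresh {t = t} IH F (room 1 ≤-refl (≤-trans (+-monoʳ-≤ d (n≤1+n (suc (need t)))) h)) B)
        (_⨾ʳ_ ws (add-loop₂ D (input-reg j) (ctr ws E) (j≢d ∘ sym) d≢e j≢e k (upd-same σ d k) j≡0 e≡0)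
        (_⨾ʳ_ ws (incIf-runs ws {c = isBit} (input-reg j) (ctr ws A) a₂)
        (_⨾ʳ_ ws (incIf-runs ws {c = isOne} (input-reg j) (ctr ws A) (upd-same σ₂ a v₁))
          (return-loop E (input-reg j) (j≢e ∘ sym) k
             (trans (upd-other _ v₂ e≢a) (trans (upd-other σ₂ v₁ e≢a) (trans (upd-same _ (1 + d) (k + 0)) (+-identityʳ k))))
             (trans (upd-other _ v₂ j≢a) (trans (upd-other σ₂ v₁ j≢a) j₂))))))))
      where
      w = Vec.lookup ws j
      k = ⟦ t ⟧ ws ρ
      k≤ = ⟦⟧-bounded t B
      m<d = <-trans (m<a F) (a<d F)
      D = room-ctr 0 m<d h
      E = room-ctr 1 m<d h
      A = frame-reg F (≤-trans (m≤m+n d _) h)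
      d≢e = <⇒≢ (n<1+n d)
      a≢d = <⇒≢ (a<d F)
      e≢a = <⇒≢ (m≤n⇒m≤1+n (a<d F)) ∘ sym
      j≢a = <⇒≢ (<-trans (toℕ<n j) (m<a F))
      j≢d = <⇒≢ (<-trans (toℕ<n j) m<d)
      j≢e = <⇒≢ (<-trans (toℕ<n j) (proj₁ E))
      j≡0 : upd σ d k (toℕ j) ≡ 0
      j≡0 = trans (upd-other σ k j≢d) (home F (toℕ j) (toℕ<n j))
      e≡0 : upd σ d k (1 + d) ≡ 0
      e≡0 = trans (upd-other σ k (d≢e ∘ sym)) (clean F (1 + d) (n≤1+n d))
      σ₂ = upd (upd (upd (upd σ d k) d 0) (toℕ j) (k + 0)) (1 + d) (k + 0)
      j₂ : σ₂ (toℕ j) ≡ k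
      j₂ = trans (upd-other _ (k + 0) j≢e) (trans (upd-same _ (toℕ j) (k + 0)) (+-identityʳ k))
      a₂ : σ₂ a ≡ v
      a₂ = trans (upd-other _ (k + 0) (e≢a ∘ sym)) (trans (upd-other _ (k + 0) (j≢a ∘ sym))
             (trans (upd-other _ 0 a≢d) (trans (upd-other σ k a≢d) ea)))
      v₁ v₂ : ℕ
      v₁ = if isBit (cells ws (toℕ j) (σ₂ (toℕ j))) then suc v else v
      v₂ = if isOne (cells ws (toℕ j) (upd σ₂ a v₁ (toℕ j))) then suc v₁ else v₁
      v₂≡ : v₂ ≡ v + digitOf w k
      v₂≡ rewrite upd-other σ₂ v₁ j≢a | j₂ | input-cell j k = trans (lemma (isBit (wordCells w k)) (isOne (wordCells w k))) (cong (v +_) (cell-digit w k))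
        where
        lemma : ∀ b c → (if c then suc (if b then suc v else v) else (if b then suc v else v))
                ≡ v + (if c then suc else id) (if b then 1 else 0)
        lemma false false = sym (+-identityʳ v)
        lemma false true  = +-comm 1 v
        lemma true  false = +-comm 1 v
        lemma true  true  = +-comm 2 v
      σ₂-at : ∀ {r} → r ≢ a → r ≢ 1 + d → r ≢ toℕ j → upd σ₂ a v₁ r ≡ upd (upd σ d k) d 0 r
      σ₂-at n₁ n₂ n₃ = trans (upd-other σ₂ v₁ n₁) (trans (upd-other _ (k + 0) n₂) (upd-other _ (k + 0) n₃))
      pw : upd (upd (upd (upd σ₂ a v₁) a v₂) (1 + d) 0) (toℕ j) 0 ≗ upd σ a (v + digitOf w k)
      pw r with r ≟ toℕ j
      ... | yes refl = sym (trans (upd-other σ _ j≢a) (home F (toℕ j) (toℕ<n j)))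
      ... | no  n with r ≟ 1 + d
      ...   | yes refl = sym (trans (upd-other σ _ e≢a) (clean F (1 + d) (n≤1+n d)))
      ...   | no  n′ with r ≟ a
      ...     | yes refl = v₂≡
      ...     | no  n″ with r ≟ d
      ...       | yes refl = trans (σ₂-at n″ n′ n) (trans (upd-same _ d 0) (sym (clean F d ≤-refl)))
      ...       | no  n‴ = trans (σ₂-at n″ n′ n) (trans (upd-other _ 0 n‴) (upd-other σ k n‴))
    plus-adds : ∀ {Γ} (t u : Tm m Γ) → Adds t → Adds u → Adds (t ⊕ u)
    plus-adds t u IHt IHu {ρ = ρ} {d} {a} {σ} F h B {v} ea = after ws
      (≗-trans (upd-upd σ a _ _) (upd-cong a (λ _ → refl) (+-assoc v _ _)))
      (_⨾ʳ_ ws (IHt F (room 0 (m≤m+n (need t) (need u)) h) B ea)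
               (IHu (frame-target _ F) (room 0 (m≤n+m (need u) (need t)) h) B (upd-same σ a _)))

    minus-adds : ∀ {Γ} (t u : Tm m Γ) → Adds t → Adds u → Adds (t ⊖ u)
    minus-adds t u IHt IHu {ρ = ρ} {d} {a} {σ} {N = N} F h B {v} ea = weaken ws
      (+-monoʳ-≤ (bound t N) (+-monoʳ-≤ (bound u N) (+-mono-≤ (+-monoˡ-≤ 1 (*-monoˡ-≤ 3 (⟦⟧-bounded u B)))
        (+-monoˡ-≤ 1 (*-monoˡ-≤ 3 (≤-trans (m∸n≤m X Y) (⟦⟧-bounded t B)))))))
      (after ws pw
        (_⨾ʳ_ ws (adds-fresh {t = t} IHt F (room 1 (≤-trans (m≤m+n (need t) (need u)) (n≤1+n _)) h) B)
        (_⨾ʳ_ ws (adds-fresh {t = u} IHu (frame-raise X F) (room 2 (m≤n+m (need u) (need t)) h) B)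
        (_⨾ʳ_ ws (monus-loop E D (d≢e ∘ sym) (upd-same _ (1 + d) Y) (trans (upd-other _ Y d≢e) (upd-same σ d X)))
                 (add-loop D (ctr ws A) (a≢d ∘ sym) (upd-same _ d (X ∸ Y))
                   (trans (upd-other _ (X ∸ Y) a≢d) (trans (upd-other _ 0 a≢e) (trans (upd-other _ Y a≢e) (trans (upd-other σ X a≢d) ea)))))))))
      where
      X = ⟦ t ⟧ ws ρ
      Y = ⟦ u ⟧ ws ρ
      m<d = <-trans (m<a F) (a<d F)
      D = room-ctr 0 m<d h
      E = room-ctr 1 m<d h
      A = frame-reg F (≤-trans (m≤m+n d _) h)
      a≢d = <⇒≢ (a<d F)
      d≢e = <⇒≢ (n<1+n d)
      a≢e = <⇒≢ (m≤n⇒m≤1+n (a<d F))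
      pw : upd (upd (upd (upd (upd (upd σ d X) (1 + d) Y) (1 + d) 0) d (X ∸ Y)) d 0) a (X ∸ Y + v) ≗ upd σ a (v + (X ∸ Y))
      pw r with r ≟ a
      ... | yes _ = +-comm (X ∸ Y) v
      ... | no  n₁ = trans (upd-upd _ d (X ∸ Y) 0 r) (go (r ≟ d))
        where
        go : Dec (r ≡ d) → upd (upd (upd (upd σ d X) (1 + d) Y) (1 + d) 0) d 0 r ≡ σ r
        go (yes refl) = trans (upd-same _ d 0) (sym (clean F d ≤-refl))
        go (no n₂) = trans (upd-other _ 0 n₂) (trans (upd-upd _ (1 + d) Y 0 r) (trans (upd-self (upd σ d X)
          (trans (upd-other σ X (d≢e ∘ sym)) (clean F (1 + d) (n≤1+n d))) r) (upd-other σ X n₂)))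

    -- The state is split into `τ`, in which `d` is still clean, and the index stored at `d`. So the
    -- same frame serves in every round, and only the index and the accumulator change.
    sum-loop : ∀ {Γ} (u : Tm m (suc Γ)) → Adds u → ∀ {xs ρ d a o N} → suc d + need u ≤ n → Counter ws d →
      ∀ k {v τ} → Frame xs ρ d a τ → (∀ i → i < k → Bounded ws (i ∷ ρ) N) → τ a ≡ v →
      Run (loop d (compile u (d ∷ xs) (1 + d) a)) (upd τ d k) o
          (upd τ a (v + sumBelow k (λ i → ⟦ u ⟧ ws (i ∷ ρ)))) o (k * (2 + bound u N) + 1)
    sum-loop u IH {d = d} {a} h D zero {v} {τ} F B ea = after ws
      (λ r → trans (upd-self τ (clean F d ≤-refl) r) (sym (upd-self τ (trans ea (sym (+-identityʳ v))) r)))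
      (loop-exit ws D (upd-same τ d 0))
    sum-loop u IH {xs} {ρ} {d} {a} {o} {N} h D (suc k) {v} {τ} F B ea = weaken ws
      (≤-reflexive (cong (2 +_) (sym (+-assoc (bound u N) _ 1))))
      (after ws (≗-trans (upd-upd τ a _ _) (upd-cong a (λ _ → refl) (+-assoc v f _)))
        (loop-step ws D (upd-same τ d (suc k))
          (before ws (upd-upd τ d (suc k) k) (after ws (upd-comm τ k (v + f) (a≢d ∘ sym))
            (IH (frame-bind k F) h (B k ≤-refl) (trans (upd-other τ k a≢d) ea))))
          (sum-loop u IH h D k (frame-target (v + f) F) (λ i i<k → B i (m≤n⇒m≤1+n i<k)) (upd-same τ a (v + f)))))
      where
      f = ⟦ u ⟧ ws (k ∷ ρ)
      a≢d = <⇒≢ (a<d F)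

    sum-adds : ∀ {Γ} (t : Tm m Γ) u → Adds t → Adds u → Adds (sum t u)
    sum-adds t u IHt IHu {ρ = ρ} {d} {a} {σ} {N = N} F h B ea = weaken ws
      (+-monoʳ-≤ (bound t N) (+-monoˡ-≤ 1 (*-monoˡ-≤ (2 + bound u (N + bound t N)) k≤)))
      (_⨾ʳ_ ws (adds-fresh {t = t} IHt F (room 1 (m≤m+n (need t) (need u)) h) B)
               (sum-loop u IHu (room 1 (m≤n+m (need u) (need t)) h) (room-ctr 0 (<-trans (m<a F) (a<d F)) h)
                 (⟦ t ⟧ ws ρ) F (λ i i<k → bounded-∷ B (≤-trans (<⇒≤ i<k) k≤)) ea))
      where k≤ = ⟦⟧-bounded t B

    sumBelow-const : ∀ k c → sumBelow k (λ _ → c) ≡ k * c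
    sumBelow-const zero    c = refl
    sumBelow-const (suc k) c = cong (c +_) (sumBelow-const k c)

    -- A product is a sum whose summand ignores the index; both have the same program, because
    -- compiling `wk u` drops the index register.
    times-adds : ∀ {Γ} (t u : Tm m Γ) → Adds t → Adds u → Adds (t ⊗ u)
    times-adds t u IHt IHu {ρ = ρ} {σ = σ} F h B {v} ea = after ws
      (upd-cong _ (λ _ → refl) (cong (v +_) (sumBelow-const (⟦ t ⟧ ws ρ) (⟦ u ⟧ ws ρ))))
      (sum-adds t (wk u) IHt (λ F h B → IHu (frame-tail F) h (bounded-tail B)) F h B ea)

    -- Register `d` holds the current value, `1 + d` the counter and `2 + d` the amount to be
    -- subtracted. Bounds for all `y ≤ x` are enough because the value only decreases.
    iter-loop : ∀ {Γ} (u : Tm m (2 + Γ)) → Adds u → ∀ {xs ρ d a o N} → 3 + d + need u ≤ n →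
      Counter ws d → Counter ws (1 + d) → Counter ws (2 + d) →
      ∀ k x {τ} → Frame xs ρ d a τ → (∀ i y → i < k → y ≤ x → Bounded ws (i ∷ y ∷ ρ) N) →
      Run (loop (1 + d) (compile u ((1 + d) ∷ d ∷ xs) (3 + d) (2 + d) ⨾ loop (2 + d) (shift left d isBlank d)))
          (upd (upd τ d x) (1 + d) k) o (upd τ d (countdown k (λ i y → ⟦ u ⟧ ws (i ∷ y ∷ ρ)) x)) o
          (k * (2 + (bound u N + (bound u N * 3 + 1))) + 1)
    iter-loop u IH {d = d} h D E S zero x {τ} F B = after ws
      (upd-self (upd τ d x) (trans (upd-other τ x (<⇒≢ (n<1+n d) ∘ sym)) (clean F (1 + d) (n≤1+n d))))
      (loop-exit ws E (upd-same _ (1 + d) 0))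
    iter-loop u IH {xs} {ρ} {d} {a} {o} {N} h D E S (suc k) x {τ} F B = weaken ws
      (≤-reflexive (cong (2 +_) (sym (+-assoc (bound u N + (bound u N * 3 + 1)) _ 1))))
      (loop-step ws E (upd-same _ (1 + d) (suc k))
        (before ws (upd-upd (upd τ d x) (1 + d) (suc k) k)
          (_⨾ʳ_ ws (adds-fresh {t = u} IH F₂ h Bk)
            (weaken ws (+-monoˡ-≤ 1 (*-monoˡ-≤ 3 (⟦⟧-bounded u Bk)))
              (after ws pw (monus-loop S D d≢s (upd-same _ (2 + d) G)
                (trans (upd-other _ G (d≢s ∘ sym)) (trans (upd-other _ k d≢e) (upd-same τ d x))))))))
        (iter-loop u IH h D E S k (x ∸ G) F (λ i y i<k y≤ → B i y (m≤n⇒m≤1+n i<k) (≤-trans y≤ (m∸n≤m x G)))))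
      where
      G = ⟦ u ⟧ ws (k ∷ x ∷ ρ)
      F₂ = frame-bind k (frame-bind x F)
      Bk = B k x ≤-refl ≤-refl
      d≢e = <⇒≢ (n<1+n d)
      d≢s = <⇒≢ (s≤s (n≤1+n d)) ∘ sym
      pw : upd (upd (upd (upd (upd τ d x) (1 + d) k) (2 + d) G) (2 + d) 0) d (x ∸ G) ≗ upd (upd τ d (x ∸ G)) (1 + d) k
      pw r = trans (go (r ≟ d)) (upd-comm τ k (x ∸ G) (d≢e ∘ sym) r)
        where
        go : Dec (r ≡ d) → upd (upd (upd (upd (upd τ d x) (1 + d) k) (2 + d) G) (2 + d) 0) d (x ∸ G) r
                         ≡ upd (upd τ (1 + d) k) d (x ∸ G) r
        go (yes refl) = trans (upd-same _ d (x ∸ G)) (sym (upd-same _ d (x ∸ G)))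
        go (no n₁) = trans (upd-other _ (x ∸ G) n₁) (trans (upd-upd _ (2 + d) G 0 r)
          (trans (upd-self (upd (upd τ d x) (1 + d) k) (clean F₂ (2 + d) ≤-refl) r)
          (trans (upd-comm τ x k d≢e r) (trans (upd-other _ x n₁) (sym (upd-other _ (x ∸ G) n₁))))))

    iter-adds : ∀ {Γ} (c t : Tm m Γ) u → Adds c → Adds t → Adds u → Adds (iter c t u)
    iter-adds c t u IHc IHt IHu {ρ = ρ} {d} {a} {σ} {N = N} F h B {v} ea = weaken ws
      (+-monoʳ-≤ (bound t N) (+-monoʳ-≤ (bound c N) (+-mono-≤
        (+-monoˡ-≤ 1 (*-monoˡ-≤ _ C≤)) (+-monoˡ-≤ 1 (*-monoˡ-≤ 3 (≤-trans (countdown-≤ C _ X) X≤))))))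
      (after ws pw
        (_⨾ʳ_ ws (adds-fresh {t = t} IHt F (room 1 (≤-trans (m≤m+n (need t) _) (m≤n+m _ 2)) h) B)
        (_⨾ʳ_ ws (adds-fresh {t = c} IHc (frame-raise X F) (room 2 (≤-trans (≤-trans (m≤m+n (need c) (need u)) (m≤n+m _ (need t))) (n≤1+n _)) h) B)
        (_⨾ʳ_ ws (iter-loop u IHu (room 3 (≤-trans (m≤n+m (need u) (need c)) (m≤n+m _ (need t))) h)
                   D (room-ctr 1 m<d h) (room-ctr 2 m<d h) C X F
                   λ i y i<C y≤X → bounded-∷ (bounded-∷ B (≤-trans y≤X X≤)) (≤-trans (<⇒≤ i<C) C≤))
                 (add-loop D (ctr ws A) (a≢d ∘ sym) (upd-same σ d Z) (trans (upd-other σ Z a≢d) ea))))))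
      where
      C = ⟦ c ⟧ ws ρ
      X = ⟦ t ⟧ ws ρ
      C≤ = ⟦⟧-bounded c B
      X≤ = ⟦⟧-bounded t B
      Z = countdown C (λ i y → ⟦ u ⟧ ws (i ∷ y ∷ ρ)) X
      m<d = <-trans (m<a F) (a<d F)
      D = room-ctr 0 m<d h
      A = frame-reg F (≤-trans (m≤m+n d _) h)
      a≢d = <⇒≢ (a<d F)
      pw : upd (upd (upd σ d Z) d 0) a (Z + v) ≗ upd σ a (v + Z)
      pw = ≗-trans (upd-cong a (upd-upd σ d Z 0) (+-comm Z v))
             (upd-cong a (upd-self σ (clean F d ≤-refl)) refl)

    adds : ∀ {Γ} (t : Tm m Γ) → Adds t
    adds (var i)      = var-adds i
    adds (wk t)       F h B = adds t (frame-tail F) h (bounded-tail B)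
    adds (ren is t)   F h B = adds t (frame-ren is F) h (bounded-ren is B)
    adds (lit c)      = lit-adds c
    adds (len j)      = len-adds j
    adds (digit j t)  = digit-adds j t (adds t)
    adds (t ⊕ u)      = plus-adds t u (adds t) (adds u)
    adds (t ⊖ u)      = minus-adds t u (adds t) (adds u)
    adds (t ⊗ u)      = times-adds t u (adds t) (adds u)
    adds (sum t u)    = sum-adds t u (adds t) (adds u)
    adds (iter c t u) = iter-adds c t u (adds c) (adds t) (adds u)

-- Output and polynomial time

data Out (m : ℕ) : ℕ → Set where
  emit : ∀ {Γ} → Tm m Γ → Out m Γ
  _⊹_  : ∀ {Γ} → Out m Γ → Out m Γ → Out m Γ
  for  : ∀ {Γ} → Tm m Γ → Out m (suc Γ) → Out m Γ

infixr 5 _⊹_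

positive? : ℕ → Bool
positive? zero    = false
positive? (suc _) = true

forBelow : ℕ → (ℕ → Word) → Word
forBelow zero    f = []
forBelow (suc k) f = forBelow k f ++ f k

⟦_⟧ᵒ : ∀ {m Γ} → Out m Γ → Vec Word m → Vec ℕ Γ → Word
⟦ emit t ⟧ᵒ  ws ρ = positive? (⟦ t ⟧ ws ρ) ∷ []
⟦ o ⊹ o′ ⟧ᵒ  ws ρ = ⟦ o ⟧ᵒ ws ρ ++ ⟦ o′ ⟧ᵒ ws ρ
⟦ for t o ⟧ᵒ ws ρ = forBelow (⟦ t ⟧ ws ρ) λ i → ⟦ o ⟧ᵒ ws (i ∷ ρ)

boundᵒ : ∀ {m Γ} → Out m Γ → ℕ → ℕ
boundᵒ (emit t)  N = bound t N + (1 + (bound t N * 3 + 1))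
boundᵒ (o ⊹ o′)  N = boundᵒ o′ N + boundᵒ o N
boundᵒ (for t o) N = bound t N + (bound t N * (2 + boundᵒ o (N + bound t N)) + 1)

needᵒ : ∀ {m Γ} → Out m Γ → ℕ
needᵒ (emit t)  = 1 + need t
needᵒ (o ⊹ o′)  = needᵒ o + needᵒ o′
needᵒ (for t o) = 1 + (need t + needᵒ o)

-- Arithmetic of polynomials

addP : Polynomial → Polynomial → Polynomial
addP []      q       = q
addP (c ∷ p) []      = c ∷ p
addP (c ∷ p) (d ∷ q) = c + d ∷ addP p q

scaleP : ℕ → Polynomial → Polynomial
scaleP c = List.map (c *_)

mulP : Polynomial → Polynomial → Polynomial
mulP []      q = []
mulP (c ∷ p) q = addP (scaleP c q) (0 ∷ mulP p q)

compP : Polynomial → Polynomial → Polynomial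
compP []      q = []
compP (c ∷ p) q = addP (c ∷ []) (mulP q (compP p q))

eval-addP : ∀ p q x → eval (addP p q) x ≡ eval p x + eval q x
eval-addP []      q       x = refl
eval-addP (c ∷ p) []      x = sym (+-identityʳ _)
eval-addP (c ∷ p) (d ∷ q) x rewrite eval-addP p q x = ring c d x (eval p x) (eval q x)
  where
  ring : ∀ c d x e f → c + d + x * (e + f) ≡ c + x * e + (d + x * f)
  ring = solve-∀

eval-scaleP : ∀ c q x → eval (scaleP c q) x ≡ c * eval q x
eval-scaleP c []      x = sym (*-zeroʳ c)
eval-scaleP c (d ∷ q) x rewrite eval-scaleP c q x = ring c d x (eval q x)
  where
  ring : ∀ c d x e → c * d + x * (c * e) ≡ c * (d + x * e)
  ring = solve-∀

eval-mulP : ∀ p q x → eval (mulP p q) x ≡ eval p x * eval q x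
eval-mulP []      q x = refl
eval-mulP (c ∷ p) q x rewrite eval-addP (scaleP c q) (0 ∷ mulP p q) x | eval-scaleP c q x | eval-mulP p q x =
  ring c x (eval p x) (eval q x)
  where
  ring : ∀ c x e f → c * f + x * (e * f) ≡ (c + x * e) * f
  ring = solve-∀

eval-compP : ∀ p q x → eval (compP p q) x ≡ eval p (eval q x)
eval-compP []      q x = refl
eval-compP (c ∷ p) q x rewrite eval-addP (c ∷ []) (mulP q (compP p q)) x | eval-mulP q (compP p q) x | eval-compP p q x =
  ring c x (eval q x * eval p (eval q x))
  where
  ring : ∀ c x e → c + x * 0 + e ≡ c + e
  ring = solve-∀

eval-mono : ∀ p {x y} → x ≤ y → eval p x ≤ eval p y
eval-mono []      x≤y = z≤n
eval-mono (c ∷ p) x≤y = +-monoʳ-≤ c (*-mono-≤ x≤y (eval-mono p x≤y))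

-- An equality rather than a bound, so that closure under composition needs no monotonicity.
IsPoly : (ℕ → ℕ) → Set
IsPoly f = Σ Polynomial λ p → ∀ x → f x ≡ eval p x

poly-const : ∀ c → IsPoly (λ _ → c)
poly-const c = c ∷ [] , λ x → sym (trans (cong (c +_) (*-zeroʳ x)) (+-identityʳ c))

poly-id : IsPoly (λ x → x)
poly-id = 0 ∷ 1 ∷ [] , λ x → sym (trans (cong (λ z → x * (1 + z)) (*-zeroʳ x)) (*-identityʳ x))

poly-+ : ∀ {f g} → IsPoly f → IsPoly g → IsPoly (λ x → f x + g x)
poly-+ (p , ep) (q , eq) = addP p q , λ x → trans (cong₂ _+_ (ep x) (eq x)) (sym (eval-addP p q x))

poly-* : ∀ {f g} → IsPoly f → IsPoly g → IsPoly (λ x → f x * g x)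
poly-* (p , ep) (q , eq) = mulP p q , λ x → trans (cong₂ _*_ (ep x) (eq x)) (sym (eval-mulP p q x))

poly-∘ : ∀ {f g} → IsPoly f → IsPoly g → IsPoly (λ x → f (g x))
poly-∘ (p , ep) (q , eq) = compP p q , λ x → trans (ep _) (trans (cong (eval p) (eq x)) (sym (eval-compP p q x)))

poly-linear : ∀ {f} k → IsPoly f → IsPoly (λ x → f x * k + 1)
poly-linear k F = poly-+ (poly-* F (poly-const k)) (poly-const 1)

poly-loop : ∀ {f g} → IsPoly f → IsPoly g → IsPoly (λ x → f x * (2 + g x) + 1)
poly-loop F G = poly-+ (poly-* F (poly-+ (poly-const 2) G)) (poly-const 1)

bound-poly : ∀ {m Γ} (t : Tm m Γ) → IsPoly (bound t)
bound-poly (var _)      = poly-+ (poly-linear 4 poly-id) (poly-linear 3 poly-id)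
bound-poly (wk t)       = bound-poly t
bound-poly (ren _ t)    = bound-poly t
bound-poly (lit c)      = poly-const (c + 1)
bound-poly (len _)      = poly-+ (poly-linear 4 poly-id) (poly-linear 3 poly-id)
bound-poly (digit _ t)  = poly-+ (bound-poly t) (poly-+ (poly-linear 4 (bound-poly t))
  (poly-+ (poly-const 1) (poly-+ (poly-const 1) (poly-linear 3 (bound-poly t)))))
bound-poly (t ⊕ u)      = poly-+ (bound-poly t) (bound-poly u)
bound-poly (t ⊖ u)      = poly-+ (bound-poly t) (poly-+ (bound-poly u)
  (poly-+ (poly-linear 3 (bound-poly u)) (poly-linear 3 (bound-poly t))))
bound-poly (t ⊗ u)      = poly-+ (bound-poly t)
  (poly-loop (bound-poly t) (poly-∘ (bound-poly u) (poly-+ poly-id (bound-poly t))))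
bound-poly (sum t b)    = poly-+ (bound-poly t)
  (poly-loop (bound-poly t) (poly-∘ (bound-poly b) (poly-+ poly-id (bound-poly t))))
bound-poly (iter c t b) = poly-+ (bound-poly t) (poly-+ (bound-poly c)
  (poly-+ (poly-loop (bound-poly c) (poly-+ body (poly-linear 3 body))) (poly-linear 3 (bound-poly t))))
  where
  body = poly-∘ (bound-poly b) (poly-+ (poly-+ poly-id (bound-poly t)) (bound-poly c))

boundᵒ-poly : ∀ {m Γ} (o : Out m Γ) → IsPoly (boundᵒ o)
boundᵒ-poly (emit t)  = poly-+ (bound-poly t) (poly-+ (poly-const 1) (poly-linear 3 (bound-poly t)))
boundᵒ-poly (o ⊹ o′)  = poly-+ (boundᵒ-poly o′) (boundᵒ-poly o)
boundᵒ-poly (for t o) = poly-+ (bound-poly t)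
  (poly-loop (bound-poly t) (poly-∘ (boundᵒ-poly o) (poly-+ poly-id (bound-poly t))))

module Writing (m work : ℕ) where
  open Registers m work
  open Evaluation m work

  compileᵒ : ∀ {Γ} → Out m Γ → Vec ℕ Γ → ℕ → Prog n
  compileᵒ (emit t)  xs d = compile t xs (1 + d) d ⨾ prepend d isBlank ⨾ loop d skip
  compileᵒ (o ⊹ o′)  xs d = compileᵒ o′ xs d ⨾ compileᵒ o xs d
  compileᵒ (for t o) xs d = compile t xs (1 + d) d ⨾ loop d (compileᵒ o (d ∷ xs) (1 + d))

  module _ (ws : Vec Word m) where

    Prepends : ∀ {Γ} → Out m Γ → Set
    Prepends {Γ} o = ∀ {xs ρ : Vec ℕ Γ} {d a σ w N} → Frame ws xs ρ d a σ → d + needᵒ o ≤ n → Bounded ws ρ N →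
      Runs ws (compileᵒ o xs d) σ w σ (⟦ o ⟧ᵒ ws ρ ++ w) (boundᵒ o N)

    clear-loop : ∀ {q} → Counter ws q → ∀ k {σ w} → σ q ≡ 0 → Runs ws (loop q skip) (upd σ q k) w σ w (k * 3 + 1)
    clear-loop {q} Q zero {σ} e = after ws (upd-self σ e) (loop-exit ws Q (upd-same σ q 0))
    clear-loop {q} Q (suc k) {σ} e =
      loop-step ws Q (upd-same σ q (suc k)) (after ws (upd-upd σ q (suc k) k) (skip-runs ws)) (clear-loop Q k e)

    counter-blank : ∀ {q} → Counter ws q → ∀ v → isBlank (cells ws q v) ≡ positive? v
    counter-blank Q v rewrite cells-counter ws (proj₁ Q) with v
    ... | zero  = refl
    ... | suc _ = refl

    emit-prepends : ∀ {Γ} (t : Tm m Γ) → Prepends (emit t)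
    emit-prepends t {ρ = ρ} {d} {σ = σ} {w} {N} F h B = weaken ws
      (+-monoʳ-≤ (bound t N) (+-monoʳ-≤ 1 (+-monoˡ-≤ 1 (*-monoˡ-≤ 3 (⟦⟧-bounded t B)))))
      (_⨾ʳ_ ws (adds-fresh ws {t = t} (adds ws t) F (room ws 1 ≤-refl h) B)
      (_⨾ʳ_ ws (after-out ws (cong (_∷ w) (trans (cong (isBlank ∘ cells ws d) (upd-same σ d v)) (counter-blank D v)))
                 (prepend-runs ws {c = isBlank} (ctr ws D)))
               (clear-loop D v (Frame.clean F d ≤-refl))))
      where
      v = ⟦ t ⟧ ws ρ
      D = room-ctr ws 0 (<-trans (Frame.m<a F) (Frame.a<d F)) h

    for-loop : ∀ {Γ} (o : Out m (suc Γ)) → Prepends o → ∀ {xs ρ d a σ N} → suc d + needᵒ o ≤ n → Counter ws d →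
      Frame ws xs ρ d a σ → ∀ k {w} → (∀ i → i < k → Bounded ws (i ∷ ρ) N) →
      Runs ws (loop d (compileᵒ o (d ∷ xs) (1 + d))) (upd σ d k) w σ
           (forBelow k (λ i → ⟦ o ⟧ᵒ ws (i ∷ ρ)) ++ w) (k * (2 + boundᵒ o N) + 1)
    for-loop o IH {d = d} {σ = σ} h D F zero B =
      after ws (upd-self σ (Frame.clean F d ≤-refl)) (loop-exit ws D (upd-same σ d 0))
    for-loop o IH {ρ = ρ} {d} {σ = σ} {N} h D F (suc k) {w} B = weaken ws
      (≤-reflexive (cong (2 +_) (sym (+-assoc (boundᵒ o N) _ 1))))
      (after-out ws (sym (++-assoc (forBelow k _) (⟦ o ⟧ᵒ ws (k ∷ ρ)) w))
        (loop-step ws D (upd-same σ d (suc k))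
          (before ws (upd-upd σ d (suc k) k) (IH (frame-bind ws k F) h (B k ≤-refl)))
          (for-loop o IH h D F k (λ i i<k → B i (m≤n⇒m≤1+n i<k)))))

    prepends : ∀ {Γ} (o : Out m Γ) → Prepends o
    prepends (emit t) = emit-prepends t
    prepends (o ⊹ o′) {ρ = ρ} {w = w} F h B = after-out ws (sym (++-assoc (⟦ o ⟧ᵒ ws ρ) (⟦ o′ ⟧ᵒ ws ρ) w))
      (_⨾ʳ_ ws (prepends o′ F (room ws 0 (m≤n+m (needᵒ o′) (needᵒ o)) h) B)
               (prepends o F (room ws 0 (m≤m+n (needᵒ o) (needᵒ o′)) h) B))
    prepends (for t o) {ρ = ρ} {d} {N = N} F h B = weaken ws
      (+-monoʳ-≤ (bound t N) (+-monoˡ-≤ 1 (*-monoˡ-≤ (2 + boundᵒ o (N + bound t N)) k≤)))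
      (_⨾ʳ_ ws (adds-fresh ws {t = t} (adds ws t) F (room ws 1 (m≤m+n (need t) (needᵒ o)) h) B)
               (for-loop o (prepends o) (room ws 1 (m≤n+m (needᵒ o) (need t)) h)
                 (room-ctr ws 0 (<-trans (Frame.m<a F) (Frame.a<d F)) h) F (⟦ t ⟧ ws ρ)
                 (λ i i<k → bounded-∷ B (≤-trans (<⇒≤ i<k) k≤))))
      where k≤ = ⟦⟧-bounded t B

length≤size : ∀ {m} (ws : Vec Word m) j → length (Vec.lookup ws j) ≤ size ws
length≤size (w ∷ ws) zero    = m≤m+n _ _
length≤size (w ∷ ws) (suc j) = ≤-trans (length≤size ws j) (m≤n+m _ (length w))

nth-initial : ∀ {m} (ws : Vec Word m) k r →
              nth emptyTape (Vec.map wordTape ws Vec.++ Vec.replicate k (emptyTape {0})) r ≡ wordTape (nth [] ws r)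
nth-initial []       zero    r       = refl
nth-initial []       (suc k) zero    = refl
nth-initial []       (suc k) (suc r) = nth-initial [] k r
nth-initial (w ∷ ws) k       zero    = refl
nth-initial (w ∷ ws) k       (suc r) = nth-initial ws k r

nth-beyond : ∀ {A : Set} {m} {z : A} (xs : Vec A m) {r} → m ≤ r → nth z xs r ≡ z
nth-beyond []       _         = refl
nth-beyond (x ∷ xs) (s≤s m≤r) = nth-beyond xs m≤r

bitPrefix-bits : ∀ {a} w → bitPrefix {a} (List.map bit w) ≡ w
bitPrefix-bits []      = refl
bitPrefix-bits (b ∷ w) = cong (b ∷_) (bitPrefix-bits w)

module _ {m : ℕ} (o : Out m 0) where
  private
    work : ℕ
    work = suc (needᵒ o)

  open Registers m work
  open Evaluation m work
  open Writing m work

  private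
    -- The work tapes start blank, so the counters have to be given their zero marks.
    mark : (ℕ → Symbol 0) → ℕ → Symbol 0 × Move
    mark h r = (if m <ᵇ r then bit true else h r) , stay

    -- After the last prepending the output head stands one cell to the left of the word.
    unwind : (ℕ → Symbol 0) → ℕ → Symbol 0 × Move
    unwind h r = h r , (if r ≡ᵇ m then right else stay)

    program : Prog n
    program = action mark ⨾ compileᵒ o [] (2 + m) ⨾ action unwind

    origin : ℕ → ℕ
    origin _ = 0

    module _ (ws : Vec Word m) where

      inputs : Tapes n
      inputs = Vec.map wordTape ws Vec.++ Vec.replicate (suc work) emptyTape

      marked : Tapes n
      marked = apply inputs (Vec.tabulate (mark (nth blank (heads inputs)) ∘ toℕ))

      nth-marked : ∀ {r} → r < n → nth emptyTape marked r ≡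
                   writeMove (wordTape (nth [] ws r)) (mark (λ i → Tape.head (wordTape {0} (nth [] ws i))) r)
      nth-marked {r} r<n = trans (nth-apply inputs (mark (nth blank (heads inputs))) r<n)
        (cong₂ writeMove (nth-initial ws (suc work) r)
          (cong (λ s → (if m <ᵇ r then bit true else s) , stay)
            (trans (nth-map Tape.head inputs r) (cong Tape.head (nth-initial ws (suc work) r)))))

      marked-rep : Rep ws origin [] marked
      marked-rep = rep regs (trans (nth-marked m<n) out)
        where
        regs : ∀ r → r < n → r ≢ m → At (cells ws r) 0 (nth emptyTape marked r)
        regs r r<n r≢m = subst (At (cells ws r) 0) (sym (nth-marked r<n)) (lemma refl)
          where
          lemma : ∀ {b} → (m <ᵇ r) ≡ b → At (if b then counterCells else wordCells (nth [] ws r)) 0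
                  (writeMove (wordTape (nth [] ws r)) ((if b then bit true else Tape.head (wordTape {0} (nth [] ws r))) , stay))
          lemma {false} _ = wordTape-at (nth [] ws r)
          lemma {true}  e rewrite nth-beyond {z = []} ws (<⇒≤ (<ᵇ⇒< m r (subst T (sym e) tt))) = atPos refl (λ _ → refl) tt
        out : writeMove (wordTape (nth [] ws m)) (mark (λ i → Tape.head (wordTape {0} (nth [] ws i))) m) ≡ emptyTape
        out with m <ᵇ m in e
        ... | true  = contradiction (<ᵇ⇒< m m (subst T (sym e) tt)) (<-irrefl refl)
        ... | false rewrite nth-beyond {z = []} ws {m} ≤-refl = refl

      -- A frame names an accumulator; here it is register `1 + m`, between the output tape and the
      -- scratch registers. This is why `work` exceeds `needᵒ o` by one.
      origin-frame : Frame ws [] [] (2 + m) (1 + m) origin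
      origin-frame = frame (λ ()) (λ ()) ≤-refl ≤-refl (λ _ _ → refl) (λ _ _ → refl)

      output-unwound : ∀ {ts} → Rep ws origin (⟦ o ⟧ᵒ ws [] ++ []) ts →
        readTape (Vec.lookup (apply ts (Vec.tabulate (unwind (nth blank (heads ts)) ∘ toℕ))) (m ↑ʳ zero)) ≡ ⟦ o ⟧ᵒ ws []
      output-unwound {ts} R = trans (cong readTape (trans (sym (nth-lookup {z = emptyTape} end (m ↑ʳ zero)))
          (cong (nth emptyTape end) (trans (toℕ-↑ʳ m zero) (+-identityʳ m)))))
        (trans (cong readTape (trans (nth-apply ts (unwind (nth blank (heads ts))) m<n) moved))
          (trans (read (⟦ o ⟧ᵒ ws [] ++ [])) (++-identityʳ _)))
        where
        end : Tapes n
        end = apply ts (Vec.tabulate (unwind (nth blank (heads ts)) ∘ toℕ))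
        moved : writeMove (nth emptyTape ts m) (unwind (nth blank (heads ts)) m) ≡
                moveHead right (tape [] blank (List.map bit (⟦ o ⟧ᵒ ws [] ++ [])))
        moved with m ≡ᵇ m | ≡⇒≡ᵇ m m refl
        ... | true | _ rewrite nth-map {z = emptyTape} Tape.head ts m | Rep.outp R = refl
        read : ∀ w → readTape {0} (moveHead right (tape [] blank (List.map bit w))) ≡ w
        read []      = refl
        read (b ∷ w) = cong (b ∷_) (bitPrefix-bits w)

  polyTime : PolyTime (λ ws → ⟦ o ⟧ᵒ ws [])
  polyTime = compiled m work program , proj₁ poly , λ ws →
    let (t , ts , r , R , t≤) = prepends ws o {a = 1 + m} (origin-frame ws) fits (bounded (λ ()) (length≤size ws)) _ (marked-rep ws)
    in _ , _ , compiled-run m work program (⨾-left (leave refl) (⨾-left r (leave refl))) ,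
       ≤-trans (+-monoʳ-≤ 1 (+-monoˡ-≤ 1 t≤)) (≤-reflexive (proj₂ poly (size ws))) , output-unwound ws R
    where
    poly = poly-+ (poly-const 1) (poly-+ (boundᵒ-poly o) (poly-const 1))
    fits : 2 + m + needᵒ o ≤ n
    fits = ≤-reflexive (trans (cong (_+ needᵒ o) (+-comm 2 m)) (+-assoc m 2 (needᵒ o)))

-- Formulas

data Fm (m : ℕ) : ℕ → Set where
  _≤ᶠ_ _≡ᶠ_      : ∀ {Γ} → Tm m Γ → Tm m Γ → Fm m Γ
  _∧ᶠ_ _∨ᶠ_ _⇒ᶠ_ : ∀ {Γ} → Fm m Γ → Fm m Γ → Fm m Γ
  ¬ᶠ_            : ∀ {Γ} → Fm m Γ → Fm m Γ
  ∀ᶠ ∃ᶠ          : ∀ {Γ} → Tm m Γ → Fm m (suc Γ) → Fm m Γ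
  renᶠ           : ∀ {Γ Δ} → Vec (Fin Δ) Γ → Fm m Γ → Fm m Δ
  anyᶠ           : ∀ {Γ} k → (Fin k → Fm m Γ) → Fm m Γ

infix  8 ¬ᶠ_
infix  5 _≤ᶠ_ _≡ᶠ_
infixr 4 _∧ᶠ_
infixr 3 _∨ᶠ_
infixr 2 _⇒ᶠ_

⟦_⟧ᶠ : ∀ {m Γ} → Fm m Γ → Vec Word m → Vec ℕ Γ → Set
⟦ t ≤ᶠ u ⟧ᶠ   ws ρ = ⟦ t ⟧ ws ρ ≤ ⟦ u ⟧ ws ρ
⟦ t ≡ᶠ u ⟧ᶠ   ws ρ = ⟦ t ⟧ ws ρ ≡ ⟦ u ⟧ ws ρ
⟦ φ ∧ᶠ ψ ⟧ᶠ   ws ρ = ⟦ φ ⟧ᶠ ws ρ × ⟦ ψ ⟧ᶠ ws ρ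
⟦ φ ∨ᶠ ψ ⟧ᶠ   ws ρ = ⟦ φ ⟧ᶠ ws ρ ⊎ ⟦ ψ ⟧ᶠ ws ρ
⟦ φ ⇒ᶠ ψ ⟧ᶠ   ws ρ = ⟦ φ ⟧ᶠ ws ρ → ⟦ ψ ⟧ᶠ ws ρ
⟦ ¬ᶠ φ ⟧ᶠ     ws ρ = ¬ ⟦ φ ⟧ᶠ ws ρ
⟦ ∀ᶠ t φ ⟧ᶠ   ws ρ = ∀ i → i < ⟦ t ⟧ ws ρ → ⟦ φ ⟧ᶠ ws (i ∷ ρ)
⟦ ∃ᶠ t φ ⟧ᶠ   ws ρ = ∃[ i ] i < ⟦ t ⟧ ws ρ × ⟦ φ ⟧ᶠ ws (i ∷ ρ)
⟦ renᶠ is φ ⟧ᶠ ws ρ = ⟦ φ ⟧ᶠ ws (Vec.map (Vec.lookup ρ) is)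
⟦ anyᶠ k φ ⟧ᶠ ws ρ = ∃[ i ] ⟦ φ i ⟧ᶠ ws ρ

someOf : ∀ {m Γ} k → (Fin k → Tm m Γ) → Tm m Γ
someOf zero    t = lit 0
someOf (suc k) t = t zero ⊕ someOf k (t ∘ suc)

-- Truth is positivity, so disjunction and bounded existence become sums and conjunction becomes a
-- product; the values need not be 0 or 1.
term : ∀ {m Γ} → Fm m Γ → Tm m Γ
term (t ≤ᶠ u)   = lit 1 ⊖ (t ⊖ u)
term (t ≡ᶠ u)   = lit 1 ⊖ ((t ⊖ u) ⊕ (u ⊖ t))
term (φ ∧ᶠ ψ)   = term φ ⊗ term ψ
term (φ ∨ᶠ ψ)   = term φ ⊕ term ψ
term (φ ⇒ᶠ ψ)   = (lit 1 ⊖ term φ) ⊕ term ψ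
term (¬ᶠ φ)     = lit 1 ⊖ term φ
term (∀ᶠ t φ)   = lit 1 ⊖ sum t (lit 1 ⊖ term φ)
term (∃ᶠ t φ)   = sum t (term φ)
term (renᶠ is φ) = ren is (term φ)
term (anyᶠ k φ) = someOf k (term ∘ φ)

positive-∸ : ∀ {n} → 0 < 1 ∸ n → n ≡ 0
positive-∸ {zero}  _ = refl
positive-∸ {suc n} h = contradiction (subst (0 <_) (0∸n≡0 n) h) (λ ())

∸-positive : ∀ {n} → n ≡ 0 → 0 < 1 ∸ n
∸-positive refl = s≤s z≤n

sumBelow-positive : ∀ k {f} → 0 < sumBelow k f → ∃[ i ] i < k × 0 < f i
sumBelow-positive (suc k) {f} h with f k in e
... | suc _ = k , ≤-refl , subst (0 <_) (sym e) (s≤s z≤n)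
... | zero  = let (i , i<k , p) = sumBelow-positive k h in i , m≤n⇒m≤1+n i<k , p

positive-sumBelow : ∀ k {f i} → i < k → 0 < f i → 0 < sumBelow k f
positive-sumBelow (suc k) {f} {i} (s≤s i≤k) p with i ≟ k
... | yes refl = <-≤-trans p (m≤m+n (f k) _)
... | no  i≢k  = <-≤-trans (positive-sumBelow k (≤∧≢⇒< i≤k i≢k) p) (m≤n+m _ (f k))

*-positive : ∀ a {b} → 0 < a * b → 0 < a × 0 < b
*-positive (suc a) {zero}  h = contradiction (subst (0 <_) (*-zeroʳ a) h) (λ ())
*-positive (suc a) {suc b} h = s≤s z≤n , s≤s z≤n

+-positive : ∀ a {b} → 0 < a + b → 0 < a ⊎ 0 < b
+-positive zero    h = inj₂ h
+-positive (suc a) h = inj₁ (s≤s z≤n)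

module _ {m : ℕ} (ws : Vec Word m) where

  someOf-positive : ∀ {Γ} k (t : Fin k → Tm m Γ) {ρ} → 0 < ⟦ someOf k t ⟧ ws ρ → ∃[ i ] 0 < ⟦ t i ⟧ ws ρ
  someOf-positive (suc k) t h = [ (zero ,_) , (λ p → let (i , q) = someOf-positive k (t ∘ suc) p in suc i , q) ]′ (+-positive _ h)

  positive-someOf : ∀ {Γ k} (t : Fin k → Tm m Γ) {ρ} i → 0 < ⟦ t i ⟧ ws ρ → 0 < ⟦ someOf k t ⟧ ws ρ
  positive-someOf t zero    p = <-≤-trans p (m≤m+n _ _)
  positive-someOf t (suc i) p = <-≤-trans (positive-someOf (t ∘ suc) i p) (m≤n+m _ _)

  -- The two directions are mutually recursive, since implication, negation and the universal
  -- quantifier exchange them. Together they make every formula decidable, and this supplies the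
  -- case distinctions.
  holds⇒ : ∀ {Γ} (φ : Fm m Γ) {ρ} → 0 < ⟦ term φ ⟧ ws ρ → ⟦ φ ⟧ᶠ ws ρ
  ⇒holds : ∀ {Γ} (φ : Fm m Γ) {ρ} → ⟦ φ ⟧ᶠ ws ρ → 0 < ⟦ term φ ⟧ ws ρ

  fails⇒ : ∀ {Γ} (φ : Fm m Γ) {ρ} → ¬ ⟦ φ ⟧ᶠ ws ρ → ⟦ term φ ⟧ ws ρ ≡ 0
  fails⇒ φ {ρ} ¬φ with ⟦ term φ ⟧ ws ρ in e
  ... | zero  = refl
  ... | suc _ = contradiction (holds⇒ φ (subst (0 <_) (sym e) (s≤s z≤n))) ¬φ

  dec : ∀ {Γ} (φ : Fm m Γ) ρ → Dec (⟦ φ ⟧ᶠ ws ρ)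
  dec φ ρ with 0 <? ⟦ term φ ⟧ ws ρ
  ... | yes p = yes (holds⇒ φ p)
  ... | no ¬p = no (¬p ∘ ⇒holds φ)

  holds⇒ (t ≤ᶠ u) h = m∸n≡0⇒m≤n (positive-∸ h)
  holds⇒ (t ≡ᶠ u) {ρ} h = let e = positive-∸ {⟦ t ⟧ ws ρ ∸ ⟦ u ⟧ ws ρ + (⟦ u ⟧ ws ρ ∸ ⟦ t ⟧ ws ρ)} h in
    ≤-antisym (m∸n≡0⇒m≤n (m+n≡0⇒m≡0 _ e)) (m∸n≡0⇒m≤n (m+n≡0⇒n≡0 (⟦ t ⟧ ws ρ ∸ ⟦ u ⟧ ws ρ) e))
  holds⇒ (φ ∧ᶠ ψ) h = let (p , q) = *-positive _ h in holds⇒ φ p , holds⇒ ψ q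
  holds⇒ (φ ∨ᶠ ψ) h = [ inj₁ ∘ holds⇒ φ , inj₂ ∘ holds⇒ ψ ]′ (+-positive _ h)
  holds⇒ (φ ⇒ᶠ ψ) {ρ} h x = [ (λ p → contradiction (positive-∸ p) (λ e → <⇒≢ (⇒holds φ x) (sym e))) , holds⇒ ψ ]′
    (+-positive (1 ∸ ⟦ term φ ⟧ ws ρ) h)
  holds⇒ (¬ᶠ φ)   h x = <⇒≢ (⇒holds φ x) (sym (positive-∸ h))
  holds⇒ (∀ᶠ t φ) {ρ} h i i< with dec φ (i ∷ ρ)
  ... | yes p = p
  ... | no ¬p = contradiction (positive-∸ h) λ e → <⇒≢ (positive-sumBelow (⟦ t ⟧ ws ρ) {λ j → 1 ∸ ⟦ term φ ⟧ ws (j ∷ ρ)} i<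
                  (∸-positive (fails⇒ φ ¬p))) (sym e)
  holds⇒ (∃ᶠ t φ) {ρ} h = let (i , i< , p) = sumBelow-positive (⟦ t ⟧ ws ρ) h in i , i< , holds⇒ φ p
  holds⇒ (renᶠ is φ) h = holds⇒ φ h
  holds⇒ (anyᶠ k φ) h = let (i , p) = someOf-positive k (term ∘ φ) h in i , holds⇒ (φ i) p

  ⇒holds (t ≤ᶠ u) h = ∸-positive (m≤n⇒m∸n≡0 h)
  ⇒holds (t ≡ᶠ u) h = ∸-positive (cong₂ _+_ (m≤n⇒m∸n≡0 (≤-reflexive h)) (m≤n⇒m∸n≡0 (≤-reflexive (sym h))))
  ⇒holds (φ ∧ᶠ ψ) (p , q) = *-mono-≤ (⇒holds φ p) (⇒holds ψ q)
  ⇒holds (φ ∨ᶠ ψ) (inj₁ p) = <-≤-trans (⇒holds φ p) (m≤m+n _ _)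
  ⇒holds (φ ∨ᶠ ψ) (inj₂ p) = <-≤-trans (⇒holds ψ p) (m≤n+m _ _)
  ⇒holds (φ ⇒ᶠ ψ) {ρ} h with dec φ ρ
  ... | yes p = <-≤-trans (⇒holds ψ (h p)) (m≤n+m _ (1 ∸ ⟦ term φ ⟧ ws ρ))
  ... | no ¬p = <-≤-trans (∸-positive (fails⇒ φ ¬p)) (m≤m+n _ _)
  ⇒holds (¬ᶠ φ)   h = ∸-positive (fails⇒ φ h)
  ⇒holds (∀ᶠ t φ) {ρ} h with sumBelow (⟦ t ⟧ ws ρ) (λ i → 1 ∸ ⟦ term φ ⟧ ws (i ∷ ρ)) in e
  ... | zero  = s≤s z≤n
  ... | suc _ = let (i , i< , p) = sumBelow-positive (⟦ t ⟧ ws ρ) (subst (0 <_) (sym e) (s≤s z≤n))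
                in contradiction (positive-∸ p) (λ e → <⇒≢ (⇒holds φ (h i i<)) (sym e))
  ⇒holds (∃ᶠ t φ) {ρ} (i , i< , p) = positive-sumBelow (⟦ t ⟧ ws ρ) i< (⇒holds φ p)
  ⇒holds (renᶠ is φ) h = ⇒holds φ h
  ⇒holds (anyᶠ k φ) (i , p) = positive-someOf (term ∘ φ) i (⇒holds (φ i) p)

positive?-true : ∀ {n} → positive? n ≡ true → 0 < n
positive?-true {suc n} _ = s≤s z≤n

true-positive? : ∀ {n} → 0 < n → positive? n ≡ true
true-positive? (s≤s _) = refl

polyT : ∀ {m Γ} → Polynomial → Tm m Γ → Tm m Γ
polyT []      t = lit 0
polyT (c ∷ p) t = lit c ⊕ t ⊗ polyT p t

⟦polyT⟧ : ∀ {m Γ} p (t : Tm m Γ) ws ρ → ⟦ polyT p t ⟧ ws ρ ≡ eval p (⟦ t ⟧ ws ρ)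
⟦polyT⟧ []      t ws ρ = refl
⟦polyT⟧ (c ∷ p) t ws ρ = cong (λ e → c + ⟦ t ⟧ ws ρ * e) (⟦polyT⟧ p t ws ρ)

-- Graphs of diameter two

argmin : ∀ {n} (f : Fin (suc n) → ℕ) → ∃[ i ] ∀ j → f i ≤ f j
argmin {zero}  f = zero , λ { zero → ≤-refl }
argmin {suc n} f with argmin (f ∘ suc)
... | i , least with ≤-total (f zero) (f (suc i))
...   | inj₁ p = zero , λ { zero → ≤-refl ; (suc j) → ≤-trans p (least j) }
...   | inj₂ p = suc i , λ { zero → p ; (suc j) → least j }

module _ (G : Graph) where
  open Graph G

  Adj? : ∀ u v → Dec (Adj u v)
  Adj? u v = adj u v 𝔹.≟ true

  Adj-sym : ∀ {u v} → Adj u v → Adj v u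
  Adj-sym {u} {v} e = trans (adj-sym v u) e

  Adj-irrefl : ∀ {u v} → Adj u v → u ≢ v
  Adj-irrefl {u} e refl = contradiction (trans (sym (irrefl u)) e) λ ()

  -- That the neighbours of `i` are neither equal nor consecutive is where a length of at least 4
  -- enters. The cases are a wrap-around at the start, none, and one at the end.
  cycle-neighbours : ∀ m (i : Fin (4 + m)) → ∃[ j ] ∃[ k ] CyclicSuc G i j × CyclicSuc G k i × j ≢ k ×
                     ¬ CyclicSuc G j k × ¬ CyclicSuc G k j
  cycle-neighbours m zero = suc zero , last , inj₁ refl , inj₂ (cong suc last≡ , refl) ,
      (λ e → contradiction (trans (cong toℕ e) last≡) λ ()) ,
      (λ { (inj₁ e) → contradiction (trans (sym last≡) e) λ () ; (inj₂ (() , _)) }) ,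
      (λ { (inj₁ e) → contradiction (trans e (cong suc last≡)) λ () ; (inj₂ (_ , ())) })
    where
    last : Fin (4 + m)
    last = fromℕ< (n<1+n (3 + m))
    last≡ : toℕ last ≡ 3 + m
    last≡ = toℕ-fromℕ< (n<1+n (3 + m))
  cycle-neighbours m (suc i) with suc (suc (toℕ i)) <? 4 + m
  ... | yes p = next′ , prev , inj₁ next≡ , inj₁ (cong suc (sym prev≡)) ,
      (λ e → contradiction (trans (sym next≡) (trans (cong toℕ e) prev≡)) (<⇒≢ (s≤s (n≤1+n _)) ∘ sym)) ,
      (λ { (inj₁ e) → contradiction (trans (sym prev≡) (trans e (cong suc next≡))) (<⇒≢ (s≤s (≤-trans (n≤1+n _) (n≤1+n _))))
         ; (inj₂ (e , e′)) → contradiction (trans (cong suc (trans (cong (2 +_) (trans (sym e′) prev≡)) (sym next≡))) e) λ () }) ,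
      (λ { (inj₁ e) → contradiction (trans (sym next≡) (trans e (cong suc prev≡))) (<⇒≢ ≤-refl ∘ sym)
         ; (inj₂ (e , _)) → contradiction (trans (sym (cong suc prev≡)) e) (<⇒≢ (toℕ<n (suc i))) })
    where
    next′ prev : Fin (4 + m)
    next′ = fromℕ< p
    prev  = inject₁ i
    next≡ : toℕ next′ ≡ suc (suc (toℕ i))
    next≡ = toℕ-fromℕ< p
    prev≡ : toℕ prev ≡ toℕ i
    prev≡ = 𝔽.toℕ-inject₁ i
  ... | no ¬p = zero , prev , inj₂ (end , refl) , inj₁ (cong suc (sym prev≡)) ,
      (λ e → contradiction (trans (cong toℕ e) prev≡′) λ ()) ,
      (λ { (inj₁ e) → contradiction (trans (sym prev≡′) e) λ () ; (inj₂ (() , _)) }) ,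
      (λ { (inj₁ ()) ; (inj₂ (e , _)) → contradiction (trans (sym (cong suc prev≡)) e) (<⇒≢ (toℕ<n (suc i))) })
    where
    prev : Fin (4 + m)
    prev  = inject₁ i
    end : suc (suc (toℕ i)) ≡ 4 + m
    end = ≤-antisym (toℕ<n (suc i)) (≮⇒≥ ¬p)
    prev≡ : toℕ prev ≡ toℕ i
    prev≡ = 𝔽.toℕ-inject₁ i
    prev≡′ : toℕ prev ≡ 2 + m
    prev≡′ = trans prev≡ (suc-injective (suc-injective end))

  -- A vertex of minimal rank on an induced cycle would have two adjacent
  -- neighbours on it.
  chordal-by-rank : (rank : Vertex → ℕ) →
    (∀ {v a b} → Adj v a → Adj v b → rank v ≤ rank a → rank v ≤ rank b → a ≡ b ⊎ Adj a b) → Chordal G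
  chordal-by-rank rank simplicial .(4 + m) (s≤s (s≤s (s≤s (s≤s {n = m} z≤n)))) (c , inj , cyc) =
    let (i , least) = argmin (rank ∘ c)
        (j , k , ij , ki , j≢k , ¬jk , ¬kj) = cycle-neighbours m i
    in [ j≢k ∘ inj , [ ¬jk , ¬kj ]′ ∘ Equivalence.to (cyc j k) ]′
       (simplicial (Equivalence.from (cyc i j) (inj₁ ij)) (Equivalence.from (cyc i k) (inj₂ ki)) (least j) (least k))

  Near : Vertex → Vertex → Set
  Near u v = u ≡ v ⊎ Adj u v ⊎ (∃[ x ] Adj u x × Adj x v)

  path₁ : ∀ {u v} → Adj u v → Path G u v 1
  path₁ e = e ∷ [] , (Adj-irrefl e ∷ []) ∷ [] ∷ []

  path₂ : ∀ {u x v} → u ≢ v → Adj u x → Adj x v → Path G u v 2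
  path₂ n e f = e ∷ f ∷ [] , (Adj-irrefl e ∷ n ∷ []) ∷ (Adj-irrefl f ∷ []) ∷ [] ∷ []

  distinct-far : ∀ {u v} → u ≢ v → ∀ l → Path G u v l → 1 ≤ l
  distinct-far n _ ([] , _)    = contradiction refl n
  distinct-far n _ (_ ∷ _ , _) = s≤s z≤n

  nonadjacent-far : ∀ {u v} → u ≢ v → ¬ Adj u v → ∀ l → Path G u v l → 2 ≤ l
  nonadjacent-far n ¬e _ ([] , _)        = contradiction refl n
  nonadjacent-far n ¬e _ (e ∷ [] , _)    = contradiction e ¬e
  nonadjacent-far n ¬e _ (_ ∷ _ ∷ _ , _) = s≤s (s≤s z≤n)

  near-distance : ∀ {u v} → Near u v → ∃[ e ] Distance G u v e × e ≤ 2
  near-distance {u} {v} near with u 𝔽.≟ v | Adj? u v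
  ... | yes refl | _     = 0 , (([] , [] ∷ []) , λ _ _ → z≤n) , z≤n
  ... | no n     | yes e = 1 , (path₁ e , distinct-far n) , s≤s z≤n
  ... | no n     | no ¬e with near
  ...   | inj₁ e                    = contradiction e n
  ...   | inj₂ (inj₁ e)             = contradiction e ¬e
  ...   | inj₂ (inj₂ (x , e , f))   = 2 , (path₂ n e f , nonadjacent-far n ¬e) , ≤-refl

  distance-near : ∀ {u v e} → Distance G u v e → e ≤ 2 → Near u v
  distance-near (([] , _) , _)            _ = inj₁ refl
  distance-near ((e ∷ [] , _) , _)        _ = inj₂ (inj₁ e)
  distance-near ((e ∷ f ∷ [] , _) , _)    _ = inj₂ (inj₂ (_ , e , f))
  distance-near ((_ ∷ _ ∷ _ ∷ _ , _) , _) (s≤s (s≤s ()))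

  near⇒diameter : (∀ u v → Near u v) → ∀ {u v} → u ≢ v → ¬ Adj u v → HasDiameter G 2
  near⇒diameter near {u} {v} n ¬e = (λ u v → near-distance (near u v)) , u , v , far (near u v)
    where
    far : Near u v → Distance G u v 2
    far (inj₁ e)                  = contradiction e n
    far (inj₂ (inj₁ e))           = contradiction e ¬e
    far (inj₂ (inj₂ (x , e , f))) = path₂ n e f , nonadjacent-far n ¬e

  diameter⇒near : HasDiameter G 2 → ∀ u v → Near u v
  diameter⇒near (d , _) u v = let (_ , dist , e≤2) = d u v in distance-near dist e≤2

  diameter⇒far : HasDiameter G 2 → ∃[ u ] ∃[ v ] u ≢ v × ¬ Adj u v
  diameter⇒far (_ , u , v , _ , least) = u , v ,
    (λ { refl → contradiction (least 0 ([] , [] ∷ [])) λ () }) ,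
    (λ e → contradiction (least 1 (path₁ e)) λ { (s≤s ()) })

  near⇒connected : (∀ u v → Near u v) → Connected G
  near⇒connected near u v = let (e , (p , _) , _) = near-distance (near u v) in e , p

  -- In diameter two a shortest path assignment amounts to the choice of one
  -- common neighbour for every pair of nonadjacent vertices.
  MiddleSet : Subset order → (Vertex → Vertex → Vertex) → Set
  MiddleSet S mid = ∀ x → x ∉ˢ S → ∃[ u ] ∃[ v ] u ∈ˢ S × v ∈ˢ S × u <ᶠ v ×
    ¬ Adj u v × Adj u x × Adj x v × mid u v ≡ x

  second : ∀ {u v l} → Walk G u v l → Vertex
  second {u} []            = u
  second (_∷_ {v = v} _ _) = v

  -- `Near` excludes shortest paths of length above 2, and on the others the only vertex besides the
  -- ends is the second one of a path of length 2.
  inner-vertex : ∀ {u v x} → Near u v → (p : ShortestPath G u v) → x ≢ u → x ≢ v → x ∈ˡ pathVertices G p →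
                 ¬ Adj u v × Adj u x × Adj x v × second (proj₁ (proj₁ (proj₂ p))) ≡ x
  inner-vertex near (_ , ([] , _) , _)     xu xv (here e)           = contradiction e xu
  inner-vertex near (_ , (e ∷ [] , _) , _) xu xv (here e′)          = contradiction e′ xu
  inner-vertex near (_ , (e ∷ [] , _) , _) xu xv (there (here e′))  = contradiction e′ xv
  inner-vertex near (_ , (e ∷ f ∷ [] , _) , _) xu xv (here e′)                 = contradiction e′ xu
  inner-vertex near (_ , (e ∷ f ∷ [] , _) , least) xu xv (there (here refl))   =
    (λ g → contradiction (least 1 (path₁ g)) λ { (s≤s ()) }) , e , f , refl
  inner-vertex near (_ , (e ∷ f ∷ [] , _) , _) xu xv (there (there (here e′))) = contradiction e′ xv
  inner-vertex near (_ , (_ ∷ _ ∷ _ ∷ _ , _) , least) xu xv _ =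
    let (_ , (p , _) , e≤2) = near-distance near
    in contradiction (≤-trans (least _ p) e≤2) λ { (s≤s (s≤s ())) }

  -- An assignment takes membership proofs as arguments, so `mid` obtains them by deciding
  -- membership, and `mid≡` relies on the uniqueness of these proofs. Elsewhere the value of `mid`
  -- is arbitrary.
  strong⇒middle : (∀ u v → Near u v) → ∀ {S} → StrongGeodeticSet G S → ∃ (MiddleSet S)
  strong⇒middle near {S} (I , covers) = mid , λ x x∉S →
    let (u , v , u∈S , v∈S , u<v , x∈) = covers x x∉S
        (¬e , e , f , s) = inner-vertex (near u v) (I u v u∈S v∈S u<v)
                             (λ e → x∉S (subst (_∈ˢ S) (sym e) u∈S)) (λ e → x∉S (subst (_∈ˢ S) (sym e) v∈S)) x∈
    in u , v , u∈S , v∈S , u<v , ¬e , e , f , trans (mid≡ u∈S v∈S u<v) s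
    where
    mid : Vertex → Vertex → Vertex
    mid u v with u ∈? S | v ∈? S | u 𝔽.<? v
    ... | yes p | yes q | yes r = second (proj₁ (proj₁ (proj₂ (I u v p q r))))
    ... | _     | _     | _     = u
    mid≡ : ∀ {u v} (p : u ∈ˢ S) (q : v ∈ˢ S) (r : u <ᶠ v) → mid u v ≡ second (proj₁ (proj₁ (proj₂ (I u v p q r))))
    mid≡ {u} {v} p q r with u ∈? S | v ∈? S | u 𝔽.<? v
    ... | yes p′ | yes q′ | yes r′ rewrite []=-irrelevant p p′ | []=-irrelevant q q′ | <-irrelevant r r′ = refl
    ... | no ¬p  | _      | _      = contradiction p ¬p
    ... | yes _  | no ¬q  | _      = contradiction q ¬q
    ... | yes _  | yes _  | no ¬r  = contradiction r ¬r

  -- `mid` is a total function and may name vertices on no shortest path. So `assign` follows it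
  -- only where it gives a common neighbour of a nonadjacent pair, and otherwise takes any shortest
  -- path.
  middle⇒strong : (∀ u v → Near u v) → ∀ {S mid} → MiddleSet S mid → StrongGeodeticSet G S
  middle⇒strong near {S} {mid} middle = (λ u v _ _ u<v → assign u<v (Adj? u v) (Adj? u (mid u v)) (Adj? (mid u v) v)) ,
    λ x x∉S → let (u , v , u∈S , v∈S , u<v , ¬e , e , f , m≡x) = middle x x∉S in
      u , v , u∈S , v∈S , u<v ,
      passes u<v (Adj? u v) (Adj? u (mid u v)) (Adj? (mid u v) v) ¬e
        (subst (Adj u) (sym m≡x) e) (subst (λ y → Adj y v) (sym m≡x) f) m≡x
    where
    assign : ∀ {u v x} → u <ᶠ v → Dec (Adj u v) → Dec (Adj u x) → Dec (Adj x v) → ShortestPath G u v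
    assign u<v (no ¬e) (yes e) (yes f) = 2 , path₂ (𝔽.<⇒≢ u<v) e f , nonadjacent-far (𝔽.<⇒≢ u<v) ¬e
    assign {u} {v} u<v _ _ _           = let (d , D , _) = near-distance (near u v) in d , D
    passes : ∀ {u v x y} (u<v : u <ᶠ v) (d : Dec (Adj u v)) (d₁ : Dec (Adj u x)) (d₂ : Dec (Adj x v)) →
             ¬ Adj u v → Adj u x → Adj x v → x ≡ y → y ∈ˡ pathVertices G (assign u<v d d₁ d₂)
    passes u<v (yes e) _ _ ¬e _ _ _            = contradiction e ¬e
    passes u<v (no _) (no ¬e) _ _ e _ _        = contradiction e ¬e
    passes u<v (no _) (yes _) (no ¬f) _ _ f _  = contradiction f ¬f
    passes u<v (no _) (yes _) (yes _) _ _ _ eq = there (here (sym eq))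

-- From satisfiability to strong geodetic sets

select : ∀ {n} (S : Subset n) → Fin ∣ S ∣ → Fin n
select (true ∷ S)  zero    = zero
select (true ∷ S)  (suc i) = suc (select S i)
select (false ∷ S) i       = suc (select S i)

select-∈ : ∀ {n} (S : Subset n) i → select S i ∈ˢ S
select-∈ (true ∷ S)  zero    = here
select-∈ (true ∷ S)  (suc i) = there (select-∈ S i)
select-∈ (false ∷ S) i       = there (select-∈ S i)

select-injective : ∀ {n} (S : Subset n) {i j} → select S i ≡ select S j → i ≡ j
select-injective (true ∷ S)  {zero}  {zero}  _ = refl
select-injective (true ∷ S)  {suc i} {suc j} e = cong suc (select-injective S (𝔽.suc-injective e))
select-injective (false ∷ S)                 e = select-injective S (𝔽.suc-injective e)

position : ∀ {n} {S : Subset n} {x} → x ∈ˢ S → Fin ∣ S ∣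
position {S = true ∷ S}  here      = zero
position {S = true ∷ S}  (there p) = suc (position p)
position {S = false ∷ S} (there p) = position p

position-injective : ∀ {n} {S : Subset n} {x y} (p : x ∈ˢ S) (q : y ∈ˢ S) → position p ≡ position q → x ≡ y
position-injective {S = true ∷ S}  here      here      _ = refl
position-injective {S = true ∷ S}  (there p) (there q) e = cong suc (position-injective p q (𝔽.suc-injective e))
position-injective {S = false ∷ S} (there p) (there q) e = cong suc (position-injective p q e)

size-≥ : ∀ {n k} {S : Subset n} (f : Fin k → Fin n) → Injective _≡_ _≡_ f → (∀ i → f i ∈ˢ S) → k ≤ ∣ S ∣
size-≥ {S = S} f inj f∈ = 𝔽.injective⇒≤ {f = λ i → position (f∈ i)} λ {i} {j} e → inj (position-injective (f∈ i) (f∈ j) e)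

size-≤ : ∀ {n k} {S : Subset n} (f : Fin n → Fin k) → (∀ {x y} → x ∈ˢ S → y ∈ˢ S → f x ≡ f y → x ≡ y) → ∣ S ∣ ≤ k
size-≤ {S = S} f inj = 𝔽.injective⇒≤ {f = f ∘ select S}
  λ {i} {j} e → select-injective S (inj (select-∈ S i) (select-∈ S j) e)

-- The graph of a CNF formula with B variables and B clauses has a core vertex
-- with a pendant leaf for each literal, variable and clause.  set false and
-- set true stand for the two kinds of sets (variables and clauses) that have
-- to be hit by literals.
data Core : Set where
  literal : Bool → Core
  set     : Bool → Core

data Node (B : ℕ) : Set where
  top  : Node B
  core : Core → Fin B → Node B
  leaf : Core → Fin B → Node B

coreIndex : Core → Fin 4
coreIndex (literal true)  = zero
coreIndex (literal false) = suc zero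
coreIndex (set false)     = suc (suc zero)
coreIndex (set true)      = suc (suc (suc zero))

coreAt : Fin 4 → Core
coreAt zero                   = literal true
coreAt (suc zero)             = literal false
coreAt (suc (suc zero))       = set false
coreAt (suc (suc (suc zero))) = set true

coreAt-index : ∀ c → coreAt (coreIndex c) ≡ c
coreAt-index (literal true)  = refl
coreAt-index (literal false) = refl
coreAt-index (set false)     = refl
coreAt-index (set true)      = refl

coreIndex-at : ∀ i → coreIndex (coreAt i) ≡ i
coreIndex-at zero                   = refl
coreIndex-at (suc zero)             = refl
coreIndex-at (suc (suc zero))       = refl
coreIndex-at (suc (suc (suc zero))) = refl

order# : ℕ → ℕ
order# B = suc (8 * B)

module Nodes (B : ℕ) where

  nodeAt : Fin 8 × Fin B → Node B
  nodeAt (b , x) = [ (λ i → core (coreAt i) x) , (λ i → leaf (coreAt i) x) ]′ (splitAt 4 b)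

  view : Fin (order# B) → Node B
  view zero    = top
  view (suc i) = nodeAt (remQuot B i)

  abstract
    code : Node B → Fin (order# B)
    code top        = zero
    code (core c x) = suc (combine (coreIndex c ↑ˡ 4) x)
    code (leaf c x) = suc (combine (4 ↑ʳ coreIndex c) x)

    view-code : ∀ (v : Node B) → view (code v) ≡ v
    view-code top = refl
    view-code (core c x) = trans (cong nodeAt (remQuot-combine {8} {B} (coreIndex c ↑ˡ 4) x)) (lemma c)
      where
      lemma : ∀ c → nodeAt (coreIndex c ↑ˡ 4 , x) ≡ core c x
      lemma (literal true)  = refl
      lemma (literal false) = refl
      lemma (set false)     = refl
      lemma (set true)      = refl
    view-code (leaf c x) = trans (cong nodeAt (remQuot-combine {8} {B} (4 ↑ʳ coreIndex c) x)) (lemma c)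
      where
      lemma : ∀ c → nodeAt (4 ↑ʳ coreIndex c , x) ≡ leaf c x
      lemma (literal true)  = refl
      lemma (literal false) = refl
      lemma (set false)     = refl
      lemma (set true)      = refl

    code-view : ∀ (i : Fin (order# B)) → code (view i) ≡ i
    code-view zero    = refl
    code-view (suc i) = trans (lemma (remQuot B i)) (cong suc (combine-remQuot {8} B i))
      where
      lemma : ∀ p → code (nodeAt p) ≡ suc (combine (proj₁ p) (proj₂ p))
      lemma (b , x) with splitAt 4 b in e
      ... | inj₁ i = cong (λ b → suc (combine b x)) (trans (cong (_↑ˡ 4) (coreIndex-at i)) (𝔽.splitAt⁻¹-↑ˡ {4} {i = b} e))
      ... | inj₂ i = cong (λ b → suc (combine b x)) (trans (cong (4 ↑ʳ_) (coreIndex-at i)) (𝔽.splitAt⁻¹-↑ʳ {4} {i = b} e))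

    code-injective : ∀ {u v : Node B} → code u ≡ code v → u ≡ v
    code-injective {u = u} {v} e = trans (sym (view-code u)) (trans (cong view e) (view-code v))

data Arc {B} (inc : Bool → Fin B → Fin B → Set) : Node B → Node B → Set where
  hub    : ∀ {v} → v ≢ top → Arc inc top v
  clique : ∀ {b x b′ x′} → (b ≡ b′ → x ≢ x′) → Arc inc (core (literal b) x) (core (literal b′) x′)
  choice : ∀ {b x} → Arc inc (core (literal b) x) (core (set false) x)
  occurs : ∀ {b x c} → inc b c x → Arc inc (core (literal b) x) (core (set true) c)
  twig   : ∀ {c x} → Arc inc (core c x) (leaf c x)

Edge : ∀ {B} (inc : Bool → Fin B → Fin B → Set) → Node B → Node B → Set
Edge inc u v = Arc inc u v ⊎ Arc inc v u

pattern arc→ a = inj₁ a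
pattern arc← a = inj₂ a

-- The graph of a formula and its strong geodetic sets

module Reduction (B : ℕ) (inc : Bool → Fin B → Fin B → Set)
  (adj : Fin (order# B) → Fin (order# B) → Bool)
  (adj⇒edge : ∀ {u v} → adj u v ≡ true → Edge inc (Nodes.view B u) (Nodes.view B v))
  (edge⇒adj : ∀ {u v} → Edge inc (Nodes.view B u) (Nodes.view B v) → adj u v ≡ true) where

  open Nodes B

  edge-sym : ∀ {u v} → Edge inc u v → Edge inc v u
  edge-sym (inj₁ a) = inj₂ a
  edge-sym (inj₂ a) = inj₁ a

  arc-irrefl : ∀ {v} → ¬ Arc inc v v
  arc-irrefl (hub n)    = n refl
  arc-irrefl (clique n) = n refl refl

  graph : Graph
  graph = record
    { order = order# B
    ; adj = adj
    ; adj-sym = λ u v → 𝔹.⇔→≡ {z = true} (mk⇔ (edge⇒adj ∘ edge-sym ∘ adj⇒edge {u} {v}) (edge⇒adj ∘ edge-sym ∘ adj⇒edge {v} {u}))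
    ; irrefl = λ v → 𝔹.¬-not λ e → [ arc-irrefl , arc-irrefl ]′ (adj⇒edge {v} {v} e)
    }

  open Graph graph using (Vertex; Adj)

  adjacent : ∀ {u v} → Edge inc u v → Adj (code u) (code v)
  adjacent {u} {v} e = edge⇒adj (subst₂ (Edge inc) (sym (view-code u)) (sym (view-code v)) e)

  edge : ∀ {u v} → Adj (code u) (code v) → Edge inc u v
  edge {u} {v} e = subst₂ (Edge inc) (view-code u) (view-code v) (adj⇒edge e)

  rank : Node B → ℕ
  rank (leaf _ _)           = 0
  rank (core (set _) _)     = 1
  rank (core (literal _) _) = 2
  rank top                  = 3

  Linked : Node B → Node B → Set
  Linked a b = a ≡ b ⊎ Edge inc a b

  literals-linked : ∀ b x b′ x′ → Linked (core (literal b) x) (core (literal b′) x′)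
  literals-linked b x b′ x′ with b 𝔹.≟ b′ | x 𝔽.≟ x′
  ... | yes refl | yes refl = inj₁ refl
  ... | no n     | _        = inj₂ (arc→ (clique λ e _ → n e))
  ... | _        | no n     = inj₂ (arc→ (clique λ _ → n))

  top-linked : ∀ b → Linked top b
  top-linked top        = inj₁ refl
  top-linked (core _ _) = inj₂ (arc→ (hub λ ()))
  top-linked (leaf _ _) = inj₂ (arc→ (hub λ ()))

  linked-top : ∀ a → Linked a top
  linked-top a = [ inj₁ ∘ sym , inj₂ ∘ edge-sym ]′ (top-linked a)

  -- Covers, by shape, the neighbours that come no earlier in the elimination order; any two nodes
  -- of these shapes above the same node are equal or adjacent.
  data Above : Node B → Node B → Set where
    top  : ∀ {v} → Above v top
    lits : ∀ {c x b y} → Above (core c x) (core (literal b) y)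
    stem : ∀ {c x} → Above (leaf c x) (core c x)

  above : ∀ {v a} → Edge inc v a → rank v ≤ rank a → Above v a
  above {v} {top} _ _ = top
  above (arc→ (hub n)) r with above-top r
    where
    above-top : ∀ {a} → 3 ≤ rank a → a ≡ top
    above-top {top} _ = refl
    above-top {core (literal _) _} (s≤s (s≤s ()))
    above-top {core (set _) _} (s≤s ())
  ... | refl = contradiction refl n
  above (arc→ (clique _)) _ = lits
  above (arc→ choice) (s≤s ())
  above (arc→ (occurs _)) (s≤s ())
  above (arc→ (twig {literal _})) ()
  above (arc→ (twig {set _})) ()
  above (arc← (clique _)) _ = lits
  above (arc← choice) _ = lits
  above (arc← (occurs _)) _ = lits
  above (arc← twig) _ = stem

  linked : ∀ {v a b} → Above v a → Above v b → Linked a b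
  linked top  _    = top-linked _
  linked _    top  = linked-top _
  linked lits lits = literals-linked _ _ _ _
  linked stem stem = inj₁ refl

  chordal : Chordal graph
  chordal = chordal-by-rank graph (rank ∘ view) λ {v} {a} {b} e f p q →
    [ (λ eq → inj₁ (trans (sym (code-view a)) (trans (cong code eq) (code-view b)))) , inj₂ ∘ edge⇒adj ]′
      (linked (above (adj⇒edge {v} {a} e) p) (above (adj⇒edge {v} {b} f) q))

  near : ∀ u v → Near graph u v
  near u v with linked-top (view u) | top-linked (view v)
  ... | inj₁ e | inj₁ f = inj₁ (trans (sym (code-view u)) (trans (cong code (trans e f)) (code-view v)))
  ... | inj₁ e | inj₂ f = inj₂ (inj₁ (edge⇒adj (subst (λ n → Edge inc n (view v)) (sym e) f)))
  ... | inj₂ e | inj₁ f = inj₂ (inj₁ (edge⇒adj (subst (Edge inc (view u)) f e)))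
  ... | inj₂ e | inj₂ f = inj₂ (inj₂ (code top , edge⇒adj (subst (Edge inc (view u)) (sym (view-code top)) e) ,
                                    edge⇒adj (subst (λ n → Edge inc n (view v)) (sym (view-code top)) f)))

  leaf-edge : ∀ {c x v} → Edge inc (leaf c x) v → v ≡ top ⊎ v ≡ core c x
  leaf-edge (arc← (hub _)) = inj₁ refl
  leaf-edge (arc← twig)    = inj₂ refl

  leaves-apart : ∀ {c x c′ x′} → ¬ Edge inc (leaf c x) (leaf c′ x′)
  leaves-apart e = [ (λ ()) , (λ ()) ]′ (leaf-edge e)

  diameter : Fin B → HasDiameter graph 2
  diameter x = near⇒diameter graph near {code (leaf (literal true) x)} {code (leaf (literal false) x)}
    (λ e → case code-injective {u = leaf (literal true) x} {leaf (literal false) x} e of λ ())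
    (λ e → leaves-apart (edge {leaf (literal true) x} {leaf (literal false) x} e))

  Satisfied : (Fin B → Bool) → Set
  Satisfied α = ∀ c → ∃[ b ] ∃[ x ] inc b c x × α x ≡ b

  -- From a satisfying assignment to a strong geodetic set

  module FromAssignment (α : Fin B → Bool) (sat : Satisfied α) (x₀ : Fin B) where

    chosen : Node B → Bool
    chosen top                  = false
    chosen (leaf _ _)           = true
    chosen (core (set _) _)     = false
    chosen (core (literal b) x) = does (α x 𝔹.≟ b)

    S : Subset (order# B)
    S = Vec.tabulate (chosen ∘ view)

    chosen⇒∈ : ∀ v → chosen v ≡ true → code v ∈ˢ S
    chosen⇒∈ v e = lookup⇒[]= (code v) S (trans (lookup∘tabulate (chosen ∘ view) (code v)) (trans (cong chosen (view-code v)) e))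

    ∈⇒chosen : ∀ {i} → i ∈ˢ S → chosen (view i) ≡ true
    ∈⇒chosen {i} p = trans (sym (lookup∘tabulate (chosen ∘ view) i)) ([]=⇒lookup p)

    true-literal : ∀ {b x} → α x ≡ b → code (core (literal b) x) ∈ˢ S
    true-literal {x = x} refl = chosen⇒∈ (core (literal (α x)) x) (lemma (α x))
      where
      lemma : ∀ b → does (b 𝔹.≟ b) ≡ true
      lemma true  = refl
      lemma false = refl

    five : Fin 5
    five = suc (suc (suc (suc zero)))

    -- Four slots per index take the leaves and the fifth takes the chosen literal of the variable.
    -- `top` is never chosen, so its slot is arbitrary.
    slot : Node B → Fin (5 * B)
    slot top        = combine {5} zero x₀
    slot (leaf c x) = combine (coreIndex c ↑ˡ 1) x
    slot (core c x) = combine five x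

    slot-injective : ∀ u v → chosen u ≡ true → chosen v ≡ true → slot u ≡ slot v → u ≡ v
    slot-injective (leaf c x) (leaf c′ x′) p q e =
      cong₂ leaf (trans (sym (coreAt-index c)) (trans (cong coreAt (𝔽.↑ˡ-injective 1 _ _ (𝔽.combine-injectiveˡ _ x _ x′ e))) (coreAt-index c′)))
                 (𝔽.combine-injectiveʳ (coreIndex c ↑ˡ 1) x (coreIndex c′ ↑ˡ 1) x′ e)
    slot-injective (core (literal b) x) (core (literal b′) x′) p q e with 𝔽.combine-injectiveʳ {5} five x five x′ e
    ... | refl with α x 𝔹.≟ b | α x 𝔹.≟ b′
    ...   | yes refl | yes refl = refl
    slot-injective (leaf c x) (core (literal b) x′) p q e =
      contradiction (𝔽.combine-injectiveˡ (coreIndex c ↑ˡ 1) x five x′ e) (last-fresh c)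
      where
      last-fresh : ∀ c → coreIndex c ↑ˡ 1 ≢ five
      last-fresh (literal true)  ()
      last-fresh (literal false) ()
      last-fresh (set false)     ()
      last-fresh (set true)      ()
    slot-injective (core (literal b) x′) (leaf c x) p q e = sym (slot-injective (leaf c x) (core (literal b) x′) q p (sym e))

    S-size : ∣ S ∣ ≤ 5 * B
    S-size = size-≤ (slot ∘ view) λ {u} {v} p q e →
      trans (sym (code-view u)) (trans (cong code (slot-injective (view u) (view v) (∈⇒chosen p) (∈⇒chosen q) e)) (code-view v))

    parent : Node B → Node B
    parent top        = top
    parent (core c x) = core c x
    parent (leaf c x) = core c x

    -- Between a leaf and a true literal the path runs through the parent of the leaf, between
    -- leaves with different parents through `top`. Both ends are tried, because it is not known
    -- which of the two codes is smaller.
    mid : Vertex → Vertex → Vertex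
    mid u v = if adj (code (parent (view u))) v then code (parent (view u))
              else if adj (code (parent (view v))) u then code (parent (view v)) else code top

    cover : ∀ {a b x} → code a ∈ˢ S → code b ∈ˢ S → a ≢ b → ¬ Edge inc a b → Edge inc a x → Edge inc b x →
            mid (code a) (code b) ≡ code x → mid (code b) (code a) ≡ code x →
            ∃[ u ] ∃[ v ] u ∈ˢ S × v ∈ˢ S × u <ᶠ v × ¬ Adj u v × Adj u (code x) × Adj (code x) v × mid u v ≡ code x
    cover {a} {b} a∈ b∈ a≢b ¬ab ax bx m m′ = [
      (λ lt → code a , code b , a∈ , b∈ , lt , ¬ab ∘ edge , adjacent ax , adjacent (edge-sym bx) , m) ,
      (λ gt → code b , code a , b∈ , a∈ , gt , ¬ab ∘ edge-sym ∘ edge , adjacent bx , adjacent (edge-sym ax) , m′) ]′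
      (≢⇒<⊎> (a≢b ∘ code-injective))
      where
      ≢⇒<⊎> : ∀ {u v : Vertex} → u ≢ v → u <ᶠ v ⊎ v <ᶠ u
      ≢⇒<⊎> {u} {v} n with 𝔽.<-cmp u v
      ... | tri< lt _ _ = inj₁ lt
      ... | tri≈ _ e _  = contradiction e n
      ... | tri> _ _ gt = inj₂ gt

    leaf∈ : ∀ c x → code (leaf c x) ∈ˢ S
    leaf∈ c x = chosen⇒∈ (leaf c x) refl

    not-adjacent : ∀ {u v} → ¬ Edge inc u v → adj (code u) (code v) ≡ false
    not-adjacent n = 𝔹.¬-not (n ∘ edge)

    mid-leaf : ∀ {c x v} → Edge inc (core c x) v → mid (code (leaf c x)) (code v) ≡ code (core c x)
    mid-leaf {c} {x} {v} e rewrite view-code (leaf c x) | adjacent {core c x} {v} e = refl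

    mid-leaf′ : ∀ {c x d y} → ¬ Edge inc (core d y) (leaf c x) → Edge inc (core c x) (core d y) →
                mid (code (core d y)) (code (leaf c x)) ≡ code (core c x)
    mid-leaf′ {c} {x} {d} {y} n e rewrite view-code (core d y) | view-code (leaf c x) |
      not-adjacent {core d y} {leaf c x} n | adjacent {core c x} {core d y} e = refl

    mid-leaves : ∀ {c d x} → c ≢ d → mid (code (leaf c x)) (code (leaf d x)) ≡ code top
    mid-leaves {c} {d} {x} n rewrite view-code (leaf c x) | view-code (leaf d x) |
      not-adjacent {core c x} {leaf d x} (λ { (arc→ twig) → n refl }) |
      not-adjacent {core d x} {leaf c x} (λ { (arc→ twig) → n refl }) = refl

    Covered : Node B → Set
    Covered x = ∃[ u ] ∃[ v ] u ∈ˢ S × v ∈ˢ S × u <ᶠ v × ¬ Adj u v × Adj u (code x) × Adj (code x) v × mid u v ≡ code x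

    -- A core vertex next to a true literal is the middle of the pair formed by its own leaf and
    -- that literal. The leaf determines the vertex, so no pair is asked for two paths.
    cover-core : ∀ {c x b y} → (c ≢ literal b ⊎ x ≢ y) → α y ≡ b → Edge inc (core c x) (core (literal b) y) → Covered (core c x)
    cover-core {c} {x} {b} {y} ne αy e = cover {leaf c x} {core (literal b) y}
      (leaf∈ c x) (true-literal αy) (λ ()) (apart ∘ edge-sym) (arc← twig) (edge-sym e) (mid-leaf e) (mid-leaf′ apart e)
      where
      apart : ¬ Edge inc (core (literal b) y) (leaf c x)
      apart (arc→ twig) = [ (λ n → n refl) , (λ n → n refl) ]′ ne

    covered : ∀ v → chosen v ≡ false → Covered v
    covered top _ = cover {leaf (literal true) x₀} {leaf (literal false) x₀} {top} (leaf∈ (literal true) x₀) (leaf∈ (literal false) x₀) (λ ())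
      leaves-apart (arc← (hub λ ())) (arc← (hub λ ())) (mid-leaves {literal true} {literal false} {x₀} λ ()) (mid-leaves {literal false} {literal true} {x₀} λ ())
    -- A false literal is covered with the help of the true literal of the same variable.
    covered (core (literal b) x) e = cover-core {literal b} {x} {α x} {x} (inj₁ λ { refl → differ e refl }) refl (arc→ (clique λ p _ → differ e (sym p)))
      where
      differ : does (α x 𝔹.≟ b) ≡ false → α x ≢ b
      differ e with α x 𝔹.≟ b
      ... | no n = n
    covered (core (set false) x) _ = cover-core (inj₁ λ ()) refl (arc← choice)
    covered (core (set true) c) _ = let (b , x , i , αx) = sat c in cover-core (inj₁ λ ()) αx (arc← (occurs i))

    strong : StrongGeodeticSet graph S
    strong = middle⇒strong graph near {mid = mid} λ i i∉ →
      subst (λ j → ∃[ u ] ∃[ v ] u ∈ˢ S × v ∈ˢ S × u <ᶠ v × ¬ Adj u v × Adj u j × Adj j v × mid u v ≡ j) (code-view i)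
        (covered (view i) (𝔹.¬-not λ e → i∉ (subst (_∈ˢ S) (code-view i) (chosen⇒∈ (view i) e))))

  -- From a small strong geodetic set to a satisfying assignment

  module FromStrongSet {S} (strong : StrongGeodeticSet graph S) (small : ∣ S ∣ ≤ 5 * B) where

    In : Node B → Set
    In v = code v ∈ˢ S

    middle : ∀ x → ¬ In x → ∃[ a ] ∃[ b ] In a × In b × a ≢ b × ¬ Edge inc a b × Edge inc x a × Edge inc x b
    middle x x∉ =
      let (u , v , u∈ , v∈ , u<v , ¬e , e , f , _) = proj₂ (strong⇒middle graph near strong) (code x) x∉
      in view u , view v , subst (_∈ˢ S) (sym (code-view u)) u∈ , subst (_∈ˢ S) (sym (code-view v)) v∈ ,
         (λ eq → 𝔽.<⇒≢ u<v (trans (sym (code-view u)) (trans (cong code eq) (code-view v)))) ,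
         ¬e ∘ edge⇒adj , edge-sym (subst (Edge inc (view u)) (view-code x) (adj⇒edge e)) ,
         subst (λ n → Edge inc n (view v)) (view-code x) (adj⇒edge f)

    not-linked : ∀ {a b} → a ≢ b → ¬ Edge inc a b → ¬ Linked a b
    not-linked n e = [ n , e ]′

    -- The only neighbours of a leaf, its parent and `top`, are adjacent, so a leaf is never the
    -- middle of a shortest path.
    leaf-in : ∀ c x → In (leaf c x)
    leaf-in c x with code (leaf c x) ∈? S
    ... | yes p = p
    ... | no ¬p with middle (leaf c x) ¬p
    ...   | a , b , _ , _ , n , ¬e , e , f with leaf-edge e | leaf-edge f
    ...     | inj₁ refl | _         = contradiction (top-linked b) (not-linked n ¬e)
    ...     | inj₂ _    | inj₁ refl = contradiction (linked-top a) (not-linked n ¬e)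
    ...     | inj₂ refl | inj₂ refl = contradiction refl n

    -- A set vertex outside S is covered by its leaf and a literal in S.
    hit : ∀ k c → ¬ In (core (set k) c) → ∃[ b ] ∃[ x ] In (core (literal b) x) × Arc inc (core (literal b) x) (core (set k) c)
    hit k c ¬p with middle (core (set k) c) ¬p
    ... | a , b , a∈ , b∈ , n , ¬e , e , f = pick e f
      where
      pick : Edge inc (core (set k) c) a → Edge inc (core (set k) c) b → ∃[ b ] ∃[ x ] In (core (literal b) x) × Arc inc (core (literal b) x) (core (set k) c)
      pick (arc← (hub _)) _ = contradiction (top-linked b) (not-linked n ¬e)
      pick _ (arc← (hub _)) = contradiction (linked-top a) (not-linked n ¬e)
      pick (arc← (choice {b′} {x})) _ = b′ , x , a∈ , choice
      pick (arc← (occurs {b′} {x} i)) _ = b′ , x , a∈ , occurs i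
      pick _ (arc← (choice {b′} {x})) = b′ , x , b∈ , choice
      pick _ (arc← (occurs {b′} {x} i)) = b′ , x , b∈ , occurs i
      pick (arc→ twig) (arc→ twig) = contradiction refl n

    -- Groups of different `x` are disjoint, and each meets `S`: if the pair vertex is outside,
    -- `hit` provides one of the two literals. Together with the leaves this already uses up 5 B
    -- places.
    data Group (x : Fin B) : Node B → Set where
      lit : ∀ b → Group x (core (literal b) x)
      var : Group x (core (set false) x)

    group : ∀ x → ∃[ v ] In v × Group x v
    group x with code (core (set false) x) ∈? S
    ... | yes p = _ , p , var
    ... | no ¬p with hit false x ¬p
    ...   | b , .x , p , choice = _ , p , lit b

    member : Fin 5 × Fin B → Node B
    member (i , x) = [ (λ j → leaf (coreAt j) x) , (λ _ → proj₁ (group x)) ]′ (splitAt 4 i)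

    member-in : ∀ p → In (member p)
    member-in (i , x) with splitAt 4 i
    ... | inj₁ j = leaf-in (coreAt j) x
    ... | inj₂ _ = proj₁ (proj₂ (group x))

    data Used : Node B → Set where
      a-leaf   : ∀ {c x} → Used (leaf c x)
      a-member : ∀ {x} → Used (proj₁ (group x))

    member-used : ∀ p → Used (member p)
    member-used (i , x) with splitAt 4 i
    ... | inj₁ _ = a-leaf
    ... | inj₂ _ = a-member

    group-injective : ∀ {x y v} → Group x v → Group y v → x ≡ y
    group-injective (lit _) (lit _) = refl
    group-injective var     var     = refl

    member-injective : ∀ {p q} → member p ≡ member q → p ≡ q
    member-injective {i , x} {j , y} e with splitAt 4 i in ei | splitAt 4 j in ej
    ... | inj₁ c | inj₁ d = cong₂ _,_ (trans (sym (𝔽.splitAt⁻¹-↑ˡ {4} {i = i} ei)) (trans (cong (_↑ˡ 1) (leaf-inj e)) (𝔽.splitAt⁻¹-↑ˡ {4} {i = j} ej))) (leaf-inj′ e)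
      where
      leaf-inj : ∀ {c d x y} → leaf (coreAt c) x ≡ leaf (coreAt d) y → c ≡ d
      leaf-inj {c} {d} e = trans (sym (coreIndex-at c)) (trans (cong (λ { (leaf c _) → coreIndex c ; _ → zero }) e) (coreIndex-at d))
      leaf-inj′ : ∀ {c d x y} → leaf c x ≡ leaf d y → x ≡ y
      leaf-inj′ refl = refl
    ... | inj₁ c | inj₂ _ with group y
    ...   | _ , _ , lit _ = contradiction e λ ()
    ...   | _ , _ , var   = contradiction e λ ()
    member-injective {i , x} {j , y} e | inj₂ _ | inj₁ d with group x
    ...   | _ , _ , lit _ = contradiction e λ ()
    ...   | _ , _ , var   = contradiction e λ ()
    member-injective {i , x} {j , y} e | inj₂ zero | inj₂ zero = cong₂ _,_
      (trans (sym (𝔽.splitAt⁻¹-↑ʳ {4} {i = i} ei)) (𝔽.splitAt⁻¹-↑ʳ {4} {i = j} ej))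
      (group-injective (proj₂ (proj₂ (group x))) (subst (Group y) (sym e) (proj₂ (proj₂ (group y)))))

    -- S has no room for a vertex besides the leaves and one vertex per group.
    all-used : ∀ {v} → In v → ¬ ¬ Used v
    all-used {v} v∈ unused = <⇒≱ (s≤s small) (size-≥ f f-injective f-in)
      where
      f : Fin (suc (5 * B)) → Fin (order# B)
      f zero    = code v
      f (suc i) = code (member (remQuot {5} B i))
      f-in : ∀ i → f i ∈ˢ S
      f-in zero    = v∈
      f-in (suc i) = member-in (remQuot {5} B i)
      f-injective : Injective _≡_ _≡_ f
      f-injective {zero}  {zero}  _ = refl
      f-injective {zero}  {suc j} e = contradiction (subst Used (sym (code-injective e)) (member-used (remQuot {5} B j))) unused
      f-injective {suc i} {zero}  e = contradiction (subst Used (code-injective e) (member-used (remQuot {5} B i))) unused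
      f-injective {suc i} {suc j} e = cong suc (trans (sym (combine-remQuot {5} B i))
        (trans (cong (λ p → combine (proj₁ p) (proj₂ p)) (member-injective {remQuot {5} B i} {remQuot {5} B j} (code-injective e))) (combine-remQuot {5} B j)))

    clause-out : ∀ c → ¬ In (core (set true) c)
    clause-out c p = all-used {core (set true) c} p λ u → lemma u refl
      where
      lemma : ∀ {v} → Used v → v ≢ core (set true) c
      lemma a-leaf ()
      lemma (a-member {x}) e with group x
      lemma (a-member {x}) () | _ , _ , lit _
      lemma (a-member {x}) () | _ , _ , var

    -- Apart from leaves, `S` has room only for one vertex per group, and both literals would have
    -- to be that vertex.
    consistent : ∀ x → In (core (literal true) x) → ¬ In (core (literal false) x)
    consistent x p q = all-used {core (literal true) x} p λ u → all-used {core (literal false) x} q λ u′ →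
      case trans (lemma u refl) (sym (lemma u′ refl)) of λ ()
      where
      lemma : ∀ {v b} → Used v → v ≡ core (literal b) x → v ≡ proj₁ (group x)
      lemma (a-member {y}) e with group-injective (proj₂ (proj₂ (group y))) (subst (Group x) (sym e) (lit _))
      ... | refl = refl

    α : Fin B → Bool
    α x = does (code (core (literal true) x) ∈? S)

    sat : Satisfied α
    sat c with hit true c (clause-out c)
    ... | b , x , p , occurs i = b , x , i , value b p
      where
      value : ∀ b → In (core (literal b) x) → α x ≡ b
      value b p with code (core (literal true) x) ∈? S | b
      ... | yes q | true  = refl
      ... | yes q | false = contradiction p (consistent x q)
      ... | no ¬q | true  = contradiction p ¬q
      ... | no ¬q | false = refl

  strong⇔satisfiable : Fin B → (∃[ S ] StrongGeodeticSet graph S × ∣ S ∣ ≤ 5 * B) ⇔ ∃ Satisfied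
  strong⇔satisfiable x₀ = mk⇔
    (λ (S , strong , small) → FromStrongSet.α strong small , FromStrongSet.sat strong small)
    (λ (α , sat) → let open FromAssignment α sat x₀ in S , strong , S-size)

-- Uniform CNF formulas

Finite : Set → Set
Finite A = Σ (List A) λ xs → ∀ a → a ∈ˡ xs

finite-Fin : ∀ n → Finite (Fin n)
finite-Fin n = allFin n , ∈-allFin

finite-× : ∀ {A B} → Finite A → Finite B → Finite (A × B)
finite-× (xs , ∈xs) (ys , ∈ys) = List.cartesianProduct xs ys , λ (a , b) → ∈-cartesianProduct⁺ (∈xs a) (∈ys b)

finite-⊎ : ∀ {A B} → Finite A → Finite B → Finite (A ⊎ B)
finite-⊎ (xs , ∈xs) (ys , ∈ys) = List.map inj₁ xs ++ List.map inj₂ ys ,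
  λ { (inj₁ a) → ∈-++⁺ˡ (∈-map⁺ inj₁ (∈xs a)) ; (inj₂ b) → ∈-++⁺ʳ (List.map inj₁ xs) (∈-map⁺ inj₂ (∈ys b)) }

finite-image : ∀ {A B} (f : A → B) (g : B → A) → (∀ b → f (g b) ≡ b) → Finite A → Finite B
finite-image f g fg (xs , ∈xs) = List.map f xs , λ b → subst (_∈ˡ List.map f xs) (fg b) (∈-map⁺ f (∈xs (g b)))

finite-Vec : ∀ {A} n → Finite A → Finite (Vec A n)
finite-Vec zero    _ = [] ∷ [] , λ { [] → here refl }
finite-Vec (suc n) F = finite-image (λ (x , xs) → x ∷ xs) (λ { (x ∷ xs) → x , xs }) (λ { (x ∷ xs) → refl })
  (finite-× F (finite-Vec n F))

finite-Bool : Finite Bool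
finite-Bool = true ∷ false ∷ [] , λ { true → here refl ; false → there (here refl) }

finite-Symbol : ∀ a → Finite (Symbol a)
finite-Symbol a = finite-image f g (λ { blank → refl ; (bit _) → refl ; (extra _) → refl })
  (finite-⊎ (finite-Fin 1) (finite-⊎ finite-Bool (finite-Fin a)))
  where
  f : Fin 1 ⊎ Bool ⊎ Fin a → Symbol a
  f (inj₁ _)        = blank
  f (inj₂ (inj₁ b)) = bit b
  f (inj₂ (inj₂ i)) = extra i
  g : Symbol a → Fin 1 ⊎ Bool ⊎ Fin a
  g blank     = inj₁ zero
  g (bit b)   = inj₂ (inj₁ b)
  g (extra i) = inj₂ (inj₂ i)

number : Bool → ℕ
number false = 0
number true  = 1

number-injective : ∀ {b c} → number b ≡ number c → b ≡ c
number-injective {false} {false} _ = refl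
number-injective {true}  {true}  _ = refl

-- In times and positions variable 0 is a position p and variable 1 a time t.
record Literal (F : Set) : Set where
  constructor literal
  field
    sign     : Bool
    time pos : Tm 1 2
    fact     : F

record Clause (F : Set) : Set where
  constructor _⟹_
  field
    guard    : Fm 1 2
    literals : List (Literal F)

infix 1 _⟹_

-- A CNF formula whose variables are triples of a time, a position and a fact.
-- It has one clause for each time, position and rule; those whose guard fails
-- are omitted.  The rules contain the facts, so that rules can be used to
-- number both.
module Uniform {Rule F : Set} (rules : Finite Rule) (pad : F → Rule) (unpad : Rule → Maybe F)
  (unpad-pad : ∀ f → unpad (pad f) ≡ just f) (clause : Rule → Clause F) (times positions : Tm 1 0) where

  open Literal
  open Clause

  R : ℕ
  R = length (proj₁ rules)

  ruleAt : Fin R → Rule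
  ruleAt = List.lookup (proj₁ rules)

  ruleIndex : Rule → Fin R
  ruleIndex r = Any.index (proj₂ rules r)

  ruleAt-index : ∀ r → ruleAt (ruleIndex r) ≡ r
  ruleAt-index r = sym (Any.lookup-index (proj₂ rules r))

  -- Imitates `combine` on `Fin`, so that formulas and indices number the triples in the same way.
  codeT : ∀ {Γ} → Tm 1 Γ → Tm 1 Γ → ℕ → Tm 1 Γ
  codeT t p κ = (ren [] positions ⊗ lit R) ⊗ t ⊕ (lit R ⊗ p ⊕ lit κ)

  here₂ : Vec (Fin 4) 2
  here₂ = zero ∷ suc zero ∷ []

  -- A clause whose guard fails is made to contain every literal. This keeps one clause per triple
  -- and imposes no condition.
  matches : Bool → Fin R → Fm 1 4
  matches s σ = var (suc (suc (suc zero))) ≡ᶠ codeT (var (suc zero)) (var zero) (toℕ σ) ∧ᶠ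
    (¬ᶠ renᶠ here₂ (guard (clause (ruleAt σ))) ∨ᶠ
     anyᶠ (length ls) λ i → let l = List.lookup ls i in
       lit (number s) ≡ᶠ lit (number (sign l)) ∧ᶠ
       var (suc (suc zero)) ≡ᶠ codeT (ren here₂ (time l)) (ren here₂ (pos l)) (toℕ (ruleIndex (pad (fact l)))))
    where ls = literals (clause (ruleAt σ))

  -- The variables of the formula are a clause and, in front of it, a
  -- propositional variable.
  incidence : Bool → Fm 1 2
  incidence s = ∃ᶠ (ren [] times) (∃ᶠ (ren [] positions) (anyᶠ R (matches s)))

  total : Tm 1 0
  total = times ⊗ (positions ⊗ lit R)

  module _ (w : Word) where

    ws : Vec Word 1
    ws = w ∷ []

    T# P# B# : ℕ
    T# = ⟦ times ⟧ ws []
    P# = ⟦ positions ⟧ ws []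
    B# = ⟦ total ⟧ ws []

    incident : Bool → Fin B# → Fin B# → Set
    incident s c x = ⟦ incidence s ⟧ᶠ ws (toℕ x ∷ toℕ c ∷ [])

    Guarded : Rule → ℕ → ℕ → Set
    Guarded r t p = ⟦ guard (clause r) ⟧ᶠ ws (p ∷ t ∷ [])

    timeOf posOf : Literal F → ℕ → ℕ → ℕ
    timeOf l t p = ⟦ time l ⟧ ws (p ∷ t ∷ [])
    posOf  l t p = ⟦ pos l ⟧ ws (p ∷ t ∷ [])

    Valuation : Set
    Valuation = ℕ → ℕ → F → Bool

    Holds : Valuation → ℕ → ℕ → Literal F → Set
    Holds β t p l = β (timeOf l t p) (posOf l t p) (fact l) ≡ sign l

    Model : Valuation → Set
    Model β = ∀ r t p → t < T# → p < P# → Guarded r t p → ∃[ l ] l ∈ˡ literals (clause r) × Holds β t p l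

    -- A literal outside the range would be given the number of a different triple or of none.
    WithinRange : Set
    WithinRange = ∀ r t p → t < T# → p < P# → Guarded r t p →
      ∀ l → l ∈ˡ literals (clause r) → timeOf l t p < T# × posOf l t p < P#

    codeℕ : ℕ → ℕ → ℕ → ℕ
    codeℕ t p κ = P# * R * t + (R * p + κ)

    enc : Fin T# → Fin P# → Fin R → Fin B#
    enc t p κ = combine t (combine p κ)

    toℕ-enc : ∀ t p κ → toℕ (enc t p κ) ≡ codeℕ (toℕ t) (toℕ p) (toℕ κ)
    toℕ-enc t p κ = trans (toℕ-combine t (combine p κ)) (cong (P# * R * toℕ t +_) (toℕ-combine p κ))

    toℕ-enc< : ∀ {t p} (t< : t < T#) (p< : p < P#) κ → toℕ (enc (fromℕ< t<) (fromℕ< p<) κ) ≡ codeℕ t p (toℕ κ)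
    toℕ-enc< t< p< κ = trans (toℕ-enc _ _ κ) (cong₂ (λ t p → codeℕ t p (toℕ κ)) (toℕ-fromℕ< t<) (toℕ-fromℕ< p<))

    dec-B : Fin B# → Fin T# × Fin P# × Fin R
    dec-B i = let (t , j) = remQuot {T#} (P# * R) i in t , remQuot {P#} R j

    dec-enc : ∀ t p κ → dec-B (enc t p κ) ≡ (t , p , κ)
    dec-enc t p κ = trans (cong (λ (t , j) → t , remQuot {P#} R j) (remQuot-combine {T#} {P# * R} t (combine p κ)))
      (cong (t ,_) (remQuot-combine {P#} {R} p κ))

    enc-dec : ∀ i → let (t , p , κ) = dec-B i in enc t p κ ≡ i
    enc-dec i = trans (cong (combine (proj₁ (remQuot {T#} (P# * R) i))) (combine-remQuot {P#} R _)) (combine-remQuot {T#} (P# * R) i)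

    model⇒satisfied : ∀ {β} → WithinRange → Model β → Σ (Fin B# → Bool) λ α → ∀ c → ∃[ b ] ∃[ x ] incident b c x × α x ≡ b
    model⇒satisfied {β} range model = α , sat
      where
      valueAt : Fin T# × Fin P# × Fin R → Bool
      valueAt (t , p , κ) = maybe′ (β (toℕ t) (toℕ p)) false (unpad (ruleAt κ))
      α : Fin B# → Bool
      α x = valueAt (dec-B x)
      α-enc : ∀ {t p} (t< : t < T#) (p< : p < P#) f → α (enc (fromℕ< t<) (fromℕ< p<) (ruleIndex (pad f))) ≡ β t p f
      α-enc t< p< f = trans (cong valueAt (dec-enc (fromℕ< t<) (fromℕ< p<) (ruleIndex (pad f))))
        (trans (cong (maybe′ (β _ _) false) (trans (cong unpad (ruleAt-index (pad f))) (unpad-pad f)))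
          (cong₂ (λ t p → β t p f) (toℕ-fromℕ< t<) (toℕ-fromℕ< p<)))
      sat : ∀ c → ∃[ b ] ∃[ x ] incident b c x × α x ≡ b
      sat c with dec ws (guard (clause (ruleAt (proj₂ (proj₂ (dec-B c)))))) (toℕ (proj₁ (proj₂ (dec-B c))) ∷ toℕ (proj₁ (dec-B c)) ∷ [])
      -- This clause contains every literal. As clauses and variables have the same numbers, `c`
      -- itself serves as the variable, with the sign that `α` gives it.
      ... | no ¬g = α c , c , (toℕ t , toℕ<n t , toℕ p , toℕ<n p , σ , c≡ , inj₁ ¬g) , refl
        where
        t = proj₁ (dec-B c)
        p = proj₁ (proj₂ (dec-B c))
        σ = proj₂ (proj₂ (dec-B c))
        c≡ : toℕ c ≡ codeℕ (toℕ t) (toℕ p) (toℕ σ)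
        c≡ = trans (cong toℕ (sym (enc-dec c))) (toℕ-enc t p σ)
      ... | yes g = sign l , x , (toℕ t , toℕ<n t , toℕ p , toℕ<n p , σ , c≡ , inj₂ (Any.index l∈ , cong number (cong sign l≡) ,
              trans (toℕ-enc< (proj₁ r) (proj₂ r) (ruleIndex (pad (fact l))))
                (cong (λ l → codeℕ (timeOf l (toℕ t) (toℕ p)) (posOf l (toℕ t) (toℕ p)) (toℕ (ruleIndex (pad (fact l))))) l≡))) ,
            trans (α-enc (proj₁ r) (proj₂ r) (fact l)) holds
        where
        t = proj₁ (dec-B c)
        p = proj₁ (proj₂ (dec-B c))
        σ = proj₂ (proj₂ (dec-B c))
        m = model (ruleAt σ) (toℕ t) (toℕ p) (toℕ<n t) (toℕ<n p) g
        l = proj₁ m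
        l∈ = proj₁ (proj₂ m)
        holds = proj₂ (proj₂ m)
        l≡ : l ≡ List.lookup (literals (clause (ruleAt σ))) (Any.index l∈)
        l≡ = Any.lookup-index l∈
        r = range (ruleAt σ) (toℕ t) (toℕ p) (toℕ<n t) (toℕ<n p) g l l∈
        x = enc (fromℕ< (proj₁ r)) (fromℕ< (proj₂ r)) (ruleIndex (pad (fact l)))
        c≡ : toℕ c ≡ codeℕ (toℕ t) (toℕ p) (toℕ σ)
        c≡ = trans (cong toℕ (sym (enc-dec c))) (toℕ-enc t p σ)

    satisfied⇒model : (α : Fin B# → Bool) → (∀ c → ∃[ b ] ∃[ x ] incident b c x × α x ≡ b) → ∃ Model
    satisfied⇒model α sat = β , model
      where
      α′ : ∀ n → Dec (n < B#) → Bool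
      α′ n (yes n<) = α (fromℕ< n<)
      α′ n (no _)   = false
      β : Valuation
      β t p f = α′ (codeℕ t p (toℕ (ruleIndex (pad f)))) (_ <? B#)
      α′-toℕ : ∀ x {n} (d : Dec (n < B#)) → toℕ x ≡ n → α′ n d ≡ α x
      α′-toℕ x (yes n<) refl = cong α (fromℕ<-toℕ x n<)
      α′-toℕ x (no ≮)   refl = contradiction (toℕ<n x) ≮
      model : Model β
      model r t p t< p< g with sat (enc (fromℕ< t<) (fromℕ< p<) (ruleIndex r))
      ... | b , x , (t′ , t′< , p′ , p′< , σ , c≡ , match) , αx =
        found (trans (cong ruleAt (sym (proj₂ (proj₂ same)))) (ruleAt-index r))
              (trans (sym (toℕ-fromℕ< t′<)) (trans (cong toℕ (sym (proj₁ same))) (toℕ-fromℕ< t<)))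
              (trans (sym (toℕ-fromℕ< p′<)) (trans (cong toℕ (sym (proj₁ (proj₂ same)))) (toℕ-fromℕ< p<))) match
        where
        same : fromℕ< t< ≡ fromℕ< t′< × fromℕ< p< ≡ fromℕ< p′< × ruleIndex r ≡ σ
        same = let (e , f) = combine-injective (fromℕ< t<) _ (fromℕ< t′<) _ (toℕ-injective (trans c≡ (sym (toℕ-enc< t′< p′< σ))))
               in e , combine-injective (fromℕ< p<) _ (fromℕ< p′<) _ f
        found : ruleAt σ ≡ r → t′ ≡ t → p′ ≡ p →
                ¬ Guarded (ruleAt σ) t′ p′ ⊎ (∃[ i ] let l = List.lookup (literals (clause (ruleAt σ))) i in
                  number b ≡ number (sign l) × toℕ x ≡ codeℕ (timeOf l t′ p′) (posOf l t′ p′) (toℕ (ruleIndex (pad (fact l))))) →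
                ∃[ l ] l ∈ˡ literals (clause r) × Holds β t p l
        found refl refl refl (inj₁ ¬g)           = contradiction g ¬g
        found refl refl refl (inj₂ (i , e , x≡)) = List.lookup (literals (clause r)) i , ∈-lookup i ,
          trans (α′-toℕ x (_ <? B#) x≡) (trans αx (number-injective e))

-- Computations as CNF formulas

infix 4 _≟ˢ_
_≟ˢ_ : ∀ {a} (s s′ : Symbol a) → Dec (s ≡ s′)
blank   ≟ˢ blank    = yes refl
bit b   ≟ˢ bit b′   = map′ (cong bit) (λ { refl → refl }) (b 𝔹.≟ b′)
extra i ≟ˢ extra i′ = map′ (cong extra) (λ { refl → refl }) (i 𝔽.≟ i′)
blank   ≟ˢ bit _    = no λ ()
blank   ≟ˢ extra _  = no λ ()
bit _   ≟ˢ blank    = no λ ()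
bit _   ≟ˢ extra _  = no λ ()
extra _ ≟ˢ blank    = no λ ()
extra _ ≟ˢ bit _    = no λ ()

-- The tape read from D cells to the left of its head.
window : ∀ {a} → ℕ → ℕ → Tape a → Symbol a
window zero    zero    (tape _ s _)  = s
window zero    (suc i) (tape _ _ rs) = cellAt rs i
window (suc D) zero    (tape ls _ _) = cellAt ls D
window (suc D) (suc p) t             = window D p t

window-head : ∀ {a} D (t : Tape a) → window D D t ≡ Tape.head t
window-head zero    t = refl
window-head (suc D) t = window-head D t

window-next : ∀ {a} D (t : Tape a) → window D (suc D) t ≡ cellAt (Tape.rightOf t) 0
window-next zero    t = refl
window-next (suc D) t = window-next D t

window-right : ∀ {a} D p (t : Tape a) → window D p (moveHead right t) ≡ window D (suc p) t
window-right zero          zero    (tape ls s [])       = refl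
window-right zero          zero    (tape ls s (r ∷ rs)) = refl
window-right zero          (suc p) (tape ls s [])       = refl
window-right zero          (suc p) (tape ls s (r ∷ rs)) = refl
window-right (suc zero)    zero    (tape ls s [])       = refl
window-right (suc zero)    zero    (tape ls s (r ∷ rs)) = refl
window-right (suc (suc D)) zero    (tape ls s [])       = refl
window-right (suc (suc D)) zero    (tape ls s (r ∷ rs)) = refl
window-right (suc D)       (suc p) t                    = window-right D p t

window-left : ∀ {a} D p (t : Tape a) → window D (suc p) (moveHead left t) ≡ window D p t
window-left zero          zero    (tape [] s rs)       = refl
window-left zero          zero    (tape (l ∷ ls) s rs) = refl
window-left zero          (suc p) (tape [] s rs)       = refl
window-left zero          (suc p) (tape (l ∷ ls) s rs) = refl
window-left (suc zero)    zero    (tape [] s rs)       = refl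
window-left (suc zero)    zero    (tape (l ∷ ls) s rs) = refl
window-left (suc (suc D)) zero    (tape [] s rs)       = refl
window-left (suc (suc D)) zero    (tape (l ∷ ls) s rs) = refl
window-left (suc D)       (suc p) t                    = window-left D p t

window-write : ∀ {a} D p {ls rs} (s s′ : Symbol a) → p ≢ D → window D p (tape ls s rs) ≡ window D p (tape ls s′ rs)
window-write zero    zero    s s′ n = contradiction refl n
window-write zero    (suc p) s s′ n = refl
window-write (suc D) zero    s s′ n = refl
window-write (suc D) (suc p) s s′ n = window-write D p s s′ (n ∘ cong suc)

window-before : ∀ {a} D p {s : Symbol a} {rs} → p < D → window D p (tape [] s rs) ≡ blank
window-before (suc D) zero    _         = refl
window-before (suc D) (suc p) (s≤s p<D) = window-before D p p<D

window-word : ∀ {a} D p w → D ≤ p → window {a} D p (wordTape w) ≡ wordCells w (p ∸ D)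
window-word zero    zero    []      _         = refl
window-word zero    zero    (b ∷ w) _         = refl
window-word zero    (suc p) []      _         = refl
window-word zero    (suc p) (b ∷ w) _         = refl
window-word (suc D) (suc p) w       (s≤s D≤p) = window-word D p w D≤p

window-word-before : ∀ {a} D p w → p < D → window {a} D p (wordTape w) ≡ blank
window-word-before D p []      = window-before D p
window-word-before D p (b ∷ w) = window-before D p

-- A move of the head shifts the window the other way: position `target` shows afterwards what
-- `source` showed before. A common parameter describes both shifts without subtraction.
source target : Move → ℕ → ℕ
source left  p = p
source stay  p = p
source right p = suc p
target left  p = suc p
target stay  p = p
target right p = p

window-move : ∀ {a} D mv p (t : Tape a) → window D (target mv p) (moveHead mv t) ≡ window D (source mv p) t
window-move D left  p t = window-left D p t
window-move D stay  p t = refl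
window-move D right p t = window-right D p t

digit-cell : ∀ {a} w i → digitOf w i ≡ 0 → wordCells {a} w i ≡ blank
digit-cell []          _       _ = refl
digit-cell (false ∷ w) (suc i) e = digit-cell w i e
digit-cell (true ∷ w)  (suc i) e = digit-cell w i e

digit-cell-bit : ∀ {a} w i b → digitOf w i ≡ suc (number b) → wordCells {a} w i ≡ bit b
digit-cell-bit (false ∷ w) zero    b e = cong bit (number-injective {false} {b} (suc-injective e))
digit-cell-bit (true ∷ w)  zero    b e = cong bit (number-injective {true} {b} (suc-injective e))
digit-cell-bit (false ∷ w) (suc i) b e = digit-cell-bit w i b e
digit-cell-bit (true ∷ w)  (suc i) b e = digit-cell-bit w i b e

digit-cases : ∀ w i → digitOf w i ≡ 0 ⊎ (∃[ b ] digitOf w i ≡ suc (number b))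
digit-cases []          _       = inj₁ refl
digit-cases (false ∷ w) zero    = inj₂ (false , refl)
digit-cases (true ∷ w)  zero    = inj₂ (true , refl)
digit-cases (false ∷ w) (suc i) = digit-cases w i
digit-cases (true ∷ w)  (suc i) = digit-cases w i

digit-beyond : ∀ w i → length w ≤ i → digitOf w i ≡ 0
digit-beyond []          i       _       = refl
digit-beyond (false ∷ w) (suc i) (s≤s h) = digit-beyond w i h
digit-beyond (true ∷ w)  (suc i) (s≤s h) = digit-beyond w i h

digit-end : ∀ w i → digitOf w i ≡ 0 → digitOf w (suc i) ≡ 0
digit-end []          i       e = refl
digit-end (false ∷ w) (suc i) e = digit-end w i e
digit-end (true ∷ w)  (suc i) e = digit-end w i e

infix 5 _<ᶠᵐ_
_<ᶠᵐ_ : ∀ {m Γ} → Tm m Γ → Tm m Γ → Fm m Γ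
t <ᶠᵐ u = lit 1 ⊕ t ≤ᶠ u

-- The clauses that describe a computation

module CookLevin (M : Machine 2) (certificate time : Polynomial) where
  open Machine M

  Sym : Set
  Sym = Symbol aux

  Local : Set
  Local = Fin states × Vec Sym tapes

  Action : Set
  Action = Fin states × Vec (Sym × Move) tapes

  -- No clause makes different facts about a cell exclude each other. A model may contain several at
  -- once; soundness follows only those that are forced.
  Fact : Set
  Fact = (Fin tapes × Sym) ⊎ Fin states

  pattern cellIs j s = inj₁ (j , s)
  pattern stateIs q  = inj₂ q

  Rule : Set
  Rule = (Local × Fin tapes × Sym) ⊎ (Local × Fin tapes) ⊎ Local ⊎ Local ⊎ (Local × Bool) ⊎ Fin tapes ⊎ Bool ⊎ Fin 3 ⊎ Fact

  pattern copy z j s  = inj₁ (z , j , s)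
  pattern write z j   = inj₂ (inj₁ (z , j))
  pattern goto z      = inj₂ (inj₂ (inj₁ z))
  pattern verdict z   = inj₂ (inj₂ (inj₂ (inj₁ z)))
  pattern single z b  = inj₂ (inj₂ (inj₂ (inj₂ (inj₁ (z , b)))))
  pattern blankAt j   = inj₂ (inj₂ (inj₂ (inj₂ (inj₂ (inj₁ j)))))
  pattern inputBit b  = inj₂ (inj₂ (inj₂ (inj₂ (inj₂ (inj₂ (inj₁ b))))))
  pattern startState  = inj₂ (inj₂ (inj₂ (inj₂ (inj₂ (inj₂ (inj₂ (inj₁ zero)))))))
  pattern guess       = inj₂ (inj₂ (inj₂ (inj₂ (inj₂ (inj₂ (inj₂ (inj₁ (suc zero))))))))
  pattern guessEnd    = inj₂ (inj₂ (inj₂ (inj₂ (inj₂ (inj₂ (inj₂ (inj₁ (suc (suc zero)))))))))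
  pattern pad f       = inj₂ (inj₂ (inj₂ (inj₂ (inj₂ (inj₂ (inj₂ (inj₂ f)))))))

  finite-Fact : Finite Fact
  finite-Fact = finite-⊎ (finite-× (finite-Fin _) (finite-Symbol _)) (finite-Fin _)

  rules : Finite Rule
  rules = finite-⊎ (finite-× finite-Local (finite-× (finite-Fin _) (finite-Symbol _)))
    (finite-⊎ (finite-× finite-Local (finite-Fin _)) (finite-⊎ finite-Local (finite-⊎ finite-Local
    (finite-⊎ (finite-× finite-Local finite-Bool) (finite-⊎ (finite-Fin _) (finite-⊎ finite-Bool
    (finite-⊎ (finite-Fin 3) finite-Fact)))))))
    where
    finite-Local : Finite Local
    finite-Local = finite-× (finite-Fin _) (finite-Vec _ (finite-Symbol _))

  padRule : Fact → Rule
  padRule f = pad f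

  unpad : Rule → Maybe Fact
  unpad (pad f) = just f
  unpad _       = nothing

  -- The number of times exceeds the length of every run on a certificate of length at most
  -- `spaceT`, with 2 to spare for inspecting the output at the end; the further `spaceT` makes the
  -- certificate fit to the right of the head. Heads are at position `timesT`, the centre, so there
  -- is as much room on either side as there are times.
  spaceT timesT positionsT : Tm 1 0
  spaceT     = polyT certificate (len zero)
  timesT     = polyT time (len zero ⊕ spaceT) ⊕ (lit 2 ⊕ spaceT)
  positionsT = timesT ⊕ timesT

  p t D : Tm 1 2
  p = var zero
  t = var (suc zero)
  D = ren [] timesT

  outTape : Fin tapes
  outTape = 2 ↑ʳ zero

  -- All negated, so that `premises z ++ ls` is the implication from the state and scanned symbols
  -- `z` to one of `ls`.
  premises : Local → List (Literal Fact)
  premises (q , h) = literal false t D (stateIs q) ∷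
    List.map (λ j → literal false t D (cellIs j (Vec.lookup h j))) (allFin tapes)

  sourceT targetT : Move → Tm 1 2
  sourceT left  = p
  sourceT stay  = p
  sourceT right = lit 1 ⊕ p
  targetT left  = lit 1 ⊕ p
  targetT stay  = p
  targetT right = p

  trivial : Clause Fact
  trivial = (lit 1 ≤ᶠ lit 0) ⟹ []

  always : Fm 1 2
  always = lit 0 ≤ᶠ lit 0

  copyClause : Local → Fin tapes → Sym → Maybe Action → Clause Fact
  copyClause z j s nothing           = trivial
  copyClause z j s (just (_ , acts)) = let mv = proj₂ (Vec.lookup acts j) in
    -- A cell keeps its symbol while it is shifted; the scanned cell, at `D`, is left to
    -- `writeClause`.
    (lit 1 ⊕ t <ᶠᵐ D ∧ᶠ sourceT mv <ᶠᵐ ren [] positionsT ∧ᶠ targetT mv <ᶠᵐ ren [] positionsT ∧ᶠ ¬ᶠ (sourceT mv ≡ᶠ D)) ⟹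
    premises z ++ literal false t (sourceT mv) (cellIs j s) ∷ literal true (lit 1 ⊕ t) (targetT mv) (cellIs j s) ∷ []

  writeClause : Local → Fin tapes → Maybe Action → Clause Fact
  writeClause z j nothing           = trivial
  writeClause z j (just (_ , acts)) = let (s , mv) = Vec.lookup acts j in
    (lit 1 ⊕ t <ᶠᵐ D ∧ᶠ targetT mv <ᶠᵐ ren [] positionsT ∧ᶠ sourceT mv ≡ᶠ D) ⟹
    premises z ++ literal true (lit 1 ⊕ t) (targetT mv) (cellIs j s) ∷ []

  gotoClause : Local → Maybe Action → Clause Fact
  gotoClause z nothing        = trivial
  gotoClause z (just (q , _)) = (lit 1 ⊕ t <ᶠᵐ D) ⟹ premises z ++ literal true (lit 1 ⊕ t) D (stateIs q) ∷ []

  -- Together with `singleClause` this says that the output is `true ∷ []`: when the machine halts,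
  -- the output head scans `bit true` and the cell to its right holds no bit.
  verdictClause : (z : Local) → Dec (Vec.lookup (proj₂ z) outTape ≡ bit true) → Maybe Action → Clause Fact
  verdictClause z (no _) nothing = always ⟹ premises z
  verdictClause z _      _       = trivial

  singleClause : Local → Bool → Maybe Action → Clause Fact
  singleClause z b nothing = always ⟹ premises z ++ literal false t (lit 1 ⊕ D) (cellIs outTape (bit b)) ∷ []
  singleClause z b _       = trivial

  initially : Fm 1 2
  initially = t ≡ᶠ lit 0

  blankGuard : Fin tapes → Fm 1 2
  blankGuard zero          = p <ᶠᵐ D ∨ᶠ digit zero (p ⊖ D) ≡ᶠ lit 0
  blankGuard (suc zero)    = p <ᶠᵐ D ∨ᶠ D ⊕ ren [] spaceT ≤ᶠ p
  blankGuard (suc (suc _)) = always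

  clause : Rule → Clause Fact
  clause (copy (q , h) j s)   = copyClause (q , h) j s (δ q h)
  clause (write (q , h) j)    = writeClause (q , h) j (δ q h)
  clause (goto (q , h))       = gotoClause (q , h) (δ q h)
  clause (verdict (q , h))    = verdictClause (q , h) (Vec.lookup h outTape ≟ˢ bit true) (δ q h)
  clause (single (q , h) b)   = singleClause (q , h) b (δ q h)
  clause (blankAt j)          = (initially ∧ᶠ blankGuard j) ⟹ literal true t p (cellIs j blank) ∷ []
  clause (inputBit b)         = (initially ∧ᶠ D ≤ᶠ p ∧ᶠ digit zero (p ⊖ D) ≡ᶠ lit (suc (number b))) ⟹
                                literal true t p (cellIs zero (bit b)) ∷ []
  clause startState           = initially ⟹ literal true t D (stateIs start) ∷ []
  -- The one free choice. `guessEnd` propagates blanks to the right, so the chosen symbols form a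
  -- word.
  clause guess                = (initially ∧ᶠ D ≤ᶠ p ∧ᶠ p <ᶠᵐ D ⊕ ren [] spaceT) ⟹
                                literal true t p (cellIs (suc zero) blank) ∷
                                literal true t p (cellIs (suc zero) (bit false)) ∷
                                literal true t p (cellIs (suc zero) (bit true)) ∷ []
  clause guessEnd             = (initially ∧ᶠ D ≤ᶠ p ∧ᶠ lit 1 ⊕ p <ᶠᵐ ren [] positionsT) ⟹
                                literal false t p (cellIs (suc zero) blank) ∷
                                literal true t (lit 1 ⊕ p) (cellIs (suc zero) blank) ∷ []
  clause (pad _)              = trivial

  open Uniform rules padRule unpad (λ _ → refl) clause timesT positionsT public

-- Acceptance is equivalent to satisfiability

module Simulation (V : Vec Word 2 → Word) (certificate time : Polynomial) (M : Machine 2)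
  (runs : ∀ ws → ∃[ t ] ∃[ d ] Machine._⇓[_]_ M (Machine.initial M ws) t d × t ≤ eval time (size ws) × Machine.output M d ≡ V ws)
  (w : Word) where

  open Machine M using (states; tapes; start; δ; Config; initial; output; step; _⇓[_]_; halt; next)
  open CookLevin M certificate time

  D# S# : ℕ
  D# = T# w
  S# = ⟦ spaceT ⟧ (ws w) []

  space≡ : S# ≡ eval certificate (length w)
  space≡ = ⟦polyT⟧ certificate (len zero) (ws w) []

  time-fits : ∀ {k y} → length y ≤ S# → k ≤ eval time (size (w ∷ y ∷ [])) → 2 + k + S# ≤ D#
  time-fits {k} {y} y≤ k≤ = ≤-trans (≤-reflexive (trans (cong (_+ S#) (+-comm 2 k)) (+-assoc k 2 S#)))
    (+-monoˡ-≤ (2 + S#) (≤-trans k≤ (≤-trans (eval-mono time (+-monoʳ-≤ (length w) (≤-trans (≤-reflexive (+-identityʳ _)) y≤)))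
      (≤-reflexive (sym (⟦polyT⟧ time (len zero ⊕ spaceT) (ws w) []))))))

  D≥2 : 2 ≤ D#
  D≥2 = ≤-trans (m≤m+n 2 S#) (m≤n+m (2 + S#) _)

  S<D : S# < D#
  S<D = ≤-trans (n≤1+n (suc S#)) (m≤n+m (2 + S#) _)

  D<2D : D# < D# + D#
  D<2D = m<m+n D# (≤-trans (s≤s z≤n) D≥2)

  tapeAt : Config → Fin tapes → Tape _
  tapeAt (_ , ts) = Vec.lookup ts

  step-halts : ∀ {q ts} → step (q , ts) ≡ nothing → δ q (Vec.map Tape.head ts) ≡ nothing
  step-halts {q} {ts} e with δ q (Vec.map Tape.head ts) | e
  ... | nothing | _ = refl

  bitPrefix-true : ∀ {a} (s : Symbol a) ss → bitPrefix (s ∷ ss) ≡ true ∷ [] → s ≡ bit true × (∀ b → cellAt ss 0 ≢ bit b)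
  bitPrefix-true (bit true) []           e = refl , λ _ ()
  bitPrefix-true (bit true) (blank ∷ _)  e = refl , λ _ ()
  bitPrefix-true (bit true) (extra _ ∷ _) e = refl , λ _ ()

  true-bitPrefix : ∀ {a} ss → (∀ b → cellAt {a} ss 0 ≢ bit b) → bitPrefix (bit true ∷ ss) ≡ true ∷ []
  true-bitPrefix []             n = refl
  true-bitPrefix (blank ∷ _)    n = refl
  true-bitPrefix (extra _ ∷ _)  n = refl
  true-bitPrefix (bit b ∷ _)    n = contradiction refl (n b)

  -- A model yields an accepted certificate

  module Sound (β : Valuation w) (model : Model w β) where

    ModelAt : Clause Fact → Set
    ModelAt C = ∀ t p → t < D# → p < D# + D# → ⟦ Clause.guard C ⟧ᶠ (ws w) (p ∷ t ∷ []) →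
      ∃[ l ] l ∈ˡ Clause.literals C × Holds w β t p l

    -- Cells at the border of the window depend on cells beyond it, so each step gives up one
    -- position on either side. Only the truth of the actual facts is maintained, not the falsity of
    -- all others.
    record Inv (t : ℕ) (c : Config) : Set where
      constructor inv
      field
        cells : ∀ j p → t ≤ p → p + t < D# + D# → β t p (cellIs j (window D# p (tapeAt c j))) ≡ true
        state : β t D# (stateIs (proj₁ c)) ≡ true

    symbolsOf : Config → Vec Sym tapes
    symbolsOf (_ , ts) = Vec.map Tape.head ts

    centre : ∀ {t c} → Inv t c → t < D# → ∀ j → β t D# (cellIs j (Vec.lookup (symbolsOf c) j)) ≡ true
    centre {t} {q , ts} I t<D j = subst (λ s → β t D# (cellIs j s) ≡ true)
      (trans (window-head D# (Vec.lookup ts j)) (sym (lookup-map j Tape.head ts)))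
      (Inv.cells I j D# (<⇒≤ t<D) (+-monoʳ-< D# t<D))

    -- The invariant makes the facts in all premises true and hence their negated literals false, so
    -- the clause is satisfied further on.
    beyond-premises : ∀ {t c p ls} → Inv t c → t < D# →
      (∃[ l ] l ∈ˡ premises (proj₁ c , symbolsOf c) ++ ls × Holds w β t p l) → ∃[ l ] l ∈ˡ ls × Holds w β t p l
    beyond-premises {t} {c} {p} I t<D (l , l∈ , h) with ∈-++⁻ (premises (proj₁ c , symbolsOf c)) l∈
    ... | inj₂ l∈′        = l , l∈′ , h
    ... | inj₁ (here refl) = contradiction (trans (sym (Inv.state I)) h) λ ()
    ... | inj₁ (there l∈′) with ∈-map⁻ _ l∈′
    ...   | j , _ , refl = contradiction (trans (sym (centre I t<D j)) h) λ ()

    -- Solves `target mv p₀ ≡ p`; the position given up in this step is what keeps the source inside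
    -- the controlled range.
    column : ∀ mv {t p} → suc t ≤ p → p + suc t < D# + D# →
      ∃[ p₀ ] target mv p₀ ≡ p × t ≤ source mv p₀ × source mv p₀ + t < D# + D# × p₀ < D# + D#
    column left  {t} {suc p} (s≤s t≤p) h = p , refl , t≤p , <-trans (+-monoʳ-< p ≤-refl) (<-trans (n<1+n _) h) ,
      <-trans (≤-<-trans (m≤m+n p (suc t)) (n<1+n _)) h
    column stay  {t} {p} t<p h = p , refl , <⇒≤ t<p , <-trans (+-monoʳ-< p ≤-refl) h , ≤-<-trans (m≤m+n p (suc t)) h
    column right {t} {p} t<p h = p , refl , m≤n⇒m≤1+n (<⇒≤ t<p) , subst (_< D# + D#) (+-suc p t) h , ≤-<-trans (m≤m+n p (suc t)) h

    sourceT≡ : ∀ mv p t → ⟦ sourceT mv ⟧ (ws w) (p ∷ t ∷ []) ≡ source mv p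
    sourceT≡ left  p t = refl
    sourceT≡ stay  p t = refl
    sourceT≡ right p t = refl

    targetT≡ : ∀ mv p t → ⟦ targetT mv ⟧ (ws w) (p ∷ t ∷ []) ≡ target mv p
    targetT≡ left  p t = refl
    targetT≡ stay  p t = refl
    targetT≡ right p t = refl

    module _ {t q ts q′ acts} (I : Inv t (q , ts)) (t+1<D : suc t < D#)
             (e : δ q (Vec.map Tape.head ts) ≡ just (q′ , acts)) where
      private
        h : Vec Sym tapes
        h = Vec.map Tape.head ts

        t<D : t < D#
        t<D = <⇒≤ t+1<D

      next-state : β (suc t) D# (stateIs q′) ≡ true
      next-state with beyond-premises I t<D
        (subst (λ m → ModelAt (gotoClause (q , h) m)) e (model (goto (q , h))) t 0 t<D (≤-<-trans z≤n D<2D) t+1<D)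
      ... | _ , here refl , holds = holds

      next-cell : ∀ j p → suc t ≤ p → p + suc t < D# + D# →
        β (suc t) p (cellIs j (window D# p (Vec.lookup (Vec.zipWith writeMove ts acts) j))) ≡ true
      next-cell j p t<p p<
        rewrite lookup-zipWith writeMove j ts acts
        with column (proj₂ (Vec.lookup acts j)) t<p p<
      ... | p₀ , refl , t≤s , s< , p₀< = subst (λ s → β (suc t) (target mv p₀) (cellIs j s) ≡ true)
          (sym (window-move D# mv p₀ (tape ls s rs))) written
        where
        s = proj₁ (Vec.lookup acts j)
        mv = proj₂ (Vec.lookup acts j)
        ls = Tape.leftOf (Vec.lookup ts j)
        rs = Tape.rightOf (Vec.lookup ts j)
        src = source mv p₀
        p<P : target mv p₀ < D# + D#
        p<P = ≤-<-trans (m≤m+n _ (suc t)) p<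
        s<P : src < D# + D#
        s<P = ≤-<-trans (m≤m+n _ t) s<
        written : β (suc t) (target mv p₀) (cellIs j (window D# src (tape ls s rs))) ≡ true
        written with src ≟ D#
        ... | yes src≡D with beyond-premises I t<D
              (subst (λ m → ModelAt (writeClause (q , h) j m)) e (model (write (q , h) j)) t p₀ t<D p₀<
                (t+1<D , subst (_< D# + D#) (sym (targetT≡ mv p₀ t)) p<P , trans (sourceT≡ mv p₀ t) src≡D))
        ...   | _ , here refl , holds = subst (λ p → β (suc t) (target mv p₀) (cellIs j p) ≡ true)
                (sym (trans (cong (λ x → window D# x (tape ls s rs)) src≡D) (window-head D# (tape ls s rs))))
                (subst (λ p → β (suc t) p (cellIs j s) ≡ true) (targetT≡ mv p₀ t) holds)
        written | no src≢D with beyond-premises I t<D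
              (subst (λ m → ModelAt (copyClause (q , h) j old m)) e (model (copy (q , h) j old)) t p₀ t<D p₀<
                (t+1<D , subst (_< D# + D#) (sym (sourceT≡ mv p₀ t)) s<P , subst (_< D# + D#) (sym (targetT≡ mv p₀ t)) p<P ,
                 λ eq → src≢D (trans (sym (sourceT≡ mv p₀ t)) eq)))
          where
          old = window D# src (Vec.lookup ts j)
        ...   | _ , here refl , holds = contradiction
                (trans (sym (Inv.cells I j src t≤s s<)) (subst (λ p → β t p (cellIs j (window D# src (Vec.lookup ts j))) ≡ false) (sourceT≡ mv p₀ t) holds)) λ ()
        ...   | _ , there (here refl) , holds = subst (λ s → β (suc t) (target mv p₀) (cellIs j s) ≡ true)
                (window-write D# src (Tape.head (Vec.lookup ts j)) s src≢D)
                (subst (λ p → β (suc t) p (cellIs j (window D# src (Vec.lookup ts j))) ≡ true) (targetT≡ mv p₀ t) holds)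

      next-inv : Inv (suc t) (q′ , Vec.zipWith writeMove ts acts)
      next-inv = inv next-cell next-state

    -- The reserve of 2 keeps the positions `D#` and `suc D#`, which decide about the output, inside
    -- the controlled range at the halting time.
    accepted : ∀ {c k d t} → c ⇓[ k ] d → Inv t c → t + k + 2 ≤ D# → output d ≡ true ∷ []
    accepted {q , ts} {t = t} (halt e) I fits = done
      where
      h = Vec.map Tape.head ts
      t<D : t < D#
      t<D = ≤-trans (≤-trans (≤-reflexive (+-comm 1 t)) (+-mono-≤ (m≤m+n t 0) (s≤s z≤n))) fits
      t+1<D : suc t < D#
      t+1<D = ≤-trans (≤-trans (≤-reflexive (+-comm 2 t)) (+-monoˡ-≤ 2 (m≤m+n t 0))) fits
      δ≡ : δ q h ≡ nothing
      δ≡ = step-halts e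
      out = Vec.lookup ts outTape
      head-true : Tape.head out ≡ bit true
      head-true with Vec.lookup h outTape ≟ˢ bit true in d
      ... | yes s = trans (sym (lookup-map outTape Tape.head ts)) s
      ... | no ¬s with subst₂ (λ m d → ModelAt (verdictClause (q , h) d m)) δ≡ d (model (verdict (q , h))) t 0 t<D (≤-<-trans z≤n D<2D) z≤n
      ...   | l , l∈ , holds with beyond-premises {p = 0} {[]} I t<D (l , ∈-++⁺ˡ l∈ , holds)
      ...     | _ , () , _
      no-bit : ∀ b → cellAt (Tape.rightOf out) 0 ≢ bit b
      no-bit b eq with beyond-premises I t<D
        (subst (λ m → ModelAt (singleClause (q , h) b m)) δ≡ (model (single (q , h) b)) t 0 t<D (≤-<-trans z≤n D<2D) z≤n)
      ... | _ , here refl , holds = contradiction (trans (sym (subst (λ s → β t (suc D#) (cellIs outTape s) ≡ true)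
              (trans (window-next D# out) eq)
              (Inv.cells I outTape (suc D#) (m≤n⇒m≤1+n (<⇒≤ t<D)) (≤-<-trans (≤-reflexive (sym (+-suc D# t))) (+-monoʳ-< D# t+1<D))))) holds) λ ()
      done : output (q , ts) ≡ true ∷ []
      done = trans (cong (λ s → bitPrefix (s ∷ Tape.rightOf out)) head-true) (true-bitPrefix (Tape.rightOf out) no-bit)
    accepted {q , ts} {t = t} (next {t = k} e r) I fits with δ q (Vec.map Tape.head ts) in eδ
    accepted {q , ts} {t = t} (next {t = k} refl r) I fits | just (q′ , acts) =
      accepted r (next-inv I t+1<D eδ) (subst (λ x → x + 2 ≤ D#) (+-suc t k) fits)
      where
      t+1<D : suc t < D#
      t+1<D = ≤-trans (≤-trans (≤-reflexive (+-comm 2 t)) (+-monoˡ-≤ 2 (m≤m+n t (suc k)))) fits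

    guess-at : ℕ → Sym → Bool
    guess-at i s = β 0 (D# + i) (cellIs (suc zero) s)

    0<D : 0 < D#
    0<D = ≤-trans (s≤s z≤n) D≥2

    -- The certificate ends before the first cell declared blank. A cell with several declared
    -- symbols counts as blank if possible, then as `true`, then as `false`.
    read : ℕ → ℕ → Word
    read zero    i = []
    read (suc k) i = if guess-at i blank then [] else guess-at i (bit true) ∷ read k (suc i)

    read-length : ∀ k i → length (read k i) ≤ k
    read-length zero    i = z≤n
    read-length (suc k) i with guess-at i blank
    ... | true  = z≤n
    ... | false = s≤s (read-length k (suc i))

    in-window : ∀ {i} → i < S# → D# + i < D# + D#
    in-window i<S = +-monoʳ-< D# (<-trans i<S S<D)

    blank-stays : ∀ i n → guess-at i blank ≡ true → D# + (i + n) < D# + D# → guess-at (i + n) blank ≡ true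
    blank-stays i zero    e lt = subst (λ i → guess-at i blank ≡ true) (sym (+-identityʳ i)) e
    blank-stays i (suc n) e lt rewrite +-suc i n with
      model guessEnd 0 (D# + (i + n)) 0<D (<-trans (+-monoʳ-< D# ≤-refl) lt) (refl , m≤m+n D# _ , ≤-<-trans (≤-reflexive (sym (+-suc D# (i + n)))) lt)
    ... | _ , here refl , holds = contradiction (trans (sym (blank-stays i n e (<-trans (+-monoʳ-< D# ≤-refl) lt))) holds) λ ()
    ... | _ , there (here refl) , holds = subst (λ x → β 0 x (cellIs (suc zero) blank) ≡ true) (sym (+-suc D# (i + n))) holds

    read-cells : ∀ k i → i + k ≡ S# → ∀ n → D# + (i + n) < D# + D# → guess-at (i + n) (wordCells (read k i) n) ≡ true
    read-cells zero i e n lt with model (blankAt (suc zero)) 0 (D# + (i + n)) 0<D lt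
      (refl , inj₂ (+-monoʳ-≤ D# (≤-trans (≤-reflexive (sym (trans (sym (+-identityʳ i)) e))) (m≤m+n i n))))
    ... | _ , here refl , holds = holds
    read-cells (suc k) i e n lt with guess-at i blank in eb
    ... | true = blank-stays i n eb lt
    read-cells (suc k) i e (suc n) lt | false =
      subst (λ x → guess-at x (wordCells (read k (suc i)) n) ≡ true) (sym (+-suc i n))
        (read-cells k (suc i) (trans (sym (+-suc i k)) e) n (subst (λ x → D# + x < D# + D#) (+-suc i n) lt))
    read-cells (suc k) i e zero lt | false = subst (λ x → guess-at x (bit (guess-at i (bit true))) ≡ true) (sym (+-identityʳ i))
        (some (guess-at i (bit true)) refl)
      where
      some : ∀ b → guess-at i (bit true) ≡ b → guess-at i (bit b) ≡ true
      some true  eq = eq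
      some false eq with model guess 0 (D# + i) 0<D (in-window i<S) (refl , m≤m+n D# i , +-monoʳ-< D# i<S)
        where
        i<S : i < S#
        i<S = ≤-trans (m<m+n i (s≤s z≤n)) (≤-reflexive e)
      ... | _ , here refl , holds                 = contradiction (trans (sym eb) holds) λ ()
      ... | _ , there (here refl) , holds         = holds
      ... | _ , there (there (here refl)) , holds = contradiction (trans (sym eq) holds) λ ()

    y : Word
    y = read S# 0

    empty-window : ∀ p → window D# p (emptyTape {Machine.aux M}) ≡ blank
    empty-window p with p <? D#
    ... | yes p<D = window-word-before D# p [] p<D
    ... | no p≮D  = window-word D# p [] (≮⇒≥ p≮D)

    initial-cell : ∀ j p → p + 0 < D# + D# → β 0 p (cellIs j (window D# p (tapeAt (initial (w ∷ y ∷ [])) j))) ≡ true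
    initial-cell zero p p< with p <? D#
    initial-cell zero p p< | yes p<D rewrite window-word-before {Machine.aux M} D# p w p<D
      with model (blankAt zero) 0 p 0<D (subst (_< D# + D#) (+-identityʳ p) p<) (refl , inj₁ p<D)
    ... | _ , here refl , holds = holds
    initial-cell zero p p< | no p≮D rewrite window-word {Machine.aux M} D# p w (≮⇒≥ p≮D) with digit-cases w (p ∸ D#)
    ... | inj₁ e rewrite digit-cell {Machine.aux M} w (p ∸ D#) e
      with model (blankAt zero) 0 p 0<D (subst (_< D# + D#) (+-identityʳ p) p<) (refl , inj₂ e)
    ...   | _ , here refl , holds = holds
    initial-cell zero p p< | no p≮D | inj₂ (b , e) rewrite digit-cell-bit {Machine.aux M} w (p ∸ D#) b e
      with model (inputBit b) 0 p 0<D (subst (_< D# + D#) (+-identityʳ p) p<) (refl , ≮⇒≥ p≮D , e)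
    ...   | _ , here refl , holds = holds
    initial-cell (suc zero) p p< with p <? D#
    ... | yes p<D rewrite window-word-before {Machine.aux M} D# p y p<D
      with model (blankAt (suc zero)) 0 p 0<D (subst (_< D# + D#) (+-identityʳ p) p<) (refl , inj₁ p<D)
    ...   | _ , here refl , holds = holds
    initial-cell (suc zero) p p< | no p≮D rewrite window-word {Machine.aux M} D# p y (≮⇒≥ p≮D) =
      subst (λ x → β 0 x (cellIs (suc zero) (wordCells y (p ∸ D#))) ≡ true) (m+[n∸m]≡n (≮⇒≥ p≮D))
        (read-cells S# 0 refl (p ∸ D#) (subst (_< D# + D#) (trans (+-identityʳ p) (sym (m+[n∸m]≡n (≮⇒≥ p≮D)))) p<))
    initial-cell (suc (suc j)) p p< rewrite lookup-replicate j (emptyTape {Machine.aux M}) | empty-window p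
      with model (blankAt (suc (suc j))) 0 p 0<D (subst (_< D# + D#) (+-identityʳ p) p<) (refl , z≤n)
    ... | _ , here refl , holds = holds

    initial-inv : Inv 0 (initial (w ∷ y ∷ []))
    initial-inv = inv (λ j p _ p< → initial-cell j p p<) state
      where
      state : β 0 D# (stateIs start) ≡ true
      state with model startState 0 0 0<D (≤-<-trans z≤n D<2D) refl
      ... | _ , here refl , holds = holds

    accepting : ∃[ y ] length y ≤ eval certificate (length w) × V (w ∷ y ∷ []) ≡ true ∷ []
    accepting = let (k , d , r , k≤ , out) = runs (w ∷ y ∷ []) in
      y , subst (length y ≤_) space≡ (read-length S# 0) ,
      trans (sym out) (accepted r initial-inv (≤-trans (≤-reflexive (+-comm k 2)) (≤-trans (m≤m+n (2 + k) S#)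
        (time-fits {y = y} (read-length S# 0) k≤))))
  within-range : WithinRange w
  within-range r t p t<T p<P g l l∈ = go r g l∈
    where
    Fine : Literal Fact → Set
    Fine l = timeOf w l t p < D# × posOf w l t p < D# + D#
    premises-fine : ∀ z {l} → l ∈ˡ premises z → Fine l
    premises-fine z (here refl) = t<T , D<2D
    premises-fine z (there l∈) with ∈-map⁻ _ l∈
    ... | j , _ , refl = t<T , D<2D
    both : ∀ z {ls l} → l ∈ˡ premises z ++ ls → (l ∈ˡ ls → Fine l) → Fine l
    both z l∈ f = [ premises-fine z , f ]′ (∈-++⁻ (premises z) l∈)
    go : ∀ r {l} → ⟦ Clause.guard (clause r) ⟧ᶠ (ws w) (p ∷ t ∷ []) → l ∈ˡ Clause.literals (clause r) → Fine l
    go (copy (q , h) j s) g l∈ with δ q h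
    go (copy (q , h) j s) g () | nothing
    ... | just (_ , acts) = both (q , h) l∈ λ { (here refl) → t<T , proj₁ (proj₂ g)
                                              ; (there (here refl)) → proj₁ g , proj₁ (proj₂ (proj₂ g)) }
    go (write (q , h) j) g l∈ with δ q h
    go (write (q , h) j) g () | nothing
    ... | just (_ , acts) = both (q , h) l∈ λ { (here refl) → proj₁ g , proj₁ (proj₂ g) }
    go (goto (q , h)) g l∈ with δ q h
    go (goto (q , h)) g () | nothing
    ... | just _ = both (q , h) l∈ λ { (here refl) → g , D<2D }
    go (verdict (q , h)) g l∈ with Vec.lookup h outTape ≟ˢ bit true | δ q h
    go (verdict (q , h)) g () | yes _ | nothing
    go (verdict (q , h)) g () | yes _ | just _
    go (verdict (q , h)) g () | no _  | just _
    ... | no _ | nothing = premises-fine (q , h) l∈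
    go (single (q , h) b) g l∈ with δ q h
    go (single (q , h) b) g () | just _
    ... | nothing = both (q , h) l∈ λ { (here refl) → t<T , ≤-trans (≤-reflexive (+-comm 2 D#)) (+-monoʳ-≤ D# D≥2) }
    go (blankAt j) g (here refl)  = t<T , p<P
    go (inputBit b) g (here refl) = t<T , p<P
    go startState g (here refl)   = t<T , D<2D
    go guess g (here refl)                 = t<T , p<P
    go guess g (there (here refl))         = t<T , p<P
    go guess g (there (there (here refl))) = t<T , p<P
    go guessEnd g (here refl)         = t<T , p<P
    go guessEnd g (there (here refl)) = t<T , proj₂ (proj₂ g)
    go (pad _) g ()

  -- An accepted certificate yields a model

  module Complete (y : Word) (short : length y ≤ eval certificate (length w)) (accept : V (w ∷ y ∷ []) ≡ true ∷ []) where

    steps : Config → ℕ → Maybe Config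
    steps c zero    = just c
    steps c (suc t) = maybe′ (λ c′ → steps c′ t) nothing (step c)

    steps-suc : ∀ t {c d} → steps c t ≡ just d → steps c (suc t) ≡ step d
    steps-suc zero {c} refl with step c
    ... | just _  = refl
    ... | nothing = refl
    steps-suc (suc t) {c} e with step c
    ... | just c′ = steps-suc t e

    final-config : ∀ {c k d} → c ⇓[ k ] d → ∀ t {e} → steps c t ≡ just e → step e ≡ nothing → e ≡ d
    final-config (halt h) zero    refl _ = refl
    final-config (halt h) (suc t) e    _ rewrite h = contradiction e λ ()
    final-config (next s r) zero    refl h = contradiction (trans (sym s) h) λ ()
    final-config (next s r) (suc t) e    h rewrite s = final-config r t e h

    run : ℕ → Maybe Config
    run = steps (initial (w ∷ y ∷ []))

    -- After the halt no fact is true, so all clauses with premises hold vacuously from then on.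
    True : Maybe Config → ℕ → Fact → Set
    True nothing  p _            = ⊥
    True (just c) p (cellIs j s) = window D# p (tapeAt c j) ≡ s
    True (just c) p (stateIs q)  = proj₁ c ≡ q

    true? : ∀ c p f → Dec (True c p f)
    true? nothing  p _            = no λ ()
    true? (just c) p (cellIs j s) = window D# p (tapeAt c j) ≟ˢ s
    true? (just c) p (stateIs q)  = proj₁ c 𝔽.≟ q

    β : Valuation w
    β t p f = does (true? (run t) p f)

    holds-true : ∀ {t p f} → True (run t) p f → β t p f ≡ true
    holds-true {t} {p} {f} = dec-true (true? (run t) p f)

    holds-false : ∀ {t p f} → ¬ True (run t) p f → β t p f ≡ false
    holds-false {t} {p} {f} = dec-false (true? (run t) p f)

    vec-ext : ∀ {A : Set} {n} {xs ys : Vec A n} → (∀ i → Vec.lookup xs i ≡ Vec.lookup ys i) → xs ≡ ys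
    vec-ext {xs = []}     {[]}     e = refl
    vec-ext {xs = x ∷ xs} {y ∷ ys} e = cong₂ _∷_ (e zero) (vec-ext (e ∘ suc))

    Goal : ℕ → ℕ → List (Literal Fact) → Set
    Goal t p ls = ∃[ l ] l ∈ˡ ls × Holds w β t p l

    premises-cases : ∀ {t p} z → Goal t p (premises z) ⊎
      (∃[ ts ] run t ≡ just (proj₁ z , ts) × Vec.map Tape.head ts ≡ proj₂ z)
    premises-cases {t} {p} (q , h) with run t in e
    ... | nothing = inj₁ (_ , here refl , holds-false {t} {D#} {stateIs q} (subst (λ c → ¬ True c D# (stateIs q)) (sym e) λ ()))
    ... | just (q₀ , ts) with q₀ 𝔽.≟ q | 𝔽.any? (λ j → ¬? (Tape.head (Vec.lookup ts j) ≟ˢ Vec.lookup h j))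
    ...   | no n     | _           = inj₁ (_ , here refl , holds-false {t} {D#} {stateIs q} (subst (λ c → ¬ True c D# (stateIs q)) (sym e) n))
    ...   | yes refl | yes (j , n) = inj₁ (_ , there (∈-map⁺ _ (∈-allFin j)) ,
            holds-false {t} {D#} {cellIs j (Vec.lookup h j)}
              (subst (λ c → ¬ True c D# (cellIs j (Vec.lookup h j))) (sym e) (n ∘ trans (sym (window-head D# (Vec.lookup ts j))))))
    ...   | yes refl | no all      = inj₂ (ts , refl , vec-ext λ j → trans (lookup-map j Tape.head ts) (same j))
      where
      same : ∀ j → Tape.head (Vec.lookup ts j) ≡ Vec.lookup h j
      same j with Tape.head (Vec.lookup ts j) ≟ˢ Vec.lookup h j
      ... | yes s = s
      ... | no n  = contradiction (j , n) all

    unless-refuted : ∀ {t p ls} z → (∀ ts → run t ≡ just (proj₁ z , ts) → Vec.map Tape.head ts ≡ proj₂ z → Goal t p ls) →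
                     Goal t p (premises z ++ ls)
    unless-refuted z f with premises-cases z
    ... | inj₁ (l , l∈ , h) = l , ∈-++⁺ˡ l∈ , h
    ... | inj₂ (ts , e , e′) = let (l , l∈ , h) = f ts e e′ in l , ∈-++⁺ʳ (premises z) l∈ , h

    step-just : ∀ {q ts h q′ acts} → Vec.map Tape.head ts ≡ h → δ q h ≡ just (q′ , acts) →
                step (q , ts) ≡ just (q′ , Vec.zipWith writeMove ts acts)
    step-just refl e rewrite e = refl

    step-nothing : ∀ {q ts h} → Vec.map Tape.head ts ≡ h → δ q h ≡ nothing → step (q , ts) ≡ nothing
    step-nothing refl e rewrite e = refl

    moved : ∀ mv {t p a b} {u : Tape a} {s b′} → ⟦ targetT mv ⟧ (ws w) (p ∷ t ∷ []) ≡ b′ → ⟦ sourceT mv ⟧ (ws w) (p ∷ t ∷ []) ≡ b →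
            window D# b′ (writeMove u (s , mv)) ≡ window D# b (tape (Tape.leftOf u) s (Tape.rightOf u))
    moved left  {p = p} {u = u} {s} refl refl = window-move D# left p (tape (Tape.leftOf u) s (Tape.rightOf u))
    moved stay  {p = p} {u = u} {s} refl refl = refl
    moved right {p = p} {u = u} {s} refl refl = window-move D# right p (tape (Tape.leftOf u) s (Tape.rightOf u))

    transition : ∀ {t q ts h q′ acts} → run t ≡ just (q , ts) → Vec.map Tape.head ts ≡ h → δ q h ≡ just (q′ , acts) →
                 run (suc t) ≡ just (q′ , Vec.zipWith writeMove ts acts)
    transition {t} e e′ eδ = trans (steps-suc t e) (step-just e′ eδ)

    true-after : ∀ {t c f p} → run t ≡ just c → True (just c) p f → β t p f ≡ true
    true-after {t} {f = f} {p} e x = holds-true {t} {p} {f} (subst (λ c → True c p f) (sym e) x)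

    false-after : ∀ {t c f p} → run t ≡ just c → ¬ True (just c) p f → β t p f ≡ false
    false-after {t} {f = f} {p} e x = holds-false {t} {p} {f} (subst (λ c → ¬ True c p f) (sym e) x)

    final-output : ∀ {t q ts h} → run t ≡ just (q , ts) → Vec.map Tape.head ts ≡ h → δ q h ≡ nothing →
      Vec.lookup h outTape ≡ bit true × (∀ b → window D# (suc D#) (Vec.lookup ts outTape) ≢ bit b)
    final-output {t} {q} {ts} e e′ eδ =
      let (k , d , r , _ , out) = runs (w ∷ y ∷ [])
          (s , n) = bitPrefix-true _ _ (trans (cong output (final-config r t e (step-nothing e′ eδ))) (trans out accept))
      in trans (cong (λ h → Vec.lookup h outTape) (sym e′)) (trans (lookup-map outTape Tape.head ts) s) ,
         λ b eq → n b (trans (sym (window-next D# (Vec.lookup ts outTape))) eq)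

    y-beyond : ∀ p → D# + S# ≤ p → digitOf y (p ∸ D#) ≡ 0
    y-beyond p h = digit-beyond y (p ∸ D#) (≤-trans (≤-trans short (≤-reflexive (sym space≡)))
      (≤-trans (≤-reflexive (sym (m+n∸m≡n D# S#))) (∸-monoˡ-≤ D# h)))

    initially-blank : ∀ j p → ⟦ blankGuard j ⟧ᶠ (ws w) (p ∷ 0 ∷ []) → window D# p (tapeAt (initial (w ∷ y ∷ [])) j) ≡ blank
    initially-blank zero p g with p <? D# | g
    ... | yes p<D | _        = window-word-before D# p w p<D
    ... | no p≮D  | inj₁ p<D = contradiction p<D p≮D
    ... | no p≮D  | inj₂ e   = trans (window-word D# p w (≮⇒≥ p≮D)) (digit-cell w (p ∸ D#) e)
    initially-blank (suc zero) p g with p <? D# | g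
    ... | yes p<D | _        = window-word-before D# p y p<D
    ... | no p≮D  | inj₁ p<D = contradiction p<D p≮D
    ... | no p≮D  | inj₂ le  = trans (window-word D# p y (≮⇒≥ p≮D)) (digit-cell y (p ∸ D#) (y-beyond p le))
    initially-blank (suc (suc j)) p g with p <? D#
    ... | yes p<D = trans (cong (window D# p) (lookup-replicate j emptyTape)) (window-word-before D# p [] p<D)
    ... | no p≮D  = trans (cong (window D# p) (lookup-replicate j emptyTape)) (window-word D# p [] (≮⇒≥ p≮D))

    model : Model w β
    model (copy (q , h) j s) t p t< p< g with δ q h in eδ
    ... | nothing = contradiction g λ ()
    ... | just (q′ , acts) = unless-refuted (q , h) λ ts e e′ → decide ts e e′ (window D# src (Vec.lookup ts j) ≟ˢ s)
      where
      mv = proj₂ (Vec.lookup acts j)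
      src = ⟦ sourceT mv ⟧ (ws w) (p ∷ t ∷ [])
      decide : ∀ ts → run t ≡ just (q , ts) → Vec.map Tape.head ts ≡ h → Dec (window D# src (Vec.lookup ts j) ≡ s) →
        Goal t p (literal false (var (suc zero)) (sourceT mv) (cellIs j s) ∷ literal true (lit 1 ⊕ (var (suc zero))) (targetT mv) (cellIs j s) ∷ [])
      decide ts e e′ (no n)  = _ , here refl , false-after {t} {f = cellIs j s} {src} e n
      decide ts e e′ (yes x) = _ , there (here refl) , true-after {suc t} {f = cellIs j s} (transition {t} e e′ eδ)
        (trans (cong (window D# _) (lookup-zipWith writeMove j ts acts)) (trans (moved mv {t} {p} {u = Vec.lookup ts j} refl refl)
          (trans (window-write D# src _ _ (proj₂ (proj₂ (proj₂ g)))) x)))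
    model (write (q , h) j) t p t< p< g with δ q h in eδ
    ... | nothing = contradiction g λ ()
    ... | just (q′ , acts) = unless-refuted (q , h) λ ts e e′ → _ , here refl ,
      true-after {suc t} {f = cellIs j (proj₁ (Vec.lookup acts j))} (transition {t} e e′ eδ)
        (trans (cong (window D# _) (lookup-zipWith writeMove j ts acts)) (trans (moved (proj₂ (Vec.lookup acts j)) {t} {p} {u = Vec.lookup ts j} refl (proj₂ (proj₂ g)))
          (window-head D# (tape (Tape.leftOf (Vec.lookup ts j)) _ (Tape.rightOf (Vec.lookup ts j))))))
    model (goto (q , h)) t p t< p< g with δ q h in eδ
    ... | nothing = contradiction g λ ()
    ... | just (q′ , acts) = unless-refuted (q , h) λ ts e e′ → _ , here refl , true-after {suc t} {f = stateIs q′} {D#} (transition {t} e e′ eδ) refl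
    model (verdict (q , h)) t p t< p< g with Vec.lookup h outTape ≟ˢ bit true | δ q h in eδ
    ... | yes _ | nothing = contradiction g λ ()
    ... | yes _ | just _  = contradiction g λ ()
    ... | no _  | just _  = contradiction g λ ()
    ... | no n  | nothing with premises-cases {t} {p} (q , h)
    ...   | inj₁ goal        = goal
    ...   | inj₂ (ts , e , e′) = contradiction (proj₁ (final-output {t} {q} {ts} e e′ eδ)) n
    model (single (q , h) b) t p t< p< g with δ q h in eδ
    ... | just _  = contradiction g λ ()
    ... | nothing = unless-refuted (q , h) λ ts e e′ → _ , here refl ,
      false-after {t} {f = cellIs outTape (bit b)} {suc D#} e (proj₂ (final-output {t} {q} {ts} e e′ eδ) b)
    model (blankAt j) .0 p t< p< (refl , g) = _ , here refl , holds-true {0} {p} {cellIs j blank} (initially-blank j p g)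
    model (inputBit b) .0 p t< p< (refl , D≤p , e) = _ , here refl , holds-true {0} {p} {cellIs zero (bit b)}
      (trans (window-word D# p w D≤p) (digit-cell-bit w (p ∸ D#) b e))
    model startState .0 p t< p< refl = _ , here refl , holds-true {0} {D#} {stateIs start} refl
    model guess .0 p t< p< (refl , D≤p , _) with digit-cases y (p ∸ D#)
    ... | inj₁ e           = _ , here refl , holds-true {0} {p} {cellIs (suc zero) blank} (trans (window-word D# p y D≤p) (digit-cell y (p ∸ D#) e))
    ... | inj₂ (false , e) = _ , there (here refl) , holds-true {0} {p} {cellIs (suc zero) (bit false)} (trans (window-word D# p y D≤p) (digit-cell-bit y (p ∸ D#) false e))
    ... | inj₂ (true , e)  = _ , there (there (here refl)) , holds-true {0} {p} {cellIs (suc zero) (bit true)} (trans (window-word D# p y D≤p) (digit-cell-bit y (p ∸ D#) true e))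
    model guessEnd .0 p t< p< (refl , D≤p , _) with digit-cases y (p ∸ D#)
    ... | inj₁ e       = _ , there (here refl) , holds-true {0} {suc p} {cellIs (suc zero) blank} (trans (window-word D# (suc p) y (m≤n⇒m≤1+n D≤p))
                           (digit-cell y (suc p ∸ D#) (subst (λ i → digitOf y i ≡ 0) (sym (+-∸-assoc 1 D≤p)) (digit-end y (p ∸ D#) e))))
    ... | inj₂ (b , e) = _ , here refl , holds-false {0} {p} {cellIs (suc zero) blank} λ x → contradiction
                           (trans (sym (digit-cell-bit y (p ∸ D#) b e)) (trans (sym (window-word D# p y D≤p)) x)) λ ()
    model (pad _) t p t< p< ()

  accepted⇔satisfiable :
    (∃[ y ] length y ≤ eval certificate (length w) × V (w ∷ y ∷ []) ≡ true ∷ []) ⇔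
    (Σ (Fin (B# w) → Bool) λ α → ∀ c → ∃[ b ] ∃[ x ] incident w b c x × α x ≡ b)
  accepted⇔satisfiable = mk⇔
    (λ (y , short , accept) → model⇒satisfied w {Complete.β y short accept} within-range (Complete.model y short accept))
    (λ (α , sat) → let (β , model) = satisfied⇒model w α sat in Sound.accepting β model)

-- Numerals

sumBelow-upper : ∀ k {f b} → (∀ y → f y ≤ 1) → (∀ y → b ≤ y → f y ≡ 0) → sumBelow k f ≤ b
sumBelow-upper zero    _ _ = z≤n
sumBelow-upper (suc k) {f} {b} f≤1 f≡0 with b ≤? k
... | yes b≤k rewrite f≡0 k b≤k = sumBelow-upper k f≤1 f≡0
... | no b≰k = ≤-trans (sumBelow-≤ (suc k) (λ i _ → f≤1 i)) (≤-trans (≤-reflexive (*-identityʳ (suc k))) (≰⇒> b≰k))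

sumBelow-lower : ∀ k {f c} → c ≤ k → (∀ y → y < c → 1 ≤ f y) → c ≤ sumBelow k f
sumBelow-lower zero    z≤n _ = z≤n
sumBelow-lower (suc k) {f} {c} c≤ h with c ≟ suc k
... | yes refl = +-mono-≤ (h k ≤-refl) (sumBelow-lower k ≤-refl λ y y<k → h y (m≤n⇒m≤1+n y<k))
... | no c≢    = ≤-trans (sumBelow-lower k (≤-pred (≤∧≢⇒< c≤ c≢)) h) (m≤n+m _ (f k))

-- The number of y with 2 y + 1 + d ≤ x.
halve : ℕ → ℕ → ℕ
halve d x = sumBelow x λ y → 1 ∸ ((y + y + (1 + d)) ∸ x)

halveT : ∀ {m Γ} → Tm m Γ → Tm m Γ → Tm m Γ
halveT d x = sum x (lit 1 ⊖ ((var zero ⊕ var zero ⊕ (lit 1 ⊕ wk d)) ⊖ wk x))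

-- With `halve->` this makes `halve d x` the least `b` with `x ≤ b + b + d`: the summand is 1
-- exactly for `y + y + d < x`, and these `y` form an initial segment.
halve-≤ : ∀ d x b → x ≤ b + b + d → halve d x ≤ b
halve-≤ d x b h = sumBelow-upper x (λ y → m∸n≤m 1 (y + y + (1 + d) ∸ x)) λ y b≤y →
  m≤n⇒m∸n≡0 (m<n⇒0<n∸m (≤-<-trans h (≤-trans (≤-reflexive (sym (+-suc (b + b) d))) (+-monoˡ-≤ (1 + d) (+-mono-≤ b≤y b≤y)))))

halve-> : ∀ d x b → b + b + d < x → b < halve d x
halve-> d x b h = sumBelow-lower x (≤-<-trans (≤-trans (m≤m+n b b) (m≤m+n (b + b) d)) h) λ y y≤b →
  ≤-reflexive (sym (cong (1 ∸_) (m≤n⇒m∸n≡0 (≤-trans (+-monoˡ-≤ (1 + d) (+-mono-≤ (≤-pred y≤b) (≤-pred y≤b)))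
    (≤-trans (≤-reflexive (+-suc (b + b) d)) h)))))

halve-≤x : ∀ d x → halve d x ≤ x
halve-≤x d x = halve-≤ d x x (≤-trans (m≤m+n x x) (m≤m+n (x + x) d))

halve-lower : ∀ d x b → b + b + d ≤ suc x → b ≤ halve d x
halve-lower d x zero    h = z≤n
halve-lower d x (suc b) h = halve-> d x b (≤-pred (≤-trans (≤-reflexive (cong (λ z → suc (z + d)) (sym (+-suc b b)))) h))

forBelow-cons : ∀ n f → forBelow (suc n) f ≡ f 0 ++ forBelow n (f ∘ suc)
forBelow-cons zero    f = sym (++-identityʳ (f 0))
forBelow-cons (suc n) f = trans (cong (_++ f (suc n)) (forBelow-cons n f)) (++-assoc (f 0) (forBelow n (f ∘ suc)) (f (suc n)))

forBelow-cong : ∀ n {f g} → (∀ i → f i ≡ g i) → forBelow n f ≡ forBelow n g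
forBelow-cong zero    e = refl
forBelow-cong (suc n) e = cong₂ _++_ (forBelow-cong n e) (e n)

forBelow-[] : ∀ n → forBelow n (λ _ → []) ≡ []
forBelow-[] zero    = refl
forBelow-[] (suc n) = trans (++-identityʳ _) (forBelow-[] n)

forBelow-replicate : ∀ n → forBelow n (λ _ → true ∷ []) ≡ replicate n true
forBelow-replicate zero    = refl
forBelow-replicate (suc n) = trans (forBelow-cons n (λ _ → true ∷ [])) (cong (true ∷_) (forBelow-replicate n))

forBelow-allFin : ∀ n f → forBelow n f ≡ concatMap (f ∘ toℕ) (allFin n)
forBelow-allFin n f = trans (lemma n f) (cong List.concat (sym (map-tabulate {n = n} id (f ∘ toℕ))))
  where
  lemma : ∀ n f → forBelow n f ≡ List.concat (List.tabulate {n = n} (f ∘ toℕ))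
  lemma zero    f = refl
  lemma (suc n) f = trans (forBelow-cons n f) (cong (f 0 ++_) (lemma n (f ∘ suc)))

forBelow-bits : ∀ n (f : ℕ → Bool) → forBelow n (λ i → f i ∷ []) ≡ List.map (f ∘ toℕ) (allFin n)
forBelow-bits n f = trans (lemma n f) (sym (map-tabulate {n = n} id (f ∘ toℕ)))
  where
  lemma : ∀ n f → forBelow n (λ i → f i ∷ []) ≡ List.tabulate {n = n} (f ∘ toℕ)
  lemma zero    f = refl
  lemma (suc n) f = trans (forBelow-cons n (λ i → f i ∷ [])) (cong (f 0 ∷_) (lemma n (f ∘ suc)))

isHalf : ℕ → ℕ → ℕ
isHalf x y = 1 ∸ ((x ∸ (y + y)) + ((y + y) ∸ x))

-- The digit emitted for x is 2 or 1 according to the parity of x; the rest of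
-- the numeral is that of halve 2 x.
digitPart : ℕ → Word
digitPart x = forBelow (1 ∸ (1 ∸ x)) λ _ → positive? (sumBelow (1 + x) (isHalf x)) ∷ []

digitPart-suc : ∀ z → let x = suc z in
  digitPart x ≡ positive? (sumBelow (1 + x) (isHalf x)) ∷ []
digitPart-suc z = cong (λ c → forBelow (1 ∸ c) λ _ → positive? (sumBelow (2 + z) (isHalf (suc z))) ∷ []) (0∸n≡0 z)

digitPartT : ∀ {m Γ} → Tm m Γ → Out m Γ
digitPartT x = for (lit 1 ⊖ (lit 1 ⊖ x))
  (emit (sum (lit 1 ⊕ wk x) (term (wk (wk x) ≡ᶠ var zero ⊕ var zero))))

-- An iteration can only subtract, so halving subtracts the difference to the half.
halvings : ℕ → ℕ → ℕ
halvings j x = countdown j (λ _ x → x ∸ halve 2 x) x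

halvings-suc : ∀ j x → halvings (suc j) x ≡ halvings j (halve 2 x)
halvings-suc j x = cong (halvings j) (m∸[m∸n]≡n (halve-≤x 2 x))

halvings-0 : ∀ j → halvings j 0 ≡ 0
halvings-0 zero    = refl
halvings-0 (suc j) = halvings-0 j

binaryT : ∀ {m Γ} → Tm m Γ → Out m Γ
binaryT k = for k (digitPartT (iter (var zero) (wk k) (var (suc zero) ⊖ halveT (lit 2) (var (suc zero)))))

even-positive : ∀ n → positive? (sumBelow (1 + (2 + (n + n))) (isHalf (2 + (n + n)))) ≡ true
even-positive n = true-positive? (positive-sumBelow (3 + (n + n)) {isHalf (2 + (n + n))} {i = suc n} (s≤s (s≤s (≤-trans (m≤m+n n n) (n≤1+n _))))
  (∸-positive (cong₂ _+_ (m≤n⇒m∸n≡0 (≤-reflexive e)) (m≤n⇒m∸n≡0 (≤-reflexive (sym e))))))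
  where
  e : 2 + (n + n) ≡ suc n + suc n
  e = cong suc (sym (+-suc n n))

odd≢even : ∀ n y → 1 + (n + n) ≢ y + y
odd≢even zero    (suc y) e = contradiction (trans (suc-injective e) (+-suc y y)) λ ()
odd≢even (suc n) zero    ()
odd≢even (suc n) (suc y) e = odd≢even n y (suc-injective (trans (sym (cong suc (+-suc n n))) (trans (suc-injective e) (+-suc y y))))

odd-not-positive : ∀ n → positive? (sumBelow (1 + (1 + (n + n))) (isHalf (1 + (n + n)))) ≡ false
odd-not-positive n = 𝔹.¬-not λ e →
  let (y , _ , p) = sumBelow-positive (2 + (n + n)) {isHalf (1 + (n + n))} (positive?-true e)
  in odd≢even n y (holds⇒ {m = 0} [] (lit (1 + (n + n)) ≡ᶠ lit (y + y)) {[]} p)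

-- A numeral has at most as many digits as its value, so `N` rounds suffice; once 0 is reached,
-- `digitPart` emits nothing.
binary-digits : ∀ b N → ℕᵇ.toℕ b ≤ N → forBelow N (λ j → digitPart (halvings j (ℕᵇ.toℕ b))) ≡ binary b
binary-digits ℕᵇ.zero N _ = trans (forBelow-cong N λ j → cong digitPart (halvings-0 j)) (forBelow-[] N)
binary-digits 2[1+ b ] (suc N) h = trans (forBelow-cons N _) (cong₂ _++_
  (trans (cong digitPart x≡) (trans (digitPart-suc (1 + (n + n))) (cong (_∷ []) (even-positive n))))
  (trans (forBelow-cong N λ j → cong digitPart (trans (halvings-suc j (2 * suc (ℕᵇ.toℕ b))) (cong (halvings j) next≡)))
    (binary-digits b N (≤-pred (≤-trans (s≤s (m≤m+n _ _)) h)))))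
  where
  n = ℕᵇ.toℕ b
  x≡ : 2 * suc n ≡ 2 + (n + n)
  x≡ = lemma n
    where
    lemma : ∀ n → 2 * suc n ≡ 2 + (n + n)
    lemma = solve-∀
  next≡ : halve 2 (2 * suc n) ≡ n
  next≡ = trans (cong (halve 2) x≡) (≤-antisym (halve-≤ 2 _ n (≤-reflexive (+-comm 2 (n + n))))
    (halve-lower 2 _ n (≤-trans (≤-reflexive (+-comm (n + n) 2)) (n≤1+n _))))
binary-digits 1+[2 b ] (suc N) h = trans (forBelow-cons N _) (cong₂ _++_
  (trans (cong digitPart x≡) (trans (digitPart-suc (n + n)) (cong (_∷ []) (odd-not-positive n))))
  (trans (forBelow-cong N λ j → cong digitPart (trans (halvings-suc j (1 + 2 * ℕᵇ.toℕ b)) (cong (halvings j) next≡)))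
    (binary-digits b N (≤-trans (m≤m+n _ _) (≤-pred h)))))
  where
  n = ℕᵇ.toℕ b
  x≡ : 1 + 2 * n ≡ 1 + (n + n)
  x≡ = cong (λ z → suc (n + z)) (+-identityʳ n)
  -- The least `b` with `2 n + 1 ≤ 2 b + 2` is `n` as well, so halving with respect to the digit 2
  -- also strips the digit 1.
  next≡ : halve 2 (1 + 2 * n) ≡ n
  next≡ = trans (cong (halve 2) x≡) (≤-antisym (halve-≤ 2 _ n (≤-trans (n≤1+n _) (≤-reflexive (+-comm 2 (n + n)))))
    (halve-lower 2 _ n (≤-reflexive (+-comm (n + n) 2))))
binary-digits 2[1+ b ] zero ()
binary-digits 1+[2 b ] zero ()

⟦binaryT⟧ : ∀ {m Γ} (k : Tm m Γ) ws ρ → ⟦ binaryT k ⟧ᵒ ws ρ ≡ binary (ℕᵇ.fromℕ (⟦ k ⟧ ws ρ))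
⟦binaryT⟧ k ws ρ = trans
  (forBelow-cong (⟦ k ⟧ ws ρ) λ j → cong (λ x → digitPart (halvings j x)) (sym (ℕᵇ.toℕ-fromℕ (⟦ k ⟧ ws ρ))))
  (binary-digits (ℕᵇ.fromℕ (⟦ k ⟧ ws ρ)) (⟦ k ⟧ ws ρ) (≤-reflexive (ℕᵇ.toℕ-fromℕ (⟦ k ⟧ ws ρ))))

-- The reduction as a program

-- In inc variable 0 is the propositional variable and variable 1 the clause.
module EdgeFormula (sizeT : Tm 1 0) (inc : Bool → Fm 1 2) where

  Kind : Set
  Kind = Core ⊎ Core

  kindAt : Fin 8 → Kind
  kindAt b = [ inj₁ ∘ coreAt , inj₂ ∘ coreAt ]′ (splitAt 4 b)

  never always₂ : Fm 1 2
  never   = lit 1 ≤ᶠ lit 0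
  always₂ = lit 0 ≤ᶠ lit 0

  same : Fm 1 2
  same = var zero ≡ᶠ var (suc zero)

  cliqueF : ∀ {b b′ : Bool} → Dec (b ≡ b′) → Fm 1 2
  cliqueF (yes _) = ¬ᶠ same
  cliqueF (no _)  = always₂

  coreArc : Core → Core → Fm 1 2
  coreArc (literal b) (literal b′) = cliqueF (b 𝔹.≟ b′)
  coreArc (literal b) (set false)  = same
  coreArc (literal b) (set true)   = inc b
  coreArc (set _)     _            = never

  twigF : ∀ {i j : Fin 4} → Dec (i ≡ j) → Fm 1 2
  twigF (yes _) = same
  twigF (no _)  = never

  -- The kinds of the ends are compared while the formula is built; only the comparison of indices
  -- is left to the machine.
  arcBetween : Kind → Kind → Fm 1 2
  arcBetween (inj₁ c) (inj₁ d) = coreArc c d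
  arcBetween (inj₁ c) (inj₂ d) = twigF (coreIndex c 𝔽.≟ coreIndex d)
  arcBetween (inj₂ _) _        = never

  numberT : Fin 8 → Tm 1 4 → Tm 1 4
  numberT b x = lit 1 ⊕ (ren [] sizeT ⊗ lit (toℕ b) ⊕ x)

  -- Variable 1 is the first vertex, variable 0 the second.
  arcF : Fm 1 2
  arcF = (var (suc zero) ≡ᶠ lit 0 ∧ᶠ ¬ᶠ (var zero ≡ᶠ lit 0)) ∨ᶠ
    ∃ᶠ (ren [] sizeT) (∃ᶠ (ren [] sizeT) (anyᶠ 8 λ i → anyᶠ 8 λ j →
      var (suc (suc (suc zero))) ≡ᶠ numberT i (var (suc zero)) ∧ᶠ
      var (suc (suc zero)) ≡ᶠ numberT j (var zero) ∧ᶠ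
      renᶠ (suc zero ∷ zero ∷ []) (arcBetween (kindAt i) (kindAt j))))

  edgeF : Fm 1 2
  edgeF = arcF ∨ᶠ renᶠ (suc zero ∷ zero ∷ []) arcF

  module _ (w : Word) where

    private
      B : ℕ
      B = ⟦ sizeT ⟧ (w ∷ []) []

    incident′ : Bool → Fin B → Fin B → Set
    incident′ b c x = ⟦ inc b ⟧ᶠ (w ∷ []) (toℕ x ∷ toℕ c ∷ [])

    open Nodes B

    nodeOf : Kind → Fin B → Node B
    nodeOf (inj₁ c) x = core c x
    nodeOf (inj₂ c) x = leaf c x

    nodeAt-kind : ∀ b x → nodeAt (b , x) ≡ nodeOf (kindAt b) x
    nodeAt-kind b x with splitAt 4 b
    ... | inj₁ _ = refl
    ... | inj₂ _ = refl

    adj : Fin (order# B) → Fin (order# B) → Bool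
    adj u v = positive? (⟦ term edgeF ⟧ (w ∷ []) (toℕ v ∷ toℕ u ∷ []))

    Between : Kind → Kind → Fin B → Fin B → Set
    Between k l x y = ⟦ arcBetween k l ⟧ᶠ (w ∷ []) (toℕ x ∷ toℕ y ∷ [])

    coreIndex-injective : ∀ {c d} → coreIndex c ≡ coreIndex d → c ≡ d
    coreIndex-injective {c} {d} e = trans (sym (coreAt-index c)) (trans (cong coreAt e) (coreAt-index d))

    between⇒arc : ∀ k l {x y} → Between k l x y → Arc incident′ (nodeOf k x) (nodeOf l y)
    between⇒arc (inj₁ (literal b)) (inj₁ (literal b′)) h with b 𝔹.≟ b′
    ... | yes _ = clique λ _ e → h (cong toℕ e)
    ... | no n  = clique λ e _ → n e
    between⇒arc (inj₁ (literal b)) (inj₁ (set false)) h with toℕ-injective h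
    ... | refl = choice
    between⇒arc (inj₁ (literal b)) (inj₁ (set true)) h = occurs h
    between⇒arc (inj₁ (set _)) (inj₁ _) ()
    between⇒arc (inj₂ _) (inj₁ _) ()
    between⇒arc (inj₂ _) (inj₂ _) ()
    between⇒arc (inj₁ c) (inj₂ d) h with coreIndex c 𝔽.≟ coreIndex d
    between⇒arc (inj₁ c) (inj₂ d) () | no _
    ... | yes e with coreIndex-injective {c} {d} e | toℕ-injective h
    ...   | refl | refl = twig

    arc⇒between : ∀ k l {x y} → Arc incident′ (nodeOf k x) (nodeOf l y) → Between k l x y
    arc⇒between (inj₁ (literal b)) (inj₁ (literal b′)) (clique n) with b 𝔹.≟ b′
    ... | yes e = n e ∘ toℕ-injective
    ... | no _  = z≤n
    arc⇒between (inj₁ (literal b)) (inj₁ (set false)) choice   = refl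
    arc⇒between (inj₁ (literal b)) (inj₁ (set true)) (occurs i) = i
    arc⇒between (inj₁ (set _)) (inj₁ _) ()
    arc⇒between (inj₁ c) (inj₂ .c) twig with coreIndex c 𝔽.≟ coreIndex c
    ... | yes _ = refl
    ... | no n  = contradiction refl n
    arc⇒between (inj₂ _) (inj₁ _) ()
    arc⇒between (inj₂ _) (inj₂ _) ()

    arcs : Fin (order# B) → Fin (order# B) → Set
    arcs u v = ⟦ arcF ⟧ᶠ (w ∷ []) (toℕ v ∷ toℕ u ∷ [])

    vertex : Fin 8 → Fin B → Fin (order# B)
    vertex b x = suc (combine b x)

    toℕ-vertex : ∀ b x → toℕ (vertex b x) ≡ suc (B * toℕ b + toℕ x)
    toℕ-vertex b x = cong suc (toℕ-combine b x)

    view-vertex : ∀ b x → view (vertex b x) ≡ nodeOf (kindAt b) x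
    view-vertex b x = trans (cong nodeAt (remQuot-combine {8} {B} b x)) (nodeAt-kind b x)

    vertex-number : ∀ u b {x} (x< : x < B) → toℕ u ≡ suc (B * toℕ b + x) → u ≡ vertex b (fromℕ< x<)
    vertex-number u b x< e = toℕ-injective (trans e (sym (trans (toℕ-vertex b (fromℕ< x<)) (cong (λ z → suc (B * toℕ b + z)) (toℕ-fromℕ< x<)))))

    suc-vertex : ∀ i → suc i ≡ vertex (proj₁ (remQuot {8} B i)) (proj₂ (remQuot {8} B i))
    suc-vertex i = cong suc (sym (combine-remQuot {8} B i))

    arcs⇒arc : ∀ u v → arcs u v → Arc incident′ (view u) (view v)
    arcs⇒arc zero zero (inj₁ (_ , n)) = contradiction refl n
    arcs⇒arc zero (suc v) (inj₁ _) = hub (subst (_≢ top) (sym (trans (cong view (suc-vertex v)) (view-vertex b x))) (not-top (kindAt b)))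
      where
      b = proj₁ (remQuot {8} B v)
      x = proj₂ (remQuot {8} B v)
      not-top : ∀ k → nodeOf k x ≢ top
      not-top (inj₁ _) ()
      not-top (inj₂ _) ()
    arcs⇒arc u v (inj₂ (x , x< , y , y< , i , j , u≡ , v≡ , h)) = subst₂ (Arc incident′)
      (sym (trans (cong view (vertex-number u i x< u≡)) (view-vertex i (fromℕ< x<))))
      (sym (trans (cong view (vertex-number v j y< v≡)) (view-vertex j (fromℕ< y<))))
      (between⇒arc (kindAt i) (kindAt j) (subst₂ (λ x y → ⟦ arcBetween (kindAt i) (kindAt j) ⟧ᶠ (w ∷ []) (x ∷ y ∷ []))
        (sym (toℕ-fromℕ< x<)) (sym (toℕ-fromℕ< y<)) h))

    arc⇒arcs : ∀ u v → Arc incident′ (view u) (view v) → arcs u v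
    arc⇒arcs zero zero (hub n) = contradiction refl n
    arc⇒arcs zero (suc v) _ = inj₁ (refl , λ ())
    arc⇒arcs (suc u) zero a = contradiction a
      (subst (λ n → ¬ Arc incident′ n top) (sym (trans (cong view (suc-vertex u)) (view-vertex b x))) (no-arc (kindAt b)))
      where
      b = proj₁ (remQuot {8} B u)
      x = proj₂ (remQuot {8} B u)
      no-arc : ∀ k → ¬ Arc incident′ (nodeOf k x) top
      no-arc (inj₁ _) ()
      no-arc (inj₂ _) ()
    arc⇒arcs (suc u) (suc v) a = inj₂ (toℕ x , toℕ<n x , toℕ y , toℕ<n y , i , j ,
      trans (cong toℕ (suc-vertex u)) (toℕ-vertex i x) , trans (cong toℕ (suc-vertex v)) (toℕ-vertex j y) ,
      arc⇒between (kindAt i) (kindAt j) (subst₂ (Arc incident′)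
        (trans (cong view (suc-vertex u)) (view-vertex i x)) (trans (cong view (suc-vertex v)) (view-vertex j y)) a))
      where
      i = proj₁ (remQuot {8} B u)
      x = proj₂ (remQuot {8} B u)
      j = proj₁ (remQuot {8} B v)
      y = proj₂ (remQuot {8} B v)

    adj⇒edge : ∀ {u v} → adj u v ≡ true → Edge incident′ (view u) (view v)
    adj⇒edge {u} {v} e = [ inj₁ ∘ arcs⇒arc u v , inj₂ ∘ arcs⇒arc v u ]′ (holds⇒ (w ∷ []) edgeF {toℕ v ∷ toℕ u ∷ []} (positive?-true e))

    edge⇒adj : ∀ {u v} → Edge incident′ (view u) (view v) → adj u v ≡ true
    edge⇒adj {u} {v} e = true-positive? (⇒holds (w ∷ []) edgeF {toℕ v ∷ toℕ u ∷ []} ([ inj₁ ∘ arc⇒arcs u v , inj₂ ∘ arc⇒arcs v u ]′ e))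

    open Reduction B incident′ adj (λ {u} {v} → adj⇒edge {u} {v}) (λ {u} {v} → edge⇒adj {u} {v}) public

  orderT : ∀ {Γ} → Tm 1 Γ
  orderT = lit 1 ⊕ lit 8 ⊗ ren [] sizeT

  instanceT : Out 1 0
  instanceT = for orderT (emit (lit 1)) ⊹ emit (lit 0) ⊹ for orderT (for orderT (emit (term edgeF))) ⊹ binaryT (lit 5 ⊗ sizeT)

  instanceT-encodes : ∀ w → ⟦ instanceT ⟧ᵒ (w ∷ []) [] ≡ encodeGraphNumber (graph w) (5 * ⟦ sizeT ⟧ (w ∷ []) [])
  instanceT-encodes w = cong₂ _++_ (forBelow-replicate n) (cong (false ∷_) (cong₂ _++_ matrix (⟦binaryT⟧ (lit 5 ⊗ sizeT) (w ∷ []) [])))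
    where
    n : ℕ
    n = order# (⟦ sizeT ⟧ (w ∷ []) [])
    entry# : ℕ → ℕ → Bool
    entry# u v = positive? (⟦ term edgeF ⟧ (w ∷ []) (v ∷ u ∷ []))
    matrix : forBelow n (λ u → forBelow n (λ v → entry# u v ∷ [])) ≡ concatMap (λ u → List.map (adj w u) (allFin n)) (allFin n)
    matrix = trans (forBelow-cong n λ u → forBelow-bits n (entry# u)) (forBelow-allFin n λ u → List.map (entry# u ∘ toℕ) (allFin n))

-- Reading an encoded instance digit by digit

digitOf-++ʳ : ∀ xs ys i → digitOf (xs ++ ys) (length xs + i) ≡ digitOf ys i
digitOf-++ʳ []           ys i = refl
digitOf-++ʳ (false ∷ xs) ys i = digitOf-++ʳ xs ys i
digitOf-++ʳ (true ∷ xs)  ys i = digitOf-++ʳ xs ys i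

digitOf-++ˡ : ∀ xs ys {i} → i < length xs → digitOf (xs ++ ys) i ≡ digitOf xs i
digitOf-++ˡ (false ∷ xs) ys {zero}  _         = refl
digitOf-++ˡ (true ∷ xs)  ys {zero}  _         = refl
digitOf-++ˡ (false ∷ xs) ys {suc i} (s≤s i<n) = digitOf-++ˡ xs ys i<n
digitOf-++ˡ (true ∷ xs)  ys {suc i} (s≤s i<n) = digitOf-++ˡ xs ys i<n

digitOf-replicate : ∀ n ys {i} → i < n → digitOf (replicate n true ++ ys) i ≡ 2
digitOf-replicate (suc n) ys {zero}  _         = refl
digitOf-replicate (suc n) ys {suc i} (s≤s i<n) = digitOf-replicate n ys i<n

digitOf-tabulate : ∀ {n} (g : Fin n → Bool) i → digitOf (List.tabulate g) (toℕ i) ≡ suc (number (g i))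
digitOf-tabulate g zero with g zero
... | true  = refl
... | false = refl
digitOf-tabulate g (suc i) with g zero
... | true  = digitOf-tabulate (g ∘ suc) i
... | false = digitOf-tabulate (g ∘ suc) i

concat-length : ∀ {n} m (f : Fin m → Word) → (∀ u → length (f u) ≡ n) → length (List.concat (List.tabulate f)) ≡ m * n
concat-length zero    f e = refl
concat-length (suc m) f e = trans (length-++ (f zero)) (cong₂ _+_ (e zero) (concat-length m (f ∘ suc) (e ∘ suc)))

digitOf-concat : ∀ {n} m (f : Fin m → Word) → (∀ u → length (f u) ≡ n) → ∀ ys u {v} → v < n →
                 digitOf (List.concat (List.tabulate f) ++ ys) (n * toℕ u + v) ≡ digitOf (f u) v
digitOf-concat {n} (suc m) f e ys zero {v} v<n
  rewrite *-zeroʳ n | ++-assoc (f zero) (List.concat (List.tabulate (f ∘ suc))) ys =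
  digitOf-++ˡ (f zero) _ (subst (v <_) (sym (e zero)) v<n)
digitOf-concat {n} (suc m) f e ys (suc u) {v} v<n
  rewrite ++-assoc (f zero) (List.concat (List.tabulate (f ∘ suc))) ys = trans
  (cong (digitOf (f zero ++ rest)) (trans (cong (_+ v) (*-suc n (toℕ u))) (trans (+-assoc n (n * toℕ u) v) (cong (_+ _) (sym (e zero))))))
  (trans (digitOf-++ʳ (f zero) rest (n * toℕ u + v)) (digitOf-concat m (f ∘ suc) (e ∘ suc) ys u v<n))
  where rest = List.concat (List.tabulate (f ∘ suc)) ++ ys

rowsOf : ∀ {n} → (Fin n → Fin n → Bool) → Word
rowsOf a = List.concat (List.tabulate λ u → List.tabulate (a u))

rows≡ : ∀ {n} (a : Fin n → Fin n → Bool) → concatMap (λ u → List.map (a u) (allFin n)) (allFin n) ≡ rowsOf a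
rows≡ {n} a = cong List.concat (trans (map-tabulate {n = n} id (λ u → List.map (a u) (allFin n)))
  (tabulate-cong λ u → map-tabulate {n = n} id (a u)))

encode≡ : ∀ G k → let open Graph G in
  encodeGraphNumber G k ≡ replicate order true ++ false ∷ rowsOf adj ++ binary (ℕᵇ.fromℕ k)
encode≡ G k = cong (λ r → replicate order true ++ false ∷ r ++ binary (ℕᵇ.fromℕ k)) (rows≡ adj)
  where open Graph G

module _ (G : Graph) (k : ℕ) where
  open Graph G

  encode-order : ∀ {i} → i < order → digitOf (encodeGraphNumber G k) i ≡ 2
  encode-order = digitOf-replicate order _

  private
    after-order : ∀ ys i → digitOf (replicate order true ++ ys) (order + i) ≡ digitOf ys i
    after-order ys i = trans (cong (λ n → digitOf (replicate order true ++ ys) (n + i)) (sym (length-replicate order)))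
      (digitOf-++ʳ (replicate order true) ys i)

    tabulate-length : ∀ u → length (List.tabulate (adj u)) ≡ order
    tabulate-length u = length-tabulate (adj u)

  encode-terminator : digitOf (encodeGraphNumber G k) order ≡ 1
  encode-terminator = trans (cong (digitOf (encodeGraphNumber G k)) (sym (+-identityʳ order))) (after-order _ 0)

  encode-entry : ∀ u v → digitOf (encodeGraphNumber G k) (order + suc (order * toℕ u + toℕ v)) ≡ suc (number (adj u v))
  encode-entry u v = trans (cong (λ w → digitOf w (order + suc (order * toℕ u + toℕ v))) (encode≡ G k)) (trans (after-order _ _)
    (trans (digitOf-concat order (λ u → List.tabulate (adj u)) tabulate-length (binary (ℕᵇ.fromℕ k)) u (toℕ<n v))
      (digitOf-tabulate (adj u) v)))

  prefix-length : length (replicate order true ++ false ∷ rowsOf adj) ≡ order + suc (order * order)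
  prefix-length = trans (length-++ (replicate order true)) (cong₂ (λ a b → a + suc b) (length-replicate order)
    (concat-length order (λ u → List.tabulate (adj u)) tabulate-length))

  encode-split : encodeGraphNumber G k ≡ (replicate order true ++ false ∷ rowsOf adj) ++ binary (ℕᵇ.fromℕ k)
  encode-split = trans (encode≡ G k) (sym (++-assoc (replicate order true) (false ∷ rowsOf adj) _))

  encode-number : ∀ i → digitOf (encodeGraphNumber G k) (order + suc (order * order) + i) ≡ digitOf (binary (ℕᵇ.fromℕ k)) i
  encode-number i = trans (cong₂ digitOf encode-split (cong (_+ i) (sym prefix-length))) (digitOf-++ʳ (replicate order true ++ false ∷ rowsOf adj) _ i)

  encode-length : length (encodeGraphNumber G k) ≡ order + suc (order * order) + length (binary (ℕᵇ.fromℕ k))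
  encode-length = trans (cong length encode-split) (trans (length-++ (replicate order true ++ false ∷ rowsOf adj))
    (cong (_+ length (binary (ℕᵇ.fromℕ k))) prefix-length))

unbinary : Word → ℕᵇ
unbinary []          = ℕᵇ.zero
unbinary (true ∷ w)  = 2[1+ unbinary w ]
unbinary (false ∷ w) = 1+[2 unbinary w ]

unbinary-binary : ∀ b → unbinary (binary b) ≡ b
unbinary-binary ℕᵇ.zero  = refl
unbinary-binary 2[1+ b ] = cong 2[1+_] (unbinary-binary b)
unbinary-binary 1+[2 b ] = cong 1+[2_] (unbinary-binary b)

binary-unbinary : ∀ w → binary (unbinary w) ≡ w
binary-unbinary []          = refl
binary-unbinary (true ∷ w)  = cong (true ∷_) (binary-unbinary w)
binary-unbinary (false ∷ w) = cong (false ∷_) (binary-unbinary w)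

-- The value 0 beyond the end lets the digits determine the length as well.
digitOf-ext : ∀ v w → (∀ i → digitOf v i ≡ digitOf w i) → v ≡ w
digitOf-ext []          []          e = refl
digitOf-ext []          (false ∷ w) e = contradiction (e 0) λ ()
digitOf-ext []          (true ∷ w)  e = contradiction (e 0) λ ()
digitOf-ext (false ∷ v) []          e = contradiction (e 0) λ ()
digitOf-ext (true ∷ v)  []          e = contradiction (e 0) λ ()
digitOf-ext (false ∷ v) (false ∷ w) e = cong (false ∷_) (digitOf-ext v w (e ∘ suc))
digitOf-ext (true ∷ v)  (true ∷ w)  e = cong (true ∷_) (digitOf-ext v w (e ∘ suc))
digitOf-ext (false ∷ v) (true ∷ w)  e = contradiction (e 0) λ ()
digitOf-ext (true ∷ v)  (false ∷ w) e = contradiction (e 0) λ ()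

-- Equal codes make the adjacency functions agree pointwise, which falls short of identifying the
-- graphs.
record SameGraph (G H : Graph) : Set where
  field
    order≡ : Graph.order G ≡ Graph.order H
    adj≡   : ∀ u v → Graph.adj G u v ≡ Graph.adj H (subst Fin order≡ u) (subst Fin order≡ v)

-- The terminator is the first digit 1 and so fixes the order; after that every matrix entry and
-- every digit of the number has a known place.
encode-injective : ∀ G H {k l} → encodeGraphNumber G k ≡ encodeGraphNumber H l → SameGraph G H × k ≡ l
encode-injective G H {k} {l} e with <-cmp (Graph.order G) (Graph.order H)
... | tri< lt _ _ = contradiction (trans (sym (encode-terminator G k)) (trans (cong (λ w → digitOf w (Graph.order G)) e) (encode-order H l lt))) λ ()
... | tri> _ _ gt = contradiction (trans (sym (encode-terminator H l)) (trans (cong (λ w → digitOf w (Graph.order H)) (sym e)) (encode-order G k gt))) λ ()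
encode-injective G@(record { order = n ; adj = a }) H@(record { order = .n ; adj = b }) {k} {l} e | tri≈ _ refl _ =
  record { order≡ = refl ; adj≡ = λ u v → number-injective (suc-injective
    (trans (sym (encode-entry G k u v)) (trans (cong (λ w → digitOf w (n + suc (n * toℕ u + toℕ v))) e) (encode-entry H l u v)))) } ,
  ℕᵇ.fromℕ-injective (trans (sym (unbinary-binary _)) (trans (cong unbinary (digitOf-ext _ _ λ i →
    trans (sym (encode-number G k i)) (trans (cong (λ w → digitOf w (n + suc (n * n) + i)) e) (encode-number H l i)))) (unbinary-binary _)))

-- The set is transferred through its middle vertices, which are described by adjacency alone; no
-- shortest path has to be transported.
strong-transfer : ∀ {G H} → SameGraph G H → (∀ u v → Near G u v) → (∀ u v → Near H u v) → ∀ {k} →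
  (∃[ S ] StrongGeodeticSet G S × ∣ S ∣ ≤ k) → ∃[ S ] StrongGeodeticSet H S × ∣ S ∣ ≤ k
strong-transfer {G@(record { order = n })} {H@(record { order = .n })} record { order≡ = refl ; adj≡ = adj≡ } nearG nearH (S , strong , small) =
  let (mid , middle) = strong⇒middle G nearG strong in
  S , middle⇒strong H nearH {mid = mid} (λ x x∉ →
    let (u , v , u∈ , v∈ , u<v , ¬e , e , f , m) = middle x x∉
    in u , v , u∈ , v∈ , u<v , (λ g → ¬e (trans (adj≡ u v) g)) , trans (sym (adj≡ u x)) e , trans (sym (adj≡ x v)) f , m) , small

polyTime₁ : (o : Out 1 0) → PolyTime {1} (λ ws → ⟦ o ⟧ᵒ (Vec.head ws ∷ []) [])
polyTime₁ o = let (M , p , runs) = polyTime o in M , p , λ { (w ∷ []) → runs (w ∷ []) }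

Class : Graph → Set
Class G = Chordal G × HasDiameter G 2

Problem : DecisionProblem
Problem = StrongGeodetic Class

-- Assembling the reduction

module Hardness (L : Language) (V : Vec Word 2 → Word) (M : Machine 2) (time : Polynomial)
  (runs : ∀ ws → ∃[ t ] ∃[ d ] Machine._⇓[_]_ M (Machine.initial M ws) t d × t ≤ eval time (size ws) × Machine.output M d ≡ V ws)
  (certificate : Polynomial)
  (L⇔ : ∀ w → L w ⇔ (∃[ y ] length y ≤ eval certificate (length w) × V (w ∷ y ∷ []) ≡ true ∷ [])) where
  open Simulation V certificate time M runs using (accepted⇔satisfiable; D≥2)
  open CookLevin M certificate time using (total; incidence; enc; ruleIndex; T#; P#; B#)
  open EdgeFormula total incidence using (instanceT; instanceT-encodes; graph; chordal; near; diameter; strong⇔satisfiable)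

  abstract
    f : Word → Word
    f w = ⟦ instanceT ⟧ᵒ (w ∷ []) []

    computable : PolyTime {1} (λ ws → f (Vec.head ws))
    computable = polyTime₁ instanceT

    encodes : ∀ w → encodeGraphNumber (graph w) (5 * B# w) ≡ f w
    encodes w = sym (instanceT-encodes w)

  -- Time 0, position 0 and some rule. Two leaves at this index are at distance 2, and the
  -- positivity of `k` also rests on it.
  x₀ : ∀ w → Fin (B# w)
  x₀ w = enc w (fromℕ< {0} positive) (fromℕ< {0} (≤-trans positive (m≤m+n (T# w) (T# w)))) (ruleIndex CookLevin.startState)
    where
    positive : 0 < T# w
    positive = ≤-trans (s≤s z≤n) (D≥2 w)

  problem : Word → StrongGeodeticInstance Class
  problem w = record
    { graph = graph w ; connected = near⇒connected (graph w) (near w) ; inClass = chordal w , diameter w (x₀ w)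
    ; k = 5 * B# w ; positive = ≤-trans (≤-trans (s≤s z≤n) (toℕ<n (x₀ w))) (m≤n*m (B# w) 5) }

  solvable : ∀ w → (∃[ S ] StrongGeodeticSet (graph w) S × ∣ S ∣ ≤ 5 * B# w) ⇔ L w
  solvable w = mk⇔
    (λ y → Equivalence.from (L⇔ w) (Equivalence.from (accepted⇔satisfiable w) (Equivalence.to (strong⇔satisfiable w (x₀ w)) y)))
    (λ l → Equivalence.from (strong⇔satisfiable w (x₀ w)) (Equivalence.to (accepted⇔satisfiable w) (Equivalence.to (L⇔ w) l)))

  -- `f w` lies in the language as soon as any instance with this code is solvable; injectivity of
  -- the encoding leads back to `problem w`.
  back : ∀ w (i : StrongGeodeticInstance Class) →
    encodeGraphNumber (StrongGeodeticInstance.graph i) (StrongGeodeticInstance.k i) ≡ f w →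
    (∃[ S ] StrongGeodeticSet (StrongGeodeticInstance.graph i) S × ∣ S ∣ ≤ StrongGeodeticInstance.k i) → L w
  back w i e y =
    let open StrongGeodeticInstance i renaming (graph to G; k to k′)
        (same , k≡) = encode-injective G (graph w) (trans e (sym (encodes w)))
    in Equivalence.to (solvable w) (strong-transfer same (diameter⇒near G (proj₂ inClass)) (near w)
         (subst (λ k → ∃[ S ] StrongGeodeticSet G S × ∣ S ∣ ≤ k) k≡ y))

  encoded : ∀ w → ∃[ i ] DecisionProblem.encode Problem i ≡ f w × (L w → DecisionProblem.Yes Problem i)
  encoded w = problem w , encodes w , Equivalence.from (solvable w)

  correct : ∀ w → (∃[ i ] DecisionProblem.encode Problem i ≡ f w) × (L w ⇔ DecisionProblem.language Problem (f w))
  correct w = let (i , e , solution) = encoded w in (i , e) , mk⇔ (λ l → i , e , solution l) (λ (i , e , y) → back w i e y)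

hard : NPHard Problem
hard L (V , (M , time , runs) , certificate , L⇔) = f , computable , correct
  where open Hardness L V M time runs certificate L⇔

-- Chordality by separation

module _ {n : ℕ} {Step : Fin n → Fin n → Set} (Step? : ∀ x y → Dec (Step x y)) where

  record Trail (x y : Fin n) (l : ℕ) : Set where
    constructor trail
    field
      at     : ℕ → Fin n
      starts : at 0 ≡ x
      ends   : at l ≡ y
      steps  : ∀ t → t < l → Step (at t) (at (suc t))

  extend : ∀ {x y z l} → Trail x y l → Step y z → Trail x z (suc l)
  extend {x} {y} {z} {l} (trail at s e st) yz = trail at′ (trans (early z≤n) s) late steps′
    where
    at′ : ℕ → Fin n
    at′ t with t ≤? l
    ... | yes _ = at t
    ... | no _  = z
    early : ∀ {t} → t ≤ l → at′ t ≡ at t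
    early {t} t≤l with t ≤? l
    ... | yes _ = refl
    ... | no ≰  = contradiction t≤l ≰
    late : at′ (suc l) ≡ z
    late with suc l ≤? l
    ... | yes p = contradiction p (<-irrefl refl)
    ... | no _  = refl
    steps′ : ∀ t → t < suc l → Step (at′ t) (at′ (suc t))
    steps′ t (s≤s t≤l) with t ≟ l
    ... | yes refl = subst₂ Step (sym (trans (early ≤-refl) e)) (sym late) yz
    ... | no t≢l   = subst₂ Step (sym (early t≤l)) (sym (early (≤∧≢⇒< t≤l t≢l))) (st t (≤∧≢⇒< t≤l t≢l))

  insert-size : ∀ {k} (S : Subset k) {x} → x ∉ˢ S → ∣ S Vec.[ x ]≔ true ∣ ≡ suc ∣ S ∣
  insert-size (true ∷ S)  {zero}  x∉ = contradiction here x∉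
  insert-size (false ∷ S) {zero}  x∉ = refl
  insert-size (true ∷ S)  {suc x} x∉ = cong suc (insert-size S (x∉ ∘ there))
  insert-size (false ∷ S) {suc x} x∉ = insert-size S (x∉ ∘ there)

  Reachable : Fin n → Subset n → Set
  Reachable b S = ∀ x → x ∈ˢ S → ∃ (Trail b x)

  -- `grow` adds a vertex as long as some step leaves the set. Sizes are at most `n`, so the fuel
  -- lasts until the set is closed.
  closure : ∀ b → ∃[ S ] b ∈ˢ S × (∀ x z → x ∈ˢ S → Step x z → z ∈ˢ S) × Reachable b S
  closure b = grow n (Vec.replicate n false Vec.[ b ]≔ true) (m≤m+n n _) ([]≔-updates (Vec.replicate n false) b) single
    where
    single : Reachable b (Vec.replicate n false Vec.[ b ]≔ true)
    single x x∈ with x 𝔽.≟ b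
    ... | yes refl = 0 , trail (λ _ → x) refl refl λ _ ()
    ... | no x≢b   = contradiction (trans (sym ([]=⇒lookup x∈)) (trans (lookup∘updateAt′ x b x≢b (Vec.replicate n false)) (lookup-replicate x false))) λ ()
    grow : ∀ fuel S → n ≤ fuel + ∣ S ∣ → b ∈ˢ S → Reachable b S →
           ∃[ S ] b ∈ˢ S × (∀ x z → x ∈ˢ S → Step x z → z ∈ˢ S) × Reachable b S
    grow fuel S h b∈ reach with 𝔽.any? (λ x → 𝔽.any? λ z → (x ∈? S) ×-dec (¬? (z ∈? S) ×-dec Step? x z))
    ... | no none = S , b∈ , (λ x z x∈ xz → case z ∈? S of λ
          { (yes z∈) → z∈ ; (no z∉) → contradiction (x , z , x∈ , z∉ , xz) none }) , reach
    grow zero S h b∈ reach | yes (x , z , x∈ , z∉ , xz) = contradiction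
      (≤-trans (s≤s h) (≤-trans (≤-reflexive (sym (insert-size S z∉))) (∣p∣≤n (S Vec.[ z ]≔ true)))) (<-irrefl refl)
    grow (suc fuel) S h b∈ reach | yes (x , z , x∈ , z∉ , xz) = grow fuel (S Vec.[ z ]≔ true)
      (≤-trans h (≤-reflexive (trans (sym (+-suc fuel ∣ S ∣)) (cong (fuel +_) (sym (insert-size S z∉)))))) (kept b∈) reach′
      where
      kept : ∀ {y} → y ∈ˢ S → y ∈ˢ (S Vec.[ z ]≔ true)
      kept {y} y∈ with y 𝔽.≟ z
      ... | yes refl = contradiction y∈ z∉
      ... | no y≢z   = []≔-minimal S y z y≢z y∈
      reach′ : Reachable b (S Vec.[ z ]≔ true)
      reach′ y y∈ with y 𝔽.≟ z
      ... | yes refl = let (l , p) = reach x x∈ in suc l , extend p xz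
      ... | no y≢z   = reach y (lookup⇒[]= y S (trans (sym (lookup∘updateAt′ y z y≢z S)) ([]=⇒lookup y∈)))

-- Separators and induced cycles

module _ (G : Graph) where
  open Graph G

  Beside : Vertex → Vertex → Vertex → Set
  Beside a c z = z ≡ c ⊎ (z ≢ a × ¬ Adj a z)

  Step : Vertex → Vertex → Vertex → Vertex → Set
  Step a c x z = Adj x z × Beside a c z

  Step? : ∀ a c x z → Dec (Step a c x z)
  Step? a c x z = Adj? G x z ×-dec ((z 𝔽.≟ c) ⊎-dec (¬? (z 𝔽.≟ a) ×-dec ¬? (Adj? G a z)))

  -- So no path from b to c avoids the rest of the closed neighbourhood of a.
  Separates : (Vertex → Set) → Vertex → Vertex → Vertex → Set
  Separates Y a b c = Y b × ¬ Y c × (∀ x z → Y x → Step a c x z → Y z)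

  -- A shortest trail from b to c would close up, with a, to an induced cycle.
  no-trail : Chordal G → ∀ {a b c} → Adj a b → Adj a c → b ≢ c → ¬ Adj b c → ∀ l → ¬ Trail (Step? a c) b c l
  no-trail chordal {a} {b} {c} ab ac b≢c ¬bc = <-rec (λ l → ¬ Trail (Step? a c) b c l) body
    where
    body : ∀ l → (∀ {k} → k < l → ¬ Trail (Step? a c) b c k) → ¬ Trail (Step? a c) b c l
    body l shorter (trail p p0 pl steps) = chordal (2 + l) (4≤ l refl) (cyc , cyc-injective , λ s t → mk⇔ (cyclic s t) (joined s t))
      where
      -- A chord replaces `suc (suc d)` steps by a single one. The vertex it leads to was already
      -- the end of a step, so it is still an admissible one.
      no-chord : ∀ i d → suc i + suc d ≤ l → ¬ Adj (p i) (p (suc i + suc d))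
      no-chord i d j≤l e = shorter l′<l (trail q (trans (early z≤n) p0) (trans (late i<l′) (trans (cong p (m∸n+n≡m d≤l)) pl)) steps′)
        where
        l′ = l ∸ suc d
        d≤l : suc d ≤ l
        d≤l = ≤-trans (m≤n+m (suc d) (suc i)) j≤l
        l′<l : l′ < l
        l′<l = ∸-monoʳ-< (s≤s z≤n) d≤l
        i<l′ : i < l′
        i<l′ = ≤-trans (≤-reflexive (sym (m+n∸n≡m (suc i) (suc d)))) (∸-monoˡ-≤ (suc d) j≤l)
        q : ℕ → Vertex
        q t with t ≤? i
        ... | yes _ = p t
        ... | no _  = p (t + suc d)
        early : ∀ {t} → t ≤ i → q t ≡ p t
        early {t} h with t ≤? i
        ... | yes _ = refl
        ... | no n  = contradiction h n
        late : ∀ {t} → i < t → q t ≡ p (t + suc d)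
        late {t} h with t ≤? i
        ... | yes t≤ = contradiction t≤ (<⇒≱ h)
        ... | no _   = refl
        inside-l : ∀ {t} → t < l′ → t + suc d < l
        inside-l {t} t< = ≤-trans (+-monoˡ-≤ (suc d) t<) (≤-reflexive (m∸n+n≡m d≤l))
        steps′ : ∀ t → t < l′ → Step a c (q t) (q (suc t))
        steps′ t t<l′ with <-cmp t i
        ... | tri< t<i _ _  = subst₂ (Step a c) (sym (early (<⇒≤ t<i))) (sym (early t<i)) (steps t (<-trans t<l′ l′<l))
        ... | tri≈ _ refl _ = subst₂ (Step a c) (sym (early ≤-refl)) (sym (late ≤-refl))
                                (e , proj₂ (subst (λ j → Step a c (p (t + suc d)) (p j)) refl (steps (t + suc d) (inside-l t<l′))))
        ... | tri> _ _ i<t  = subst₂ (Step a c) (sym (late i<t)) (sym (late (m≤n⇒m≤1+n i<t))) (steps (t + suc d) (inside-l t<l′))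

      step-adj : ∀ {t} → t < l → Adj (p t) (p (suc t))
      step-adj {t} t<l = proj₁ (steps t t<l)

      nonadjacent : ∀ {i j} → suc i < j → j ≤ l → ¬ Adj (p i) (p j)
      nonadjacent {i} {j} i<j j≤l e = no-chord i (j ∸ suc (suc i)) (≤-trans (≤-reflexive j≡) j≤l) (subst (λ j → Adj (p i) (p j)) (sym j≡) e)
        where
        j≡ : suc i + suc (j ∸ suc (suc i)) ≡ j
        j≡ = trans (+-suc (suc i) _) (m+[n∸m]≡n i<j)

      -- A repetition yields a chord: go one step on from the later occurrence or, if that is the
      -- end of the trail, one step back from the earlier one. What remains is `p 0 ≡ p l`, that is
      -- `b ≡ c`.
      distinct : ∀ {i j} → i < j → j ≤ l → p i ≢ p j
      distinct {i} {j} i<j j≤l e with j ≟ l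
      ... | no j≢l = nonadjacent {i} {suc j} (s≤s i<j) (≤∧≢⇒< j≤l j≢l) (subst (λ x → Adj x (p (suc j))) (sym e) (step-adj (≤∧≢⇒< j≤l j≢l)))
      distinct {zero}  {j} i<j j≤l e | yes refl = b≢c (trans (sym p0) (trans e pl))
      distinct {suc i} {j} i<j j≤l e | yes refl = nonadjacent {i} i<j ≤-refl (subst (Adj (p i)) e (step-adj (<-trans (n<1+n i) i<j)))

      -- By distinctness an inner vertex is not `c`, so the exception made for `c` in `Beside` does
      -- not apply to it.
      outside-a : ∀ {t} → 0 < t → t < l → p t ≢ a × ¬ Adj a (p t)
      outside-a {suc t} _ t<l with proj₂ (steps t (<-trans (n<1+n t) t<l))
      ... | inj₁ e = contradiction (trans e (sym pl)) (distinct t<l ≤-refl)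
      ... | inj₂ h = h

      4≤ : ∀ k → k ≡ l → 4 ≤ 2 + k
      4≤ zero          refl = contradiction (trans (sym p0) pl) b≢c
      4≤ (suc zero)    refl = contradiction (subst₂ Adj p0 pl (step-adj (s≤s z≤n))) ¬bc
      4≤ (suc (suc k)) _    = s≤s (s≤s (s≤s (s≤s z≤n)))

      cyc : Fin (2 + l) → Vertex
      cyc zero    = a
      cyc (suc t) = p (toℕ t)

      bounded-by-l : ∀ (t : Fin (suc l)) → toℕ t ≤ l
      bounded-by-l t = ≤-pred (toℕ<n t)

      a≢p : ∀ (t : Fin (suc l)) → a ≢ p (toℕ t)
      a≢p t e with toℕ t ≟ 0 | toℕ t ≟ l
      ... | yes t≡0 | _       = Adj-irrefl G ab (trans e (trans (cong p t≡0) p0))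
      ... | no _    | yes t≡l = Adj-irrefl G ac (trans e (trans (cong p t≡l) pl))
      ... | no t≢0  | no t≢l  = proj₁ (outside-a (n≢0⇒n>0 t≢0) (≤∧≢⇒< (bounded-by-l t) t≢l)) (sym e)

      cyc-injective : Injective _≡_ _≡_ cyc
      cyc-injective {zero}  {zero}  _ = refl
      cyc-injective {zero}  {suc t} e = contradiction e (a≢p t)
      cyc-injective {suc s} {zero}  e = contradiction (sym e) (a≢p s)
      cyc-injective {suc s} {suc t} e with <-cmp (toℕ s) (toℕ t)
      ... | tri< lt _ _ = contradiction e (distinct lt (bounded-by-l t))
      ... | tri≈ _ eq _ = cong suc (toℕ-injective eq)
      ... | tri> _ _ gt = contradiction (sym e) (distinct gt (bounded-by-l s))

      to-a : ∀ (t : Fin (suc l)) → Adj a (p (toℕ t)) → toℕ t ≡ 0 ⊎ toℕ t ≡ l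
      to-a t e with toℕ t ≟ 0 | toℕ t ≟ l
      ... | yes t≡0 | _       = inj₁ t≡0
      ... | no _    | yes t≡l = inj₂ t≡l
      ... | no t≢0  | no t≢l  = contradiction e (proj₂ (outside-a (n≢0⇒n>0 t≢0) (≤∧≢⇒< (bounded-by-l t) t≢l)))

      along : ∀ (s t : Fin (suc l)) → Adj (p (toℕ s)) (p (toℕ t)) → toℕ s < toℕ t → toℕ t ≡ suc (toℕ s)
      along s t e lt with toℕ t ≟ suc (toℕ s)
      ... | yes eq = eq
      ... | no ne  = contradiction e (nonadjacent (≤∧≢⇒< lt (ne ∘ sym)) (bounded-by-l t))

      cyclic : ∀ s t → Adj (cyc s) (cyc t) → CyclicSuc G s t ⊎ CyclicSuc G t s
      cyclic zero    zero    e = contradiction refl (Adj-irrefl G e)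
      cyclic zero    (suc t) e = [ (λ t≡0 → inj₁ (inj₁ (cong suc t≡0))) , (λ t≡l → inj₂ (inj₂ (cong (2 +_) t≡l , refl))) ]′ (to-a t e)
      cyclic (suc s) zero    e = [ (λ s≡0 → inj₂ (inj₁ (cong suc s≡0))) , (λ s≡l → inj₁ (inj₂ (cong (2 +_) s≡l , refl))) ]′ (to-a s (Adj-sym G e))
      cyclic (suc s) (suc t) e with <-cmp (toℕ s) (toℕ t)
      ... | tri< lt _ _ = inj₁ (inj₁ (cong suc (along s t e lt)))
      ... | tri≈ _ eq _ = contradiction (cong p eq) (Adj-irrefl G e)
      ... | tri> _ _ gt = inj₂ (inj₁ (cong suc (along t s (Adj-sym G e) gt)))

      from-suc : ∀ s t → CyclicSuc G s t → Adj (cyc s) (cyc t)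
      from-suc zero    (suc t) (inj₁ e) = subst (Adj a) (sym (trans (cong p (suc-injective e)) p0)) ab
      from-suc zero    _       (inj₂ (() , _))
      from-suc (suc s) (suc t) (inj₁ e) = subst (λ x → Adj (p (toℕ s)) (p x)) (sym (suc-injective e))
        (step-adj (≤-trans (≤-reflexive (sym (suc-injective e))) (bounded-by-l t)))
      from-suc (suc s) zero    (inj₂ (e , _)) = Adj-sym G (subst (Adj a) (sym (trans (cong p (suc-injective (suc-injective e))) pl)) ac)
      from-suc (suc s) (suc t) (inj₂ (_ , ()))

      joined : ∀ s t → CyclicSuc G s t ⊎ CyclicSuc G t s → Adj (cyc s) (cyc t)
      joined s t = [ from-suc s t , Adj-sym G ∘ from-suc t s ]′

  chordal⇒separated : Chordal G → ∀ a b c → Adj a b → Adj a c → b ≢ c → ¬ Adj b c → ∃[ S ] Separates (_∈ˢ S) a b c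
  chordal⇒separated chordal a b c ab ac b≢c ¬bc =
    let (S , b∈ , closed , reach) = closure (Step? a c) b in
    S , b∈ , (λ c∈ → let (l , t) = reach c c∈ in no-trail chordal ab ac b≢c ¬bc l t) , closed

  -- Let `b` and `c` be the neighbours of `a` on an induced cycle. The rest of the cycle avoids the
  -- closed neighbourhood of `a`, so walking along it from `b` carries `Y` to `c`.
  separated⇒chordal : (∀ a b c → Adj a b → Adj a c → b ≢ c → ¬ Adj b c → Σ (Vertex → Set) λ Y → Separates Y a b c) → Chordal G
  separated⇒chordal sep .(4 + m) (s≤s (s≤s (s≤s (s≤s {n = m} z≤n)))) (f , inj , cyc) = c∉ (walk (2 + m) ≤-refl)
    where
    vertex# : ∀ i → i < 4 + m → Vertex
    vertex# i lt = f (fromℕ< lt)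
    last< : 3 + m < 4 + m
    last< = ≤-refl
    a b c : Vertex
    a = f zero
    b = f (suc zero)
    c = vertex# (3 + m) last<
    last≡ : toℕ (fromℕ< last<) ≡ 3 + m
    last≡ = toℕ-fromℕ< last<
    not-cyclic : ∀ {i j : Fin (4 + m)} → suc (toℕ i) ≢ toℕ j → suc (toℕ j) ≢ toℕ i →
                 (toℕ i ≡ 0 → toℕ j ≢ 3 + m) → (toℕ j ≡ 0 → toℕ i ≢ 3 + m) → ¬ Adj (f i) (f j)
    not-cyclic {i} {j} n₁ n₂ n₃ n₄ e with Equivalence.to (cyc i j) e
    ... | inj₁ (inj₁ p)        = n₁ (sym p)
    ... | inj₁ (inj₂ (p , q))  = n₄ q (suc-injective p)
    ... | inj₂ (inj₁ p)        = n₂ (sym p)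
    ... | inj₂ (inj₂ (p , q))  = n₃ q (suc-injective p)
    S = sep a b c (Equivalence.from (cyc zero (suc zero)) (inj₁ (inj₁ refl)))
      (Equivalence.from (cyc zero _) (inj₂ (inj₂ (cong suc last≡ , refl))))
      (λ e → contradiction (trans (cong toℕ (inj e)) last≡) λ ())
      (not-cyclic (λ e → contradiction (trans e last≡) λ ()) (λ e → contradiction (trans (sym (cong suc last≡)) e) λ ()) (λ ())
        (λ e → contradiction (trans (sym last≡) e) λ ()))
    Y = proj₁ S
    c∉ = proj₁ (proj₂ (proj₂ S))
    closed = proj₂ (proj₂ (proj₂ S))
    walk : ∀ i (lt : suc i < 4 + m) → Y (vertex# (suc i) lt)
    walk zero    lt = subst (Y ∘ f) (toℕ-injective (sym (toℕ-fromℕ< lt))) (proj₁ (proj₂ S))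
    walk (suc i) lt = closed _ _ (walk i (<-trans (n<1+n _) lt))
      (Equivalence.from (cyc _ _) (inj₁ (inj₁ (trans (toℕ-fromℕ< lt) (cong suc (sym (toℕ-fromℕ< (<-trans (n<1+n _) lt))))))) , beside)
      where
      z≡ : toℕ (fromℕ< lt) ≡ 2 + i
      z≡ = toℕ-fromℕ< lt
      beside : Beside a c (vertex# (2 + i) lt)
      beside with 2 + i ≟ 3 + m
      ... | yes e = inj₁ (cong f (toℕ-injective (trans z≡ (trans e (sym last≡)))))
      ... | no ne = inj₂ ((λ e → contradiction (trans (sym z≡) (cong toℕ (inj e))) λ ()) ,
              not-cyclic (λ e → contradiction (trans e z≡) λ ()) (λ e → contradiction (trans (sym (cong suc z≡)) e) λ ())
                (λ _ e → ne (trans (sym z≡) e)) (λ e → contradiction (trans (sym z≡) e) λ ()))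

-- The verifier

pattern v0 = zero
pattern v1 = suc v0
pattern v2 = suc v1
pattern v3 = suc v2
pattern v4 = suc v3

module _ {Γ : ℕ} where

  entryF : Tm 2 Γ → Tm 2 Γ → Tm 2 Γ → Fm 2 Γ
  entryF n u v = digit zero (n ⊕ (lit 1 ⊕ (n ⊗ u ⊕ v))) ≡ᶠ lit 2

  -- The certificate is a table of three predicates of four vertices each.
  tableF : ℕ → Tm 2 Γ → Tm 2 Γ → Tm 2 Γ → Tm 2 Γ → Tm 2 Γ → Fm 2 Γ
  tableF tag n a b c d = digit (suc zero)
    (n ⊗ (n ⊗ (n ⊗ n)) ⊗ lit tag ⊕ (n ⊗ (n ⊗ n) ⊗ a ⊕ (n ⊗ n ⊗ b ⊕ (n ⊗ c ⊕ d)))) ≡ᶠ lit 2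

  selectedF : Tm 2 Γ → Tm 2 Γ → Fm 2 Γ
  selectedF n x = tableF 0 n (lit 0) (lit 0) (lit 0) x

  middleF : Tm 2 Γ → Tm 2 Γ → Tm 2 Γ → Tm 2 Γ → Fm 2 Γ
  middleF n u v x = tableF 1 n (lit 0) u v x

  separatorF : Tm 2 Γ → Tm 2 Γ → Tm 2 Γ → Tm 2 Γ → Tm 2 Γ → Fm 2 Γ
  separatorF = tableF 2

  prefixT : Tm 2 Γ → Tm 2 Γ
  prefixT n = n ⊕ (lit 1 ⊕ n ⊗ n)

private
  ν : ∀ {Γ} → Fin Γ → Tm 2 Γ
  ν = var

shapeF symmetricF irreflexiveF nearF farF chordalF coveredF functionalF smallF : Fm 2 1
-- The strict inequality makes the numeral nonempty, which in bijective notation means that its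
-- value is positive.
shapeF       = ∀ᶠ (ν v0) (digit zero (ν v0) ≡ᶠ lit 2) ∧ᶠ digit zero (ν v0) ≡ᶠ lit 1 ∧ᶠ prefixT (ν v0) <ᶠᵐ len zero
symmetricF   = ∀ᶠ (ν v0) (∀ᶠ (ν v1) (entryF (ν v2) (ν v1) (ν v0) ⇒ᶠ entryF (ν v2) (ν v0) (ν v1)))
irreflexiveF = ∀ᶠ (ν v0) (¬ᶠ entryF (ν v1) (ν v0) (ν v0))
nearF        = ∀ᶠ (ν v0) (∀ᶠ (ν v1) (ν v1 ≡ᶠ ν v0 ∨ᶠ entryF (ν v2) (ν v1) (ν v0) ∨ᶠ
                 ∃ᶠ (ν v2) (entryF (ν v3) (ν v2) (ν v0) ∧ᶠ entryF (ν v3) (ν v0) (ν v1))))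
farF         = ∃ᶠ (ν v0) (∃ᶠ (ν v1) (¬ᶠ (ν v1 ≡ᶠ ν v0) ∧ᶠ ¬ᶠ entryF (ν v2) (ν v1) (ν v0)))
chordalF     = ∀ᶠ (ν v0) (∀ᶠ (ν v1) (∀ᶠ (ν v2)
                 (entryF (ν v3) (ν v2) (ν v1) ∧ᶠ entryF (ν v3) (ν v2) (ν v0) ∧ᶠ ¬ᶠ (ν v1 ≡ᶠ ν v0) ∧ᶠ ¬ᶠ entryF (ν v3) (ν v1) (ν v0) ⇒ᶠ
                  separatorF (ν v3) (ν v2) (ν v1) (ν v0) (ν v1) ∧ᶠ
                  ¬ᶠ separatorF (ν v3) (ν v2) (ν v1) (ν v0) (ν v0) ∧ᶠ
                  ∀ᶠ (ν v3) (∀ᶠ (ν v4)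
                    (separatorF (ν (suc v4)) (ν v4) (ν v3) (ν v2) (ν v1) ∧ᶠ entryF (ν (suc v4)) (ν v1) (ν v0) ∧ᶠ
                     (ν v0 ≡ᶠ ν v2 ∨ᶠ ¬ᶠ (ν v0 ≡ᶠ ν v4) ∧ᶠ ¬ᶠ entryF (ν (suc v4)) (ν v4) (ν v0)) ⇒ᶠ
                     separatorF (ν (suc v4)) (ν v4) (ν v3) (ν v2) (ν v0))))))
coveredF     = ∀ᶠ (ν v0) (¬ᶠ selectedF (ν v1) (ν v0) ⇒ᶠ ∃ᶠ (ν v1) (∃ᶠ (ν v2)
                 (selectedF (ν v3) (ν v1) ∧ᶠ selectedF (ν v3) (ν v0) ∧ᶠ ν v1 <ᶠᵐ ν v0 ∧ᶠ ¬ᶠ entryF (ν v3) (ν v1) (ν v0) ∧ᶠ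
                  entryF (ν v3) (ν v1) (ν v2) ∧ᶠ entryF (ν v3) (ν v2) (ν v0) ∧ᶠ middleF (ν v3) (ν v1) (ν v0) (ν v2))))
-- The middle vertex is unique, since a pair may contribute only one path.
functionalF  = ∀ᶠ (ν v0) (∀ᶠ (ν v1) (∀ᶠ (ν v2) (∀ᶠ (ν v3)
                 (middleF (ν v4) (ν v3) (ν v2) (ν v1) ∧ᶠ middleF (ν v4) (ν v3) (ν v2) (ν v0) ⇒ᶠ ν v1 ≡ᶠ ν v0))))
-- `k` can be exponential in the length of the word. So the size of the selection is halved along
-- the digits of `k`, the least significant first, and what is left is compared with 0.
smallF       = iter (len zero ⊖ prefixT (ν v0)) (sum (ν v0) (term (selectedF (ν v1) (ν v0))))
                 (ν v1 ⊖ halveT (digit zero (prefixT (ν v2) ⊕ (len zero ⊖ prefixT (ν v2) ⊖ (lit 1 ⊕ ν v0)))) (ν v1)) ≡ᶠ lit 0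

verifierF : Fm 2 0
verifierF = ∃ᶠ (len zero) (shapeF ∧ᶠ symmetricF ∧ᶠ irreflexiveF ∧ᶠ nearF ∧ᶠ farF ∧ᶠ chordalF ∧ᶠ coveredF ∧ᶠ functionalF ∧ᶠ smallF)

-- Counting the selected vertices and comparing with a numeral

sumBelow-cons : ∀ k f → sumBelow (suc k) f ≡ f 0 + sumBelow k (f ∘ suc)
sumBelow-cons zero    f = refl
sumBelow-cons (suc k) f = trans (cong (f (suc k) +_) (sumBelow-cons k f))
  (trans (sym (+-assoc (f (suc k)) (f 0) _)) (trans (cong (_+ sumBelow k (f ∘ suc)) (+-comm (f (suc k)) (f 0))) (+-assoc (f 0) _ _)))

sumBelow-size : ∀ n {f} → (∀ i → f i ≤ 1) → sumBelow n f ≡ ∣ Vec.tabulate {n = n} (positive? ∘ f ∘ toℕ) ∣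
sumBelow-size zero    h = refl
sumBelow-size (suc n) {f} h = trans (sumBelow-cons n f) (first (f 0) (h 0))
  where
  first : ∀ x → x ≤ 1 → x + sumBelow n (f ∘ suc) ≡ ∣ positive? x ∷ Vec.tabulate {n = n} (positive? ∘ f ∘ suc ∘ toℕ) ∣
  first zero          _ = sumBelow-size n (h ∘ suc)
  first (suc zero)    _ = cong suc (sumBelow-size n (h ∘ suc))
  first (suc (suc _)) (s≤s ())

countdown-cong : ∀ k {g h : ℕ → ℕ → ℕ} → (∀ i x → i < k → g i x ≡ h i x) → ∀ x → countdown k g x ≡ countdown k h x
countdown-cong zero    e x = refl
countdown-cong (suc k) {g} {h} e x rewrite e k x ≤-refl = countdown-cong k (λ i x i<k → e i x (m≤n⇒m≤1+n i<k)) (x ∸ h k x)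

-- The index of `countdown` decreases, so counting it from the other end starts with the least
-- significant digit. Again the difference to the halved value is subtracted.
digitStep : Word → ℕ → ℕ → ℕ
digitStep R i x = x ∸ halve (digitOf R (length R ∸ suc i)) x

-- c ≤ 2 b + d holds iff the halving of c with respect to the digit d is ≤ b.
numeral-≤ : ∀ R c → countdown (length R) (digitStep R) c ≡ 0 ⇔ c ≤ ℕᵇ.toℕ (unbinary R)
numeral-≤ []      c = mk⇔ ≤-reflexive n≤0⇒n≡0
numeral-≤ (b ∷ R) c = mk⇔
  (λ e → to (Equivalence.to (numeral-≤ R _) (trans (sym rest) e)))
  (λ h → trans rest (Equivalence.from (numeral-≤ R _) (from h)))
  where
  d = suc (number b)
  n = ℕᵇ.toℕ (unbinary R)
  L = length R
  first : ∀ b {i} → i ≡ 0 → digitOf (b ∷ R) i ≡ suc (number b)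
  first true  refl = refl
  first false refl = refl
  later : ∀ b i x → i < L → x ∸ halve (digitOf (b ∷ R) (suc L ∸ suc i)) x ≡ digitStep R i x
  later b i x i<L with L ∸ i | +-∸-assoc 1 i<L
  later true  i x i<L | .(1 + (L ∸ suc i)) | refl = refl
  later false i x i<L | .(1 + (L ∸ suc i)) | refl = refl
  start-at : c ∸ (c ∸ halve (digitOf (b ∷ R) (suc L ∸ suc L)) c) ≡ halve d c
  start-at = trans (cong (λ e → c ∸ (c ∸ halve e c)) (first b (n∸n≡0 L))) (m∸[m∸n]≡n (halve-≤x d c))
  rest : countdown (suc L) (digitStep (b ∷ R)) c ≡ countdown L (digitStep R) (halve d c)
  rest = trans (cong (countdown L (digitStep (b ∷ R))) start-at) (countdown-cong L (later b) (halve d c))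
  value : ∀ b → ℕᵇ.toℕ (unbinary (b ∷ R)) ≡ n + n + suc (number b)
  value true  = ring n
    where
    ring : ∀ n → 2 * suc n ≡ n + n + 2
    ring = solve-∀
  value false = ring n
    where
    ring : ∀ n → 1 + 2 * n ≡ n + n + 1
    ring = solve-∀
  from : c ≤ ℕᵇ.toℕ (unbinary (b ∷ R)) → halve d c ≤ n
  from h = halve-≤ d c n (≤-trans h (≤-reflexive (value b)))
  to : halve d c ≤ n → c ≤ ℕᵇ.toℕ (unbinary (b ∷ R))
  to h = ≤-trans (≮⇒≥ λ lt → <⇒≱ (halve-> d c n lt) h) (≤-reflexive (sym (value b)))

digitOf-drop : ∀ m w j → digitOf (List.drop m w) j ≡ digitOf w (m + j)
digitOf-drop zero    w           j = refl
digitOf-drop (suc m) []          j = refl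
digitOf-drop (suc m) (false ∷ w) j = digitOf-drop m w j
digitOf-drop (suc m) (true ∷ w)  j = digitOf-drop m w j

digitOf-within : ∀ w i → i < length w → ∃[ b ] digitOf w i ≡ suc (number b)
digitOf-within (false ∷ w) zero    _       = false , refl
digitOf-within (true ∷ w)  zero    _       = true , refl
digitOf-within (false ∷ w) (suc i) (s≤s h) = digitOf-within w i h
digitOf-within (true ∷ w)  (suc i) (s≤s h) = digitOf-within w i h

∀-Fin : ∀ {n} {P : ℕ → Set} → (∀ (i : Fin n) → P (toℕ i)) → ∀ i → i < n → P i
∀-Fin {P = P} h i i<n = subst P (toℕ-fromℕ< i<n) (h (fromℕ< i<n))

∃-Fin : ∀ {n} {P : ℕ → Set} → (∃[ i ] i < n × P i) → Σ (Fin n) (P ∘ toℕ)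
∃-Fin {P = P} (i , i<n , p) = fromℕ< i<n , subst P (sym (toℕ-fromℕ< i<n)) p

does-true : ∀ {P : Set} (d : Dec P) → does d ≡ true → P
does-true (yes p) _ = p

-- The meaning of the verifier's formulas

module Semantics (w y : Word) (n : ℕ) where

  Entry : ℕ → ℕ → Set
  Entry u v = digitOf w (n + (1 + (n * u + v))) ≡ 2

  tableIndex : ℕ → ℕ → ℕ → ℕ → ℕ → ℕ
  tableIndex tag a b c d = n * (n * (n * n)) * tag + (n * (n * n) * a + (n * n * b + (n * c + d)))

  Table : ℕ → ℕ → ℕ → ℕ → ℕ → Set
  Table tag a b c d = digitOf y (tableIndex tag a b c d) ≡ 2

  prefix : ℕ
  prefix = n + (1 + n * n)

  numeral : Word
  numeral = List.drop prefix w

  isSelected : ℕ → ℕ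
  isSelected x = ⟦ term {2} {2} (selectedF (var v1) (var v0)) ⟧ (w ∷ y ∷ []) (x ∷ n ∷ [])

  isSelected-≤ : ∀ x → isSelected x ≤ 1
  isSelected-≤ x = m∸n≤m 1 (digitOf y (tableIndex 0 0 0 0 x) ∸ 2 + (2 ∸ digitOf y (tableIndex 0 0 0 0 x)))

  selected? : ℕ → Bool
  selected? = positive? ∘ isSelected

  selected⇒ : ∀ {x} → selected? x ≡ true → Table 0 0 0 0 x
  selected⇒ {x} e = holds⇒ (w ∷ y ∷ []) (selectedF (var v1) (var v0)) {x ∷ n ∷ []} (positive?-true e)

  ⇒selected : ∀ {x} → Table 0 0 0 0 x → selected? x ≡ true
  ⇒selected {x} h = true-positive? (⇒holds (w ∷ y ∷ []) (selectedF (var v1) (var v0)) {x ∷ n ∷ []} h)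

  selection : Subset n
  selection = Vec.tabulate (selected? ∘ toℕ)

  small⇔ : ⟦ smallF ⟧ᶠ (w ∷ y ∷ []) (n ∷ []) ⇔ ∣ selection ∣ ≤ ℕᵇ.toℕ (unbinary numeral)
  small⇔ = mk⇔
    (λ e → subst (_≤ K) size≡ (Equivalence.to (numeral-≤ numeral c) (trans (sym steps) e)))
    (λ h → trans steps (Equivalence.from (numeral-≤ numeral c) (subst (_≤ K) (sym size≡) h)))
    where
    K = ℕᵇ.toℕ (unbinary numeral)
    c = sumBelow n isSelected
    size≡ : c ≡ ∣ selection ∣
    size≡ = sumBelow-size n isSelected-≤
    L≡ : length numeral ≡ length w ∸ prefix
    L≡ = length-drop prefix w
    steps : countdown (length w ∸ prefix) (λ i x → x ∸ halve (digitOf w (prefix + (length w ∸ prefix ∸ (1 + i)))) x) c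
            ≡ countdown (length numeral) (digitStep numeral) c
    steps = subst (λ L → countdown L (λ i x → x ∸ halve (digitOf w (prefix + (L ∸ (1 + i)))) x) c
                         ≡ countdown (length numeral) (digitStep numeral) c) L≡
      (countdown-cong (length numeral) (λ i x _ → cong (λ d → x ∸ halve d x) (sym (digitOf-drop prefix w (length numeral ∸ suc i)))) c)

-- An accepted certificate yields a solvable instance

module FromFormula (w y : Word) (n : ℕ)
  (shape : ⟦ shapeF ⟧ᶠ (w ∷ y ∷ []) (n ∷ [])) (symmetric : ⟦ symmetricF ⟧ᶠ (w ∷ y ∷ []) (n ∷ []))
  (irreflexive : ⟦ irreflexiveF ⟧ᶠ (w ∷ y ∷ []) (n ∷ [])) (nearby : ⟦ nearF ⟧ᶠ (w ∷ y ∷ []) (n ∷ []))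
  (far : ⟦ farF ⟧ᶠ (w ∷ y ∷ []) (n ∷ [])) (separated : ⟦ chordalF ⟧ᶠ (w ∷ y ∷ []) (n ∷ []))
  (covered : ⟦ coveredF ⟧ᶠ (w ∷ y ∷ []) (n ∷ [])) (functional : ⟦ functionalF ⟧ᶠ (w ∷ y ∷ []) (n ∷ []))
  (small : ⟦ smallF ⟧ᶠ (w ∷ y ∷ []) (n ∷ [])) where

  open Semantics w y n

  adj : Fin n → Fin n → Bool
  adj u v = does (digitOf w (n + (1 + (n * toℕ u + toℕ v))) ≟ 2)

  adj⇒ : ∀ {u v} → adj u v ≡ true → Entry (toℕ u) (toℕ v)
  adj⇒ = does-true (_ ≟ 2)

  ⇒adj : ∀ {u v} → Entry (toℕ u) (toℕ v) → adj u v ≡ true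
  ⇒adj = dec-true (_ ≟ 2)

  graph : Graph
  graph = record
    { order = n
    ; adj = adj
    ; adj-sym = λ u v → 𝔹.⇔→≡ {z = true} (mk⇔
        (λ e → ⇒adj {v} {u} (symmetric (toℕ u) (toℕ<n u) (toℕ v) (toℕ<n v) (adj⇒ {u} {v} e)))
        (λ e → ⇒adj {u} {v} (symmetric (toℕ v) (toℕ<n v) (toℕ u) (toℕ<n u) (adj⇒ {v} {u} e))))
    ; irrefl = λ v → 𝔹.¬-not λ e → irreflexive (toℕ v) (toℕ<n v) (adj⇒ {v} {v} e)
    }

  open Graph graph using (Adj)

  near : ∀ u v → Near graph u v
  near u v with nearby (toℕ u) (toℕ<n u) (toℕ v) (toℕ<n v)
  ... | inj₁ e        = inj₁ (toℕ-injective e)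
  ... | inj₂ (inj₁ e) = inj₂ (inj₁ (⇒adj {u} {v} e))
  ... | inj₂ (inj₂ h) = let (x , e , f) = ∃-Fin {P = λ x → Entry (toℕ u) x × Entry x (toℕ v)} h
                        in inj₂ (inj₂ (x , ⇒adj {u} {x} e , ⇒adj {x} {v} f))

  diameter : HasDiameter graph 2
  diameter = let (u , h) = ∃-Fin {P = λ u → ∃[ v ] v < n × u ≢ v × ¬ Entry u v} far
                 (v , u≢v , ¬e) = ∃-Fin {P = λ v → toℕ u ≢ v × ¬ Entry (toℕ u) v} h
             in near⇒diameter graph near {u} {v} (u≢v ∘ cong toℕ) (¬e ∘ adj⇒ {u} {v})

  chordal : Chordal graph
  chordal = separated⇒chordal graph λ a b c ab ac b≢c ¬bc →
    let (Yb , ¬Yc , closed) = separated (toℕ a) (toℕ<n a) (toℕ b) (toℕ<n b) (toℕ c) (toℕ<n c)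
          (adj⇒ {a} {b} ab , adj⇒ {a} {c} ac , b≢c ∘ toℕ-injective , ¬bc ∘ ⇒adj {b} {c})
    in (λ x → Table 2 (toℕ a) (toℕ b) (toℕ c) (toℕ x)) , Yb , ¬Yc , λ x z Yx (xz , beside) →
       closed (toℕ x) (toℕ<n x) (toℕ z) (toℕ<n z) (Yx , adj⇒ {x} {z} xz ,
         [ inj₁ ∘ cong toℕ , (λ (z≢a , ¬az) → inj₂ (z≢a ∘ toℕ-injective , ¬az ∘ ⇒adj {a} {z})) ]′ beside)

  member? : ∀ x → selected? (toℕ x) ≡ true → x ∈ˢ selection
  member? x e = lookup⇒[]= x selection (trans (lookup∘tabulate (selected? ∘ toℕ) x) e)

  Mid : Fin n → Fin n → Fin n → Set
  Mid u v x = Table 1 0 (toℕ u) (toℕ v) (toℕ x)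

  Mid? : ∀ u v x → Dec (Mid u v x)
  Mid? u v x = digitOf y (tableIndex 1 0 (toℕ u) (toℕ v) (toℕ x)) ≟ 2

  mid : Fin n → Fin n → Fin n
  mid u v with 𝔽.any? (Mid? u v)
  ... | yes (x , _) = x
  ... | no _        = u

  mid≡ : ∀ {u v x} → Mid u v x → mid u v ≡ x
  mid≡ {u} {v} {x} m with 𝔽.any? (Mid? u v)
  ... | yes (x′ , m′) = toℕ-injective (functional (toℕ u) (toℕ<n u) (toℕ v) (toℕ<n v) (toℕ x′) (toℕ<n x′) (toℕ x) (toℕ<n x) (m′ , m))
  ... | no none       = contradiction (x , m) none

  Pair : ℕ → ℕ → ℕ → Set
  Pair x u v = Table 0 0 0 0 u × Table 0 0 0 0 v × u < v × ¬ Entry u v × Entry u x × Entry x v × Table 1 0 u v x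

  middle : MiddleSet graph selection mid
  middle x x∉ =
    let (u , h) = ∃-Fin {P = λ u → ∃[ v ] v < n × Pair (toℕ x) u v}
                    (covered (toℕ x) (toℕ<n x) λ s → x∉ (member? x (⇒selected s)))
        (v , su , sv , u<v , ¬uv , ux , xv , m) = ∃-Fin {P = Pair (toℕ x) (toℕ u)} h
    in u , v , member? u (⇒selected su) , member? v (⇒selected sv) , u<v , ¬uv ∘ adj⇒ {u} {v} , ⇒adj {u} {x} ux , ⇒adj {x} {v} xv , mid≡ m

  k : ℕ
  k = ℕᵇ.toℕ (unbinary numeral)

  long : prefix < length w
  long = proj₂ (proj₂ shape)

  k-positive : 1 ≤ k
  k-positive = nonempty numeral (subst (0 <_) (sym (length-drop prefix w)) (m<n⇒0<n∸m long))
    where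
    nonempty : ∀ R → 0 < length R → 1 ≤ ℕᵇ.toℕ (unbinary R)
    nonempty (true ∷ R)  _ = s≤s z≤n
    nonempty (false ∷ R) _ = s≤s z≤n

  entry-digit : ∀ i → i < length w → digitOf w i ≡ suc (number (does (digitOf w i ≟ 2)))
  entry-digit i i< with digitOf-within w i i<
  ... | true  , e rewrite e = refl
  ... | false , e rewrite e = refl

  -- Up to the terminator this is `shapeF`. In the matrix every digit is 1 or 2, so testing for 2
  -- recovers it, and the rest is a numeral because every word is the bijective numeral of its
  -- value.
  encodes : encodeGraphNumber graph k ≡ w
  encodes = digitOf-ext _ w λ i → case <-cmp i n of λ
    { (tri< i<n _ _)  → trans (encode-order graph k i<n) (sym (proj₁ shape i i<n))
    ; (tri≈ _ refl _) → trans (encode-terminator graph k) (sym (proj₁ (proj₂ shape)))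
    ; (tri> _ _ n<i)  → subst (λ i → digitOf (encodeGraphNumber graph k) i ≡ digitOf w i) (after n<i) (beyond (i ∸ suc n)) }
    where
    after : ∀ {i} → n < i → n + suc (i ∸ suc n) ≡ i
    after {i} n<i = trans (+-suc n (i ∸ suc n)) (m+[n∸m]≡n n<i)
    beyond : ∀ j → digitOf (encodeGraphNumber graph k) (n + suc j) ≡ digitOf w (n + suc j)
    beyond j with j <? n * n
    ... | yes j< = subst (λ j → digitOf (encodeGraphNumber graph k) (n + suc j) ≡ digitOf w (n + suc j)) j≡
          (trans (encode-entry graph k u v) (sym (entry-digit _ (≤-<-trans (≤-trans (≤-reflexive (cong (λ j → n + suc j) j≡)) (+-monoʳ-≤ n (s≤s (<⇒≤ j<)))) long))))
      where
      u = proj₁ (remQuot {n} n (fromℕ< j<))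
      v = proj₂ (remQuot {n} n (fromℕ< j<))
      j≡ : n * toℕ u + toℕ v ≡ j
      j≡ = trans (sym (toℕ-combine u v)) (trans (cong toℕ (combine-remQuot {n} n (fromℕ< j<))) (toℕ-fromℕ< j<))
    ... | no j≮ = subst (λ i → digitOf (encodeGraphNumber graph k) i ≡ digitOf w i) i≡
          (trans (encode-number graph k (j ∸ n * n)) (trans (cong (λ R → digitOf R (j ∸ n * n))
            (trans (cong binary (ℕᵇ.fromℕ-toℕ (unbinary numeral))) (binary-unbinary numeral))) (digitOf-drop prefix w (j ∸ n * n))))
      where
      i≡ : prefix + (j ∸ n * n) ≡ n + suc j
      i≡ = trans (+-assoc n (suc (n * n)) _) (cong (λ j → n + suc j) (m+[n∸m]≡n (≮⇒≥ j≮)))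

  accepted : DecisionProblem.language Problem w
  accepted = record { graph = graph ; connected = near⇒connected graph near ; inClass = chordal , diameter ; k = k ; positive = k-positive } ,
    encodes , selection , middle⇒strong graph near {mid = mid} middle , Equivalence.to small⇔ small

-- A solvable instance yields an accepted certificate

module ToFormula (G : Graph) (chordal : Chordal G) (diameter : HasDiameter G 2) (k : ℕ) (k-positive : 1 ≤ k)
  (S : Subset (Graph.order G)) (strong : StrongGeodeticSet G S) (small : ∣ S ∣ ≤ k) where

  open Graph G renaming (order to n)

  w : Word
  w = encodeGraphNumber G k

  near : ∀ u v → Near G u v
  near = diameter⇒near G diameter

  mid : Fin n → Fin n → Fin n
  mid = proj₁ (strong⇒middle G near strong)

  Sep : (a b c : Fin n) → Set
  Sep a b c = Adj a b × Adj a c × b ≢ c × ¬ Adj b c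

  sep? : ∀ a b c → Dec (Sep a b c)
  sep? a b c = Adj? G a b ×-dec (Adj? G a c ×-dec (¬? (b 𝔽.≟ c) ×-dec ¬? (Adj? G b c)))

  separator : ∀ {a b c} → Dec (Sep a b c) → Subset n
  separator (yes (ab , ac , b≢c , ¬bc)) = proj₁ (chordal⇒separated G chordal _ _ _ ab ac b≢c ¬bc)
  -- The formula asks for separators only where `Sep` holds; elsewhere any set will do.
  separator (no _)                      = S

  separates : ∀ {a b c} (d : Dec (Sep a b c)) → Sep a b c → Separates G (_∈ˢ separator d) a b c
  separates (yes (ab , ac , b≢c , ¬bc)) _ = proj₂ (chordal⇒separated G chordal _ _ _ ab ac b≢c ¬bc)
  separates (no ¬s) s = contradiction s ¬s

  table : Fin 3 → Fin n → Fin n → Fin n → Fin n → Bool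
  table v0 _ _ _ x = Vec.lookup S x
  table v1 _ u v x = does (mid u v 𝔽.≟ x)
  table v2 a b c x = Vec.lookup (separator (sep? a b c)) x

  entryAt : Fin (3 * (n * (n * (n * n)))) → Bool
  entryAt i =
    let (tag , i₁) = remQuot {3} (n * (n * (n * n))) i
        (a , i₂)   = remQuot {n} (n * (n * n)) i₁
        (b , i₃)   = remQuot {n} (n * n) i₂
        (c , d)    = remQuot {n} n i₃
    in table tag a b c d

  entryAt-combine : ∀ tag a b c d → entryAt (combine tag (combine a (combine b (combine c d)))) ≡ table tag a b c d
  entryAt-combine tag a b c d = begin
    at₁ (remQuot {3} (n * (n * (n * n))) (combine tag (combine a (combine b (combine c d)))))
      ≡⟨ cong at₁ (remQuot-combine {3} tag _) ⟩
    at₂ tag (remQuot {n} (n * (n * n)) (combine a (combine b (combine c d))))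
      ≡⟨ cong (at₂ tag) (remQuot-combine {n} a _) ⟩
    at₃ tag a (remQuot {n} (n * n) (combine b (combine c d)))
      ≡⟨ cong (at₃ tag a) (remQuot-combine {n} b _) ⟩
    at₄ tag a b (remQuot {n} n (combine c d))
      ≡⟨ cong (at₄ tag a b) (remQuot-combine {n} c d) ⟩
    table tag a b c d ∎
    where
    open ≡-Reasoning
    at₄ : Fin 3 → Fin n → Fin n → Fin n × Fin n → Bool
    at₄ tag a b (c , d) = table tag a b c d
    at₃ : Fin 3 → Fin n → Fin n × Fin (n * n) → Bool
    at₃ tag a (b , i) = at₄ tag a b (remQuot {n} n i)
    at₂ : Fin 3 → Fin n × Fin (n * (n * n)) → Bool
    at₂ tag (a , i) = at₃ tag a (remQuot {n} (n * n) i)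
    at₁ : Fin 3 × Fin (n * (n * (n * n))) → Bool
    at₁ (tag , i) = at₂ tag (remQuot {n} (n * (n * n)) i)

  y : Word
  y = List.tabulate entryAt

  open Semantics w y n

  table-digit : ∀ tag a b c d → digitOf y (tableIndex (toℕ tag) (toℕ a) (toℕ b) (toℕ c) (toℕ d)) ≡ suc (number (table tag a b c d))
  table-digit tag a b c d = trans (cong (digitOf y) (sym index≡))
    (trans (digitOf-tabulate entryAt (combine tag (combine a (combine b (combine c d))))) (cong (suc ∘ number) (entryAt-combine tag a b c d)))
    where
    index≡ : toℕ (combine tag (combine a (combine b (combine c d)))) ≡ tableIndex (toℕ tag) (toℕ a) (toℕ b) (toℕ c) (toℕ d)
    index≡ = trans (toℕ-combine tag _) (cong (_ +_) (trans (toℕ-combine a _) (cong (_ +_) (trans (toℕ-combine b _) (cong (_ +_) (toℕ-combine c d))))))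

  Table⇒ : ∀ tag {a b c d} → Table (toℕ tag) (toℕ a) (toℕ b) (toℕ c) (toℕ d) → table tag a b c d ≡ true
  Table⇒ tag {a} {b} {c} {d} h = number-injective (suc-injective (trans (sym (table-digit tag a b c d)) h))

  ⇒Table : ∀ tag {a b c d} → table tag a b c d ≡ true → Table (toℕ tag) (toℕ a) (toℕ b) (toℕ c) (toℕ d)
  ⇒Table tag {a} {b} {c} {d} e = trans (table-digit tag a b c d) (cong (suc ∘ number) e)

  entry⇒ : ∀ {u v} → Entry (toℕ u) (toℕ v) → Adj u v
  entry⇒ {u} {v} h = number-injective (suc-injective (trans (sym (encode-entry G k u v)) h))

  ⇒entry : ∀ {u v} → Adj u v → Entry (toℕ u) (toℕ v)
  ⇒entry {u} {v} e = trans (encode-entry G k u v) (cong (suc ∘ number) e)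

  -- Predicates of fewer than four vertices are padded with the vertex 0, which exists as soon as
  -- there is some vertex `x`.
  origin# : Fin n → Fin n
  origin# x = fromℕ< {0} (≤-<-trans z≤n (toℕ<n x))

  selected⇒∈ : ∀ {x} → Table 0 0 0 0 (toℕ x) → x ∈ˢ S
  selected⇒∈ {x} h = lookup⇒[]= x S (Table⇒ v0 {origin# x} {origin# x} {origin# x} {x}
    (subst (λ z → Table 0 z z z (toℕ x)) (sym (toℕ-fromℕ< {0} (≤-<-trans z≤n (toℕ<n x)))) h))

  ∈⇒selected : ∀ {x} → x ∈ˢ S → Table 0 0 0 0 (toℕ x)
  ∈⇒selected {x} x∈ = subst (λ z → Table 0 z z z (toℕ x)) (toℕ-fromℕ< {0} (≤-<-trans z≤n (toℕ<n x)))
    (⇒Table v0 {origin# x} {origin# x} {origin# x} {x} ([]=⇒lookup x∈))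

  middle⇒ : ∀ {u v x} → Table 1 0 (toℕ u) (toℕ v) (toℕ x) → mid u v ≡ x
  middle⇒ {u} {v} {x} h = does-true (mid u v 𝔽.≟ x) (Table⇒ v1 {origin# x} {u} {v} {x}
    (subst (λ z → Table 1 z (toℕ u) (toℕ v) (toℕ x)) (sym (toℕ-fromℕ< {0} (≤-<-trans z≤n (toℕ<n x)))) h))

  ⇒middle : ∀ {u v x} → mid u v ≡ x → Table 1 0 (toℕ u) (toℕ v) (toℕ x)
  ⇒middle {u} {v} {x} e = subst (λ z → Table 1 z (toℕ u) (toℕ v) (toℕ x)) (toℕ-fromℕ< {0} (≤-<-trans z≤n (toℕ<n x)))
    (⇒Table v1 {origin# x} {u} {v} {x} (dec-true (mid u v 𝔽.≟ x) e))

  separator⇒ : ∀ {a b c x} → Table 2 (toℕ a) (toℕ b) (toℕ c) (toℕ x) → x ∈ˢ separator (sep? a b c)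
  separator⇒ {a} {b} {c} {x} h = lookup⇒[]= x _ (Table⇒ v2 {a} {b} {c} {x} h)

  ⇒separator : ∀ {a b c x} → x ∈ˢ separator (sep? a b c) → Table 2 (toℕ a) (toℕ b) (toℕ c) (toℕ x)
  ⇒separator {a} {b} {c} {x} x∈ = ⇒Table v2 {a} {b} {c} {x} ([]=⇒lookup x∈)

  Holds′ : Fm 2 1 → Set
  Holds′ φ = ⟦ φ ⟧ᶠ (w ∷ y ∷ []) (n ∷ [])

  R : Word
  R = binary (ℕᵇ.fromℕ k)

  R-nonempty : 0 < length R
  R-nonempty with ℕᵇ.fromℕ k | ℕᵇ.toℕ-fromℕ k
  ... | ℕᵇ.zero  | e = contradiction (subst (1 ≤_) (sym e) k-positive) λ ()
  ... | 2[1+ _ ] | _ = s≤s z≤n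
  ... | 1+[2 _ ] | _ = s≤s z≤n

  shape : Holds′ shapeF
  shape = (λ i i<n → encode-order G k i<n) , encode-terminator G k ,
    ≤-trans (≤-trans (≤-reflexive (+-comm 1 prefix)) (+-monoʳ-≤ prefix R-nonempty)) (≤-reflexive (sym (encode-length G k)))

  symmetric : Holds′ symmetricF
  symmetric = ∀-Fin {P = λ u → ∀ v → v < n → Entry u v → Entry v u} λ u → ∀-Fin {P = λ v → Entry (toℕ u) v → Entry v (toℕ u)} λ v e →
    ⇒entry {v} {u} (Adj-sym G (entry⇒ {u} {v} e))

  irreflexive : Holds′ irreflexiveF
  irreflexive = ∀-Fin {P = λ v → ¬ Entry v v} λ v e → Adj-irrefl G (entry⇒ {v} {v} e) refl

  nearby : Holds′ nearF
  nearby = ∀-Fin {P = λ u → ∀ v → v < n → u ≡ v ⊎ Entry u v ⊎ (∃[ x ] x < n × Entry u x × Entry x v)} λ u →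
    ∀-Fin {P = λ v → toℕ u ≡ v ⊎ Entry (toℕ u) v ⊎ (∃[ x ] x < n × Entry (toℕ u) x × Entry x v)} λ v → close u v (near u v)
    where
    close : ∀ u v → Near G u v → toℕ u ≡ toℕ v ⊎ Entry (toℕ u) (toℕ v) ⊎ (∃[ x ] x < n × Entry (toℕ u) x × Entry x (toℕ v))
    close u v (inj₁ e)                  = inj₁ (cong toℕ e)
    close u v (inj₂ (inj₁ e))           = inj₂ (inj₁ (⇒entry {u} {v} e))
    close u v (inj₂ (inj₂ (x , e , f))) = inj₂ (inj₂ (toℕ x , toℕ<n x , ⇒entry {u} {x} e , ⇒entry {x} {v} f))

  far : Holds′ farF
  far = let (u , v , u≢v , ¬e) = diameter⇒far G diameter in
    toℕ u , toℕ<n u , toℕ v , toℕ<n v , u≢v ∘ toℕ-injective , ¬e ∘ entry⇒ {u} {v}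

  Separated : ℕ → ℕ → ℕ → Set
  Separated a b c = Entry a b × Entry a c × b ≢ c × ¬ Entry b c → Table 2 a b c b × ¬ Table 2 a b c c ×
    (∀ x → x < n → ∀ z → z < n → Table 2 a b c x × Entry x z × (z ≡ c ⊎ z ≢ a × ¬ Entry a z) → Table 2 a b c z)

  separated : Holds′ chordalF
  separated = ∀-Fin {P = λ a → ∀ b → b < n → ∀ c → c < n → Separated a b c} λ a →
    ∀-Fin {P = λ b → ∀ c → c < n → Separated (toℕ a) b c} λ b → ∀-Fin {P = Separated (toℕ a) (toℕ b)} λ c → separated-at a b c
    where
    separated-at : ∀ a b c → Separated (toℕ a) (toℕ b) (toℕ c)
    separated-at a b c (ab , ac , b≢c , ¬bc) = ⇒separator {a} {b} {c} {b} (proj₁ s) , proj₁ (proj₂ s) ∘ separator⇒ {a} {b} {c} {c} ,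
      ∀-Fin {P = λ x → ∀ z → z < n → Table 2 (toℕ a) (toℕ b) (toℕ c) x × Entry x z × (z ≡ toℕ c ⊎ z ≢ toℕ a × ¬ Entry (toℕ a) z) → Table 2 (toℕ a) (toℕ b) (toℕ c) z} λ x →
      ∀-Fin {P = λ z → Table 2 (toℕ a) (toℕ b) (toℕ c) (toℕ x) × Entry (toℕ x) z × (z ≡ toℕ c ⊎ z ≢ toℕ a × ¬ Entry (toℕ a) z) → Table 2 (toℕ a) (toℕ b) (toℕ c) z} λ z (Yx , xz , beside) →
      ⇒separator {a} {b} {c} {z} (proj₂ (proj₂ s) x z (separator⇒ {a} {b} {c} {x} Yx) (entry⇒ {x} {z} xz ,
        [ inj₁ ∘ toℕ-injective , (λ (z≢a , ¬az) → inj₂ (z≢a ∘ cong toℕ , ¬az ∘ ⇒entry {a} {z})) ]′ beside))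
      where
      s = separates (sep? a b c) (entry⇒ {a} {b} ab , entry⇒ {a} {c} ac , b≢c ∘ cong toℕ , ¬bc ∘ ⇒entry {b} {c})

  Pair : ℕ → ℕ → ℕ → Set
  Pair x u v = Table 0 0 0 0 u × Table 0 0 0 0 v × u < v × ¬ Entry u v × Entry u x × Entry x v × Table 1 0 u v x

  covered : Holds′ coveredF
  covered = ∀-Fin {P = λ x → ¬ Table 0 0 0 0 x → ∃[ u ] u < n × (∃[ v ] v < n × Pair x u v)} λ x x∉ →
    let (u , v , u∈ , v∈ , u<v , ¬uv , ux , xv , m) = proj₂ (strong⇒middle G near strong) x (x∉ ∘ ∈⇒selected {x})
    in toℕ u , toℕ<n u , toℕ v , toℕ<n v , ∈⇒selected {u} u∈ , ∈⇒selected {v} v∈ , u<v , ¬uv ∘ entry⇒ {u} {v} ,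
       ⇒entry {u} {x} ux , ⇒entry {x} {v} xv , ⇒middle {u} {v} {x} m

  functional : Holds′ functionalF
  functional = ∀-Fin {P = λ u → ∀ v → v < n → ∀ x → x < n → ∀ z → z < n → Table 1 0 u v x × Table 1 0 u v z → x ≡ z} λ u →
    ∀-Fin {P = λ v → ∀ x → x < n → ∀ z → z < n → Table 1 0 (toℕ u) v x × Table 1 0 (toℕ u) v z → x ≡ z} λ v →
    ∀-Fin {P = λ x → ∀ z → z < n → Table 1 0 (toℕ u) (toℕ v) x × Table 1 0 (toℕ u) (toℕ v) z → x ≡ z} λ x →
    ∀-Fin {P = λ z → Table 1 0 (toℕ u) (toℕ v) (toℕ x) × Table 1 0 (toℕ u) (toℕ v) z → toℕ x ≡ z} λ z (h , h′) →
    cong toℕ (trans (sym (middle⇒ {u} {v} {x} h)) (middle⇒ {u} {v} {z} h′))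

  few : Holds′ smallF
  few = Equivalence.from small⇔ (subst₂ _≤_ (cong ∣_∣ selection≡) (trans (sym (ℕᵇ.toℕ-fromℕ k)) (cong ℕᵇ.toℕ (sym numeral≡))) small)
    where
    selection≡ : S ≡ selection
    selection≡ = trans (sym (tabulate∘lookup S)) (Vec-tabulate-cong λ x → 𝔹.⇔→≡ {z = true} (mk⇔
      (λ e → ⇒selected (∈⇒selected {x} (lookup⇒[]= x S e)))
      (λ e → []=⇒lookup (selected⇒∈ {x} (selected⇒ e)))))
    numeral≡ : unbinary numeral ≡ ℕᵇ.fromℕ k
    numeral≡ = trans (cong unbinary (digitOf-ext numeral R λ i →
      trans (digitOf-drop prefix w i) (encode-number G k i))) (unbinary-binary _)

  holds : ⟦ verifierF ⟧ᶠ (w ∷ y ∷ []) []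
  holds = n , ≤-<-trans (m≤m+n n _) (proj₂ (proj₂ shape)) ,
    shape , symmetric , irreflexive , nearby , far , separated , covered , functional , few

  y-length : length y ≡ 3 * (n * (n * (n * n)))
  y-length = length-tabulate entryAt

certificate-poly : IsPoly (λ x → 3 * (x * (x * (x * x))))
certificate-poly = poly-* (poly-const 3) (poly-* poly-id (poly-* poly-id (poly-* poly-id poly-id)))

verify : Vec Word 2 → Word
verify ws = ⟦ emit (term verifierF) ⟧ᵒ ws []

verified : ∀ w → DecisionProblem.language Problem w ⇔
  (∃[ y ] length y ≤ eval (proj₁ certificate-poly) (length w) × verify (w ∷ y ∷ []) ≡ true ∷ [])
verified w = mk⇔ to from
  where
  to : DecisionProblem.language Problem w → ∃[ y ] length y ≤ eval (proj₁ certificate-poly) (length w) × verify (w ∷ y ∷ []) ≡ true ∷ []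
  to (i , refl , S , strong , small) = y ,
      ≤-trans (≤-reflexive y-length) (≤-trans (*-monoʳ-≤ 3 (*-mono-≤ n≤ (*-mono-≤ n≤ (*-mono-≤ n≤ n≤))))
        (≤-reflexive (proj₂ certificate-poly (length w)))) ,
      cong (_∷ []) (true-positive? (⇒holds (w ∷ y ∷ []) verifierF {[]} holds))
    where
    open StrongGeodeticInstance i
    open ToFormula graph (proj₁ inClass) (proj₂ inClass) k positive S strong small using (y; y-length; holds)
    n≤ : Graph.order graph ≤ length w
    n≤ = ≤-trans (m≤m+n (Graph.order graph) _) (≤-trans (m≤m+n _ _) (≤-reflexive (sym (encode-length graph k))))
  from : (∃[ y ] length y ≤ eval (proj₁ certificate-poly) (length w) × verify (w ∷ y ∷ []) ≡ true ∷ []) → DecisionProblem.language Problem w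
  from (y , _ , e) =
    let (n , _ , s , sy , ir , ne , fa , se , co , fu , sm) = holds⇒ (w ∷ y ∷ []) verifierF {[]} (positive?-true (∷-injectiveˡ e))
    in FromFormula.accepted w y n s sy ir ne fa se co fu sm

membership : NP (DecisionProblem.language Problem)
membership = verify , polyTime (emit (term verifierF)) , proj₁ certificate-poly , verified

theorem7 : NPComplete (StrongGeodetic (λ G → Chordal G × HasDiameter G 2))
theorem7 = membership , hard
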